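{- For every integer $k$, there are only finitely many simple holomorphic eta quotients of weight $k/2$; that is, the set of all simple holomorphic eta quotients of weight $k/2$ (of arbitrary level) is finite.
   Context: Let $\mathfrak{H}=\{z\in\mathbb{C}: \operatorname{Im}(z)>0\}$ and let $\eta(z)=q^{1/24}\prod_{n=1}^\infty(1-q^n)$, where $q^r=e^{2\pi i r z}$, be the Dedekind eta function on $\mathfrak{H}$. For a positive integer $d$ put $\eta_d(z)=\eta(dz)$. An eta quotient is a function on $\mathfrak{H}$ given by a finite product $f=\prod_{d}\eta_d^{X_d}$ with $d$ ranging over positive integers and $X_d\in\mathbb{Z}$ (the exponents are uniquely determined by $f$). Its weight is $\frac12\sum_d X_d$ and its level is $N=\operatorname{lcm}\{d: X_d\neq 0\}$. For a positive integer $M$, an eta quotient on $\Gamma_0(M)$ is an eta quotient whose level divides $M$. An eta quotient of level $N$ is called holomorphic if it has no pole at any cusp of $\Gamma_0(N)$. (For an eta quotient $f=\prod_{d\mid M}\eta_d^{X_d}$ on $\Gamma_0(M)$, the order at a cusp $a/t$ with $t\mid M$, $\gcd(a,t)=1$, is $\frac1{24}\sum_{d\mid M}\frac{M\gcd(d,t)^2}{d\,\gcd(t^2,M)}X_d$, so holomorphy means that these numbers are nonnegative for all $t\mid M$.) An eta quotient $f$ is primitive if there do not exist an eta quotient $h\neq f$ and a positive integer $\nu$ such that $f(z)=h(\nu z)$ for all $z\in\mathfrak{H}$. A holomorphic eta quotient $f$ on $\Gamma_0(M)$ is factorizable on $\Gamma_0(M)$ if $f=g\cdot h$ for some nonconstant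 holomorphic eta quotients $g,h$ on $\Gamma_0(M)$. A holomorphic eta quotient of level $N$ is quasi-irreducible if it is not factorizable on $\Gamma_0(N)$. A holomorphic eta quotient is simple if it is both primitive and quasi-irreducible. -}

module Defs where

open import Data.Integer using (ℤ; +_; 0ℤ) renaming (_+_ to _+ℤ_; _*_ to _*ℤ_)
import Data.Integer.Properties as ℤ
open import Data.List using (List; foldr; map; filter; upTo)
open import Data.List.Relation.Unary.Any using (Any)
open import Data.Nat
  using (ℕ; suc; _*_; _^_; _/_; _⊔_; _<_; NonZero; ≢-nonZero; ≢-nonZero⁻¹)
open import Data.Nat.Divisibility using (_∣_; _∣?_; divides)
open import Data.Nat.DivMod using (0/n≡0; m*n/n≡m)
open import Data.Nat.GCD using (gcd; gcd[m,n]≢0)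
open import Data.Nat.LCM using (lcm)
open import Data.Nat.Properties
  using (≤-<-trans; m≤m⊔n; m≤n⊔m; *-cancelʳ-<; m*n≢0; m^n≢0)
open import Data.Product using (_×_; Σ-syntax; ∃-syntax)
open import Data.Rational using (ℚ; 0ℚ) renaming (_≤_ to _≤ℚ_; _/_ to _/ℚ_)
open import Data.Sum using (inj₁)
open import Relation.Binary.PropositionalEquality
open import Relation.Nullary using (¬_; yes; no; ¬?)

-- The eta quotient ∏ η(dz)^(X d), over d ≥ 1, represented by its exponents
-- X : ℕ → ℤ; this loses nothing, since the function determines the exponents.
-- The index 0 is not a legitimate d, hence the convention X 0 = 0.
record EtaQuotient : Set where
  field
    exponent   : ℕ → ℤ
    exponent-0 : exponent 0 ≡ 0ℤ
    bound      : ℕ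
    vanishes   : ∀ d → bound < d → exponent d ≡ 0ℤ

open EtaQuotient public

-- Equality of eta quotients as functions; it must ignore the choice of `bound`.
infix 4 _≈_
_≈_ : EtaQuotient → EtaQuotient → Set
f ≈ g = ∀ d → exponent f d ≡ exponent g d

𝟏 : EtaQuotient
𝟏 = record { exponent = λ _ → 0ℤ ; exponent-0 = refl ; bound = 0 ; vanishes = λ _ _ → refl }

infixl 7 _·_
_·_ : EtaQuotient → EtaQuotient → EtaQuotient
f · g = record
  { exponent   = λ d → exponent f d +ℤ exponent g d
  ; exponent-0 = cong₂ _+ℤ_ (exponent-0 f) (exponent-0 g)
  ; bound      = bound f ⊔ bound g
  ; vanishes   = λ d b<d → cong₂ _+ℤ_
      (vanishes f d (≤-<-trans (m≤m⊔n (bound f) (bound g)) b<d))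
      (vanishes g d (≤-<-trans (m≤n⊔m (bound f) (bound g)) b<d))
  }

rescaleExponent : (ν : ℕ) .{{_ : NonZero ν}} → (ℕ → ℤ) → ℕ → ℤ
rescaleExponent ν X d with ν ∣? d
... | yes _ = X (d / ν)
... | no  _ = 0ℤ

-- The function z ↦ h(νz): each factor η(dz) of h becomes η(dνz).
rescale : (ν : ℕ) .{{_ : NonZero ν}} → EtaQuotient → EtaQuotient
rescale ν h = record
  { exponent   = rescaleExponent ν (exponent h)
  ; exponent-0 = at-0
  ; bound      = bound h * ν
  ; vanishes   = above
  }
  where
  at-0 : rescaleExponent ν (exponent h) 0 ≡ 0ℤ
  at-0 with ν ∣? 0
  ... | yes _ = trans (cong (exponent h) (0/n≡0 ν)) (exponent-0 h)
  ... | no  _ = refl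

  above : ∀ d → bound h * ν < d → rescaleExponent ν (exponent h) d ≡ 0ℤ
  above d b<d with ν ∣? d
  ... | no  _                = refl
  ... | yes (divides q refl) =
    trans (cong (exponent h) (m*n/n≡m q ν)) (vanishes h q (*-cancelʳ-< ν (bound h) q b<d))

sumℤ : List ℤ → ℤ
sumℤ = foldr _+ℤ_ 0ℤ

support : EtaQuotient → List ℕ
support f = filter (λ d → ¬? (exponent f d ℤ.≟ 0ℤ)) (upTo (suc (bound f)))

weight : EtaQuotient → ℚ
weight f = sumℤ (map (exponent f) (support f)) /ℚ 2

level : EtaQuotient → ℕ
level f = foldr lcm 1 (support f)

On-Γ₀ : ℕ → EtaQuotient → Set
On-Γ₀ M f = level f ∣ M

cuspDenominator≢0 : (M t : ℕ) .{{_ : NonZero t}} → NonZero (24 * gcd (t ^ 2) M)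
cuspDenominator≢0 M t = m*n≢0 24 (gcd (t ^ 2) M) {{_}} {{gcd≢0}}
  where
  gcd≢0 : NonZero (gcd (t ^ 2) M)
  gcd≢0 = ≢-nonZero (gcd[m,n]≢0 (t ^ 2) M (inj₁ (≢-nonZero⁻¹ (t ^ 2) {{m^n≢0 t 2}})))

-- The order at a cusp a/t of Γ₀(M), t ∣ M and gcd(a,t) = 1, of an eta quotient f
-- on Γ₀(M), which does not depend on a:
--
--   1/24 · Σ_{d ∣ M} (M · gcd(d,t)² / (d · gcd(t²,M))) · X d .
--
-- The d-independent denominator 24 · gcd(t²,M) is taken out of the sum, where
-- d = suc i and the quotient M / d of natural numbers is exact.
order : (M t : ℕ) .{{_ : NonZero t}} → EtaQuotient → ℚ
order M t f =
  _/ℚ_ (sumℤ (map term (filter (λ i → suc i ∣? M) (upTo M))))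
       (24 * gcd (t ^ 2) M) {{cuspDenominator≢0 M t}}
  where
  term : ℕ → ℤ
  term i = + ((M / suc i) * gcd (suc i) t ^ 2) *ℤ exponent f (suc i)

Holomorphic : EtaQuotient → Set
Holomorphic f = ∀ t .{{_ : NonZero t}} → t ∣ level f → 0ℚ ≤ℚ order (level f) t f

Primitive : EtaQuotient → Set
Primitive f =
  ¬ (Σ[ h ∈ EtaQuotient ] Σ[ ν ∈ ℕ ] Σ[ ν≢0 ∈ NonZero ν ]
      (¬ (h ≈ f) × f ≈ rescale ν {{ν≢0}} h))

-- An eta quotient is constant only if it is 1, as its q-expansion has leading
-- coefficient 1.
Nonconstant : EtaQuotient → Set
Nonconstant f = ¬ (f ≈ 𝟏)

FactorizableOn-Γ₀ : ℕ → EtaQuotient → Set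
FactorizableOn-Γ₀ M f =
  ∃[ g ] ∃[ h ]
    ( (On-Γ₀ M g × Holomorphic g × Nonconstant g)
    × (On-Γ₀ M h × Holomorphic h × Nonconstant h)
    × f ≈ g · h )

QuasiIrreducible : EtaQuotient → Set
QuasiIrreducible f = Holomorphic f × ¬ FactorizableOn-Γ₀ (level f) f

Simple : EtaQuotient → Set
Simple f = Primitive f × QuasiIrreducible f

-- A set of eta quotients is finite if some finite list exhausts it.
Finite : (EtaQuotient → Set) → Set
Finite P = ∃[ fs ] (∀ f → P f → Any (f ≈_) fs)

-- An eta quotient of level N is a function X on the exponent vectors of the divisors
-- of N, and it is holomorphic iff its potential V(u) = Σ_v X(v) K(u,v) is nonnegative,
-- where K(u,v) = 1 / dist(u,v) and dist(u,v) = ∏ p^|u_p - v_p| = uv / gcd(u,v)².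
-- Inverting K gives Σ |X| ≤ σ Σ X with σ ≤ ∏_{p | N} (1 + 16/p), which by Chebyshev's
-- estimate is polynomial in log log N.
--
-- Cover the support by boxes, starting from single points and merging two boxes as
-- long as a point of one is within distance R of the other.  If R is a large multiple
-- of σ² k, clamping to a box shows that each of the remaining clusters has positive
-- weight, so there are at most k of them; if moreover R exceeds the product D of the
-- diameters by a factor σ k, then each cluster is holomorphic by itself, as its
-- potential has denominator at most D.  Quasi-irreducibility leaves one cluster, and
-- primitivity bounds N by its diameter D, where log D is polynomial in σ.  So N is
-- bounded in terms of k, and then so is X.
module Submission where

-- The bound on N is circular, because σ depends on the primes of N. It closes as follows: if N ≤
-- 2^(2^L), then N has at most 2^L prime factors, σ is polynomial in L, and the clusters bound log N
-- by a polynomial in L, which is below 2^(L-1) once L is large.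
--
-- This is also what forces two passes of merging. With a threshold that exceeds the product D of
-- the diameters, a merge may square D, so log D can grow by the factor 2 to the number of merges.
-- Starting from the points of the support, of which there may be σ k, that would be exponential in
-- σ. A threshold independent of D only multiplies D by a fixed factor per merge, and it already
-- leaves at most k clusters. The squarings that follow then number at most k and cost only the
-- constant 2^k.

module PrimeProducts where

  open import Data.List using (List; []; _∷_; map; length; filter)
  open import Data.List.Relation.Unary.All as All using (All; []; _∷_)
  import Data.List.Relation.Unary.All.Properties as All
  open import Data.List.Properties using (length-filter; map-id)
  open import Data.List.Relation.Unary.Unique.Propositional using (Unique; []; _∷_)
  import Data.List.Relation.Unary.Unique.Propositional.Properties as Unique
  open import Data.Nat
  open import Data.Nat.Combinatorics using (k![n∸k]!∣n!)
  open import Data.Nat.Divisibility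
  open import Data.Nat.ListAction using (product)
  open import Data.Nat.Primality using (Prime; euclidsLemma; prime⇒irreducible; ¬prime[0]; ¬prime[1]; productOfPrimes≢0)
  open import Data.Nat.Properties
  open import Data.Nat.Solver using (module +-*-Solver)
  open import Data.Sum using (inj₁; inj₂)
  open import Function using (_∘_)
  open import Relation.Binary.PropositionalEquality hiding (J)
  open import Relation.Unary using (Decidable)
  open import Relation.Nullary using (yes; no; contradiction; ¬?)
  open +-*-Solver using (solve; _:=_; _:+_; _:*_; con)

  -- Products over distinct primes: Chebyshev's estimate and the growth of ∏ (1 + 1/p)

  *-interchange : ∀ a b c d → (a * b) * (c * d) ≡ (a * c) * (b * d)
  *-interchange = solve 4 (λ a b c d → (a :* b) :* (c :* d) := (a :* c) :* (b :* d)) refl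

  prime-∣-prime : ∀ {p q} → Prime p → Prime q → p ∣ q → p ≡ q
  prime-∣-prime pp pq p∣q with prime⇒irreducible pq p∣q
  ... | inj₁ refl = contradiction pp ¬prime[1]
  ... | inj₂ p≡q  = p≡q

  prime-∤-product : ∀ {p ps} → Prime p → All Prime ps → All (p ≢_) ps → p ∤ product ps
  prime-∤-product pp []       _          p∣1 with refl ← ∣1⇒≡1 p∣1 = ¬prime[1] pp
  prime-∤-product {p} {q ∷ ps} pp (pq ∷ h) (p≢q ∷ p≢) p∣ with euclidsLemma q (product ps) pp p∣
  ... | inj₁ p∣q = p≢q (prime-∣-prime pp pq p∣q)
  ... | inj₂ p∣Π = prime-∤-product pp h p≢ p∣Π

  product-∣ : ∀ {ps n} → Unique ps → All Prime ps → All (_∣ n) ps → product ps ∣ n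
  product-∣ []       []       []         = 1∣ _
  product-∣ {p ∷ ps} (p≢ ∷ u) (pp ∷ h) (p∣n ∷ ∣n) with product-∣ u h ∣n
  ... | divides q refl with euclidsLemma q (product ps) pp p∣n
  ... | inj₁ p∣q = *-monoˡ-∣ (product ps) p∣q
  ... | inj₂ p∣Π = contradiction p∣Π (prime-∤-product pp h p≢)

  prime-∣-! : ∀ {p} m → Prime p → p ∣ m ! → p ≤ m
  prime-∣-! zero    pp p∣ with refl ← ∣1⇒≡1 p∣ = contradiction pp ¬prime[1]
  prime-∣-! (suc m) pp p∣ with euclidsLemma (suc m) (m !) pp p∣
  ... | inj₁ p∣suc = ∣⇒≤ p∣suc
  ... | inj₂ p∣m!  = m≤n⇒m≤1+n (prime-∣-! m pp p∣m!)

  -- From n to n + 1 the central binomial coefficient grows by the factor (2n+2)(2n+1)/(n+1)² < 4.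
  central-bound : ∀ n → (n + n) ! ≤ 4 ^ n * (n ! * n !)
  central-bound zero    = ≤-refl
  central-bound (suc n) rewrite +-suc n n = begin
    (2 + (n + n)) * ((1 + (n + n)) * (n + n) !)
      ≤⟨ *-monoʳ-≤ (2 + (n + n)) (*-mono-≤ (n≤1+n (1 + (n + n))) (central-bound n)) ⟩
    (2 + (n + n)) * ((2 + (n + n)) * (4 ^ n * (n ! * n !)))
      ≡⟨ solve 3 (λ n p f → (con 2 :+ (n :+ n)) :* ((con 2 :+ (n :+ n)) :* (p :* (f :* f)))
           := (con 4 :* p) :* (((con 1 :+ n) :* f) :* ((con 1 :+ n) :* f))) refl n (4 ^ n) (n !) ⟩
    4 ^ suc n * (suc n ! * suc n !) ∎
    where open ≤-Reasoning

  -- Chebyshev's argument: a prime in (n, 2n] divides (2n)! but not n!, so it divides the central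
  -- binomial coefficient `q`.
  block-product : ∀ {n ps} → Unique ps → All Prime ps → All (n <_) ps → All (_≤ n + n) ps → product ps ≤ 4 ^ n
  block-product {n} {ps} u h n< ≤2n with k![n∸k]!∣n! (m≤m+n n n)
  ... | divides q eq = ≤-trans (∣⇒≤ {{q≢0}} (product-∣ u h (∣q h n< ≤2n))) q≤
    where
    eq′ : (n + n) ! ≡ q * (n ! * n !)
    eq′ = trans eq (cong (λ m → q * (n ! * m !)) (m+n∸m≡n n n))
    q≢0 : NonZero q
    q≢0 = ≢-nonZero λ { refl → contradiction eq′ (≢-nonZero⁻¹ _ {{(n + n) !≢0}}) }
    q≤ : q ≤ 4 ^ n
    q≤ = *-cancelʳ-≤ q (4 ^ n) (n ! * n !) {{n !* n !≢0}} (subst (_≤ 4 ^ n * (n ! * n !)) eq′ (central-bound n))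
    ∣q : ∀ {ps} → All Prime ps → All (n <_) ps → All (_≤ n + n) ps → All (_∣ q) ps
    ∣q []       []        []        = []
    ∣q {p ∷ _} (pp ∷ h) (n<p ∷ n<) (p≤ ∷ ≤2n) = p∣q ∷ ∣q h n< ≤2n
      where
      p∣p! : ∀ {p} → Prime p → p ∣ p !
      p∣p! {zero}  pp = contradiction pp ¬prime[0]
      p∣p! {suc p} pp = divides (p !) (*-comm (suc p) (p !))
      p∣q : p ∣ q
      p∣q with euclidsLemma q (n ! * n !) pp (subst (p ∣_) eq′ (∣-trans (p∣p! pp) (m≤n⇒m!∣n! p≤)))
      ... | inj₁ p∣q = p∣q
      ... | inj₂ p∣!! with euclidsLemma (n !) (n !) pp p∣!!
      ... | inj₁ p∣! = contradiction (prime-∣-! n pp p∣!) (<⇒≱ n<p)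
      ... | inj₂ p∣! = contradiction (prime-∣-! n pp p∣!) (<⇒≱ n<p)

  power≤product : ∀ {M ps} → All (M <_) ps → M ^ length ps ≤ product ps
  power≤product []           = ≤-refl
  power≤product (M<p ∷ M<) = *-mono-≤ (<⇒≤ M<p) (power≤product M<)

  -- Each factor (p + 1)/p is at most (M + 1)/M; denominators are cleared here and below, to stay in
  -- ℕ.
  product-suc : ∀ {M ps} → All (M <_) ps → product (map suc ps) * M ^ length ps ≤ suc M ^ length ps * product ps
  product-suc []         = ≤-refl
  product-suc {M} {p ∷ ps} (M<p ∷ M<) = begin
    (suc p * product (map suc ps)) * (M * M ^ length ps)   ≡⟨ *-interchange (suc p) (product (map suc ps)) M (M ^ length ps) ⟩
    (suc p * M) * (product (map suc ps) * M ^ length ps)   ≤⟨ *-mono-≤ p+1*M (product-suc M<) ⟩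
    (suc M * p) * (suc M ^ length ps * product ps)         ≡⟨ *-interchange (suc M) p (suc M ^ length ps) (product ps) ⟩
    (suc M * suc M ^ length ps) * (p * product ps)         ∎
    where
    open ≤-Reasoning
    p+1*M : suc p * M ≤ suc M * p
    p+1*M = +-mono-≤ (<⇒≤ M<p) (≤-reflexive (*-comm p M))

  -- With M = n + k this is (1 + 1/M)^n ≤ M/(M - n), an upper counterpart of Bernoulli's inequality.
  -- The induction keeps M fixed and trades n for k.
  exp-bound : ∀ n k → suc (n + k) ^ n * k ≤ (n + k) ^ suc n
  exp-bound zero    k = ≤-reflexive (*-comm 1 k)
  exp-bound (suc n) k = begin
    M⁺ * M⁺ ^ n * k           ≡⟨ solve 3 (λ a b k → a :* b :* k := b :* (a :* k)) refl M⁺ (M⁺ ^ n) k ⟩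
    M⁺ ^ n * (M⁺ * k)         ≤⟨ *-monoʳ-≤ (M⁺ ^ n) (≤-trans (+-monoˡ-≤ (M * k) (m≤n+m k (suc n))) (≤-reflexive (sym (*-suc M k)))) ⟩
    M⁺ ^ n * (M * suc k)      ≡⟨ solve 3 (λ a b k → a :* (b :* k) := b :* (a :* k)) refl (M⁺ ^ n) M (suc k) ⟩
    M * (M⁺ ^ n * suc k)      ≤⟨ *-monoʳ-≤ M (subst (λ m → suc m ^ n * suc k ≤ m ^ suc n) (+-suc n k) (exp-bound n (suc k))) ⟩
    M * M ^ suc n             ∎
    where
    open ≤-Reasoning
    M M⁺ : ℕ
    M  = suc (n + k)
    M⁺ = suc M

  -- The exponent is split into two halves, each contributing at most 2 by `exp-bound` with k = n.
  -- Even M is enough, as M will be a power of two.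
  [1+1/M]^M≤4 : ∀ n .{{_ : NonZero n}} → suc (n + n) ^ (n + n) ≤ 4 * (n + n) ^ (n + n)
  [1+1/M]^M≤4 n = begin
    suc M ^ (n + n)                  ≡⟨ ^-distribˡ-+-* (suc M) n n ⟩
    suc M ^ n * suc M ^ n            ≤⟨ *-mono-≤ half half ⟩
    (2 * M ^ n) * (2 * M ^ n)        ≡⟨ *-interchange 2 (M ^ n) 2 (M ^ n) ⟩
    4 * (M ^ n * M ^ n)              ≡⟨ cong (4 *_) (sym (^-distribˡ-+-* M n n)) ⟩
    4 * M ^ (n + n)                  ∎
    where
    open ≤-Reasoning
    M : ℕ
    M = n + n
    half : suc M ^ n ≤ 2 * M ^ n
    half = *-cancelʳ-≤ (suc M ^ n) (2 * M ^ n) n (≤-trans (exp-bound n n)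
      (≤-reflexive (solve 2 (λ n x → (n :+ n) :* x := con 2 :* x :* n) refl n (M ^ n))))

  bernoulli : ∀ m n → (m + n) * m ^ n ≤ m * suc m ^ n
  bernoulli m zero    = ≤-reflexive (cong (_* 1) (+-identityʳ m))
  bernoulli m (suc n) = begin
    (m + suc n) * (m * m ^ n)        ≡⟨ sym (*-assoc (m + suc n) m (m ^ n)) ⟩
    (m + suc n) * m * m ^ n          ≤⟨ *-monoˡ-≤ (m ^ n) (≤-trans (m≤m+n _ n) (≤-reflexive
        (solve 2 (λ m n → (m :+ (con 1 :+ n)) :* m :+ n := (con 1 :+ m) :* (m :+ n)) refl m n))) ⟩
    suc m * (m + n) * m ^ n          ≡⟨ *-assoc (suc m) (m + n) (m ^ n) ⟩
    suc m * ((m + n) * m ^ n)        ≤⟨ *-monoʳ-≤ (suc m) (bernoulli m n) ⟩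
    suc m * (m * suc m ^ n)          ≡⟨ solve 3 (λ a b c → a :* (b :* c) := b :* (a :* c)) refl (suc m) m (suc m ^ n) ⟩
    m * suc m ^ suc n                ∎
    where open ≤-Reasoning

  2≤[1+1/j]^j : ∀ j .{{_ : NonZero j}} → 2 * j ^ j ≤ suc j ^ j
  2≤[1+1/j]^j j = *-cancelˡ-≤ j (≤-trans
    (≤-reflexive (solve 2 (λ j x → j :* (con 2 :* x) := (j :+ j) :* x) refl j (j ^ j))) (bernoulli j j))

  ^-distribʳ-* : ∀ m n o → (m * n) ^ o ≡ m ^ o * n ^ o
  ^-distribʳ-* m n zero    = refl
  ^-distribʳ-* m n (suc o) = trans (cong (m * n *_) (^-distribʳ-* m n o)) (*-interchange m n (m ^ o) (n ^ o))

  ^-cancelˡ-≤ : ∀ {a b} n .{{_ : NonZero n}} → a ^ n ≤ b ^ n → a ≤ b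
  ^-cancelˡ-≤ n p = ≮⇒≥ (λ b<a → <⇒≱ (^-monoˡ-< n b<a) p)

  smaller-exponent : ∀ {M N t c} .{{_ : NonZero M}} → t ≤ N → suc M ^ N ≤ c * M ^ N → suc M ^ t ≤ c * M ^ t
  smaller-exponent {M} {N} {t} {c} t≤N h = *-cancelʳ-≤ (suc M ^ t) (c * M ^ t) (M ^ (N ∸ t)) {{m^n≢0 M (N ∸ t)}} (begin
    suc M ^ t * M ^ (N ∸ t)      ≤⟨ *-monoʳ-≤ (suc M ^ t) (^-monoˡ-≤ (N ∸ t) (n≤1+n M)) ⟩
    suc M ^ t * suc M ^ (N ∸ t)  ≡⟨ sym (^-distribˡ-+-* (suc M) t (N ∸ t)) ⟩
    suc M ^ (t + (N ∸ t))        ≡⟨ cong (suc M ^_) (m+[n∸m]≡n t≤N) ⟩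
    suc M ^ N                    ≤⟨ h ⟩
    c * M ^ N                    ≡⟨ cong (λ e → c * M ^ e) (sym (m+[n∸m]≡n t≤N)) ⟩
    c * M ^ (t + (N ∸ t))        ≡⟨ cong (c *_) (^-distribˡ-+-* M t (N ∸ t)) ⟩
    c * (M ^ t * M ^ (N ∸ t))    ≡⟨ sym (*-assoc c (M ^ t) (M ^ (N ∸ t))) ⟩
    c * M ^ t * M ^ (N ∸ t)      ∎)
    where open ≤-Reasoning

  -- The j-th powers of the two sides are compared with (1 + 1/M)^(2M) ≤ 16 ≤ (1 + 1/j)^(4j).
  few-primes : ∀ n j t .{{_ : NonZero n}} .{{_ : NonZero j}} → t * j ≤ (n + n) + (n + n) →
    suc (n + n) ^ t * j ^ 4 ≤ suc j ^ 4 * (n + n) ^ t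
  few-primes n j t tj≤ = ^-cancelˡ-≤ j (begin
    (suc M ^ t * j ^ 4) ^ j             ≡⟨ ^-distribʳ-* (suc M ^ t) (j ^ 4) j ⟩
    (suc M ^ t) ^ j * (j ^ 4) ^ j       ≡⟨ cong₂ _*_ (^-*-assoc (suc M) t j) (swap-powers j 4 j) ⟩
    suc M ^ (t * j) * (j ^ j) ^ 4       ≤⟨ *-monoˡ-≤ ((j ^ j) ^ 4) (smaller-exponent {M} {M + M} {t * j} {16} {{M≢0}} tj≤ twice) ⟩
    16 * M ^ (t * j) * (j ^ j) ^ 4      ≡⟨ solve 2 (λ a b → con 16 :* a :* b := con 16 :* b :* a) refl (M ^ (t * j)) ((j ^ j) ^ 4) ⟩
    2 ^ 4 * (j ^ j) ^ 4 * M ^ (t * j)   ≡⟨ cong (_* M ^ (t * j)) (sym (^-distribʳ-* 2 (j ^ j) 4)) ⟩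
    (2 * j ^ j) ^ 4 * M ^ (t * j)       ≤⟨ *-monoˡ-≤ (M ^ (t * j)) (^-monoˡ-≤ 4 (2≤[1+1/j]^j j)) ⟩
    (suc j ^ j) ^ 4 * M ^ (t * j)       ≡⟨ cong₂ _*_ (sym (swap-powers (suc j) 4 j)) (sym (^-*-assoc M t j)) ⟩
    (suc j ^ 4) ^ j * (M ^ t) ^ j       ≡⟨ sym (^-distribʳ-* (suc j ^ 4) (M ^ t) j) ⟩
    (suc j ^ 4 * M ^ t) ^ j             ∎)
    where
    open ≤-Reasoning
    M : ℕ
    M = n + n
    M≢0 : NonZero M
    M≢0 = >-nonZero (≤-trans (>-nonZero⁻¹ n) (m≤m+n n n))
    swap-powers : ∀ a b c → (a ^ b) ^ c ≡ (a ^ c) ^ b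
    swap-powers a b c = trans (^-*-assoc a b c) (trans (cong (a ^_) (*-comm b c)) (sym (^-*-assoc a c b)))
    twice : suc M ^ (M + M) ≤ 16 * M ^ (M + M)
    twice = begin
      suc M ^ (M + M)              ≡⟨ ^-distribˡ-+-* (suc M) M M ⟩
      suc M ^ M * suc M ^ M        ≤⟨ *-mono-≤ ([1+1/M]^M≤4 n) ([1+1/M]^M≤4 n) ⟩
      4 * M ^ M * (4 * M ^ M)      ≡⟨ *-interchange 4 (M ^ M) 4 (M ^ M) ⟩
      16 * (M ^ M * M ^ M)         ≡⟨ cong (16 *_) (sym (^-distribˡ-+-* M M M)) ⟩
      16 * M ^ (M + M)             ∎

  2^≢0 : ∀ j → NonZero (2 ^ j)
  2^≢0 j = m^n≢0 2 j

  2^suc : ∀ j → 2 ^ suc j ≡ 2 ^ j + 2 ^ j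
  2^suc j = cong (2 ^ j +_) (+-identityʳ (2 ^ j))

  2^-cancel : ∀ {a b} → 2 ^ a ≤ 2 ^ b → a ≤ b
  2^-cancel p = ≮⇒≥ (λ b<a → <⇒≱ (^-monoʳ-< 2 (s≤s (s≤s z≤n)) b<a) p)

  -- With M = 2^(j+1), the chain M^t ≤ ∏ p ≤ 4^M allows at most 2M/(j+1) primes, and each has 1 +
  -- 1/p ≤ 1 + 1/M. The bound takes the form ((j+2)/(j+1))^4 because such factors telescope over
  -- consecutive blocks.
  dyadic-block : ∀ j {ps} → Unique ps → All Prime ps → All (2 ^ suc j <_) ps → All (_≤ 2 ^ suc (suc j)) ps →
    product (map suc ps) * suc j ^ 4 ≤ suc (suc j) ^ 4 * product ps
  dyadic-block j {ps} u h M< ≤2M = *-cancelʳ-≤ _ _ (M ^ t) {{m^n≢0 M t {{2^≢0 (suc j)}}}} (begin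
    product (map suc ps) * J * M ^ t        ≡⟨ solve 3 (λ a b c → a :* b :* c := a :* c :* b) refl (product (map suc ps)) J (M ^ t) ⟩
    product (map suc ps) * M ^ t * J        ≤⟨ *-monoˡ-≤ J (product-suc M<) ⟩
    suc M ^ t * product ps * J              ≡⟨ solve 3 (λ a b c → a :* b :* c := a :* c :* b) refl (suc M ^ t) (product ps) J ⟩
    suc M ^ t * J * product ps              ≤⟨ *-monoˡ-≤ (product ps) few ⟩
    J⁺ * M ^ t * product ps                 ≡⟨ solve 3 (λ a b c → a :* b :* c := a :* c :* b) refl J⁺ (M ^ t) (product ps) ⟩
    J⁺ * product ps * M ^ t                 ∎)
    where
    open ≤-Reasoning
    M t J J⁺ : ℕ
    M  = 2 ^ suc j
    t  = length ps
    J  = suc j ^ 4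
    J⁺ = suc (suc j) ^ 4
    count : t * suc j ≤ M + M
    count = 2^-cancel (begin
      2 ^ (t * suc j)    ≡⟨ trans (cong (2 ^_) (*-comm t (suc j))) (sym (^-*-assoc 2 (suc j) t)) ⟩
      M ^ t              ≤⟨ power≤product M< ⟩
      product ps         ≤⟨ block-product u h M< (subst (λ m → All (_≤ m) ps) (2^suc (suc j)) ≤2M) ⟩
      4 ^ M              ≡⟨ ^-*-assoc 2 2 M ⟩
      2 ^ (2 * M)        ≡⟨ cong (λ e → 2 ^ (M + e)) (+-identityʳ M) ⟩
      2 ^ (M + M)        ∎)
    few : suc M ^ t * J ≤ J⁺ * M ^ t
    few = subst (λ m → suc m ^ t * J ≤ J⁺ * m ^ t) (sym (2^suc j))
      (few-primes (2 ^ j) (suc j) t {{2^≢0 j}} (subst (λ m → t * suc j ≤ m + m) (2^suc j) count))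

  product-filter : ∀ {Q : ℕ → Set} (Q? : Decidable Q) (f : ℕ → ℕ) ps →
    product (map f ps) ≡ product (map f (filter Q? ps)) * product (map f (filter (¬? ∘ Q?) ps))
  product-filter Q? f []       = refl
  product-filter Q? f (p ∷ ps) with Q? p
  ... | yes _ = trans (cong (f p *_) (product-filter Q? f ps)) (sym (*-assoc (f p) _ _))
  ... | no  _ = trans (cong (f p *_) (product-filter Q? f ps))
      (solve 3 (λ a x y → a :* (x :* y) := x :* (a :* y)) refl (f p)
        (product (map f (filter Q? ps))) (product (map f (filter (¬? ∘ Q?) ps))))

  product-split : ∀ b A B C ps →
    product (map suc (filter (_≤? b) ps)) ≤ A * product (filter (_≤? b) ps) →
    product (map suc (filter (¬? ∘ (_≤? b)) ps)) * C ≤ B * product (filter (¬? ∘ (_≤? b)) ps) →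
    product (map suc ps) * C ≤ A * B * product ps
  product-split b A B C ps h₁ h₂ = begin
    product (map suc ps) * C     ≡⟨ cong (_* C) (product-filter (_≤? b) suc ps) ⟩
    s⁺ * l⁺ * C                  ≡⟨ *-assoc s⁺ l⁺ C ⟩
    s⁺ * (l⁺ * C)                ≤⟨ *-mono-≤ h₁ h₂ ⟩
    A * s * (B * l)              ≡⟨ *-interchange A s B l ⟩
    A * B * (s * l)              ≡⟨ cong (A * B *_) (sym Π≡) ⟩
    A * B * product ps           ∎
    where
    open ≤-Reasoning
    small large : List ℕ
    small = filter (_≤? b) ps
    large = filter (¬? ∘ (_≤? b)) ps
    s s⁺ l l⁺ : ℕ
    s  = product small
    s⁺ = product (map suc small)
    l  = product large
    l⁺ = product (map suc large)
    Π≡ : product ps ≡ s * l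
    Π≡ = trans (cong product (sym (map-id ps))) (trans (product-filter (_≤? b) (λ p → p) ps)
      (cong₂ (λ x y → product x * product y) (map-id small) (map-id large)))

  all-> : ∀ b ps → All (b <_) (filter (¬? ∘ (_≤? b)) ps)
  all-> b ps = All.map ≰⇒> (All.all-filter (¬? ∘ (_≤? b)) ps)

  prime≤2 : ∀ {p} → Prime p → p ≤ 2 → p ≡ 2
  prime≤2 {0} pp _ = contradiction pp ¬prime[0]
  prime≤2 {1} pp _ = contradiction pp ¬prime[1]
  prime≤2 {2} pp _ = refl
  prime≤2 {suc (suc (suc _))} pp (s≤s (s≤s ()))

  -- The dyadic factors telescope to (j+1)^4; the initial 2 covers the prime 2 alone, which
  -- contributes 3/2.
  small-primes : ∀ j {ps} → Unique ps → All Prime ps → All (_≤ 2 ^ suc j) ps →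
    product (map suc ps) ≤ 2 * suc j ^ 4 * product ps
  small-primes zero {[]}         u h b = s≤s z≤n
  small-primes zero {p ∷ []}     u (pp ∷ _) (p≤2 ∷ _) rewrite prime≤2 pp p≤2 = s≤s (s≤s (s≤s z≤n))
  small-primes zero {p ∷ q ∷ _} ((p≢q ∷ _) ∷ _) (pp ∷ pq ∷ _) (p≤2 ∷ q≤2 ∷ _) =
    contradiction (trans (prime≤2 pp p≤2) (sym (prime≤2 pq q≤2))) p≢q
  small-primes (suc j) {ps} u h ≤b = *-cancelʳ-≤ _ _ J {{m^n≢0 (suc j) 4}} (begin
    product (map suc ps) * J     ≤⟨ product-split b (2 * J) J⁺ J ps
                                      (small-primes j (Unique.filter⁺ (_≤? b) u) (All.filter⁺ (_≤? b) h) (All.all-filter (_≤? b) ps))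
                                      (dyadic-block j (Unique.filter⁺ (¬? ∘ (_≤? b)) u) (All.filter⁺ (¬? ∘ (_≤? b)) h)
                                        (all-> b ps) (All.filter⁺ (¬? ∘ (_≤? b)) ≤b)) ⟩
    2 * J * J⁺ * product ps      ≡⟨ solve 3 (λ a b c → con 2 :* a :* b :* c := con 2 :* b :* c :* a) refl J J⁺ (product ps) ⟩
    2 * J⁺ * product ps * J      ∎)
    where
    open ≤-Reasoning
    b J J⁺ : ℕ
    b  = 2 ^ suc j
    J  = suc j ^ 4
    J⁺ = suc (suc j) ^ 4

  -- Only the number of primes is controlled, not their size. With b = 2^(J+1), there are at most b
  -- primes above b, and they contribute at most (1 + 1/b)^b ≤ 4; so 8 is 2 times 4.
  product-suc-bound : ∀ J {ps} → Unique ps → All Prime ps → length ps ≤ 2 ^ J →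
    product (map suc ps) ≤ 8 * suc J ^ 4 * product ps
  product-suc-bound J {ps} u h len = begin
    product (map suc ps)                ≡⟨ sym (*-identityʳ (product (map suc ps))) ⟩
    product (map suc ps) * 1            ≤⟨ product-split b (2 * suc J ^ 4) 4 1 ps
      (small-primes J (Unique.filter⁺ (_≤? b) u) (All.filter⁺ (_≤? b) h) (All.all-filter (_≤? b) ps)) large ⟩
    2 * suc J ^ 4 * 4 * product ps      ≡⟨ cong (_* product ps) (solve 1 (λ a → con 2 :* a :* con 4 := con 8 :* a) refl (suc J ^ 4)) ⟩
    8 * suc J ^ 4 * product ps          ∎
    where
    open ≤-Reasoning
    b : ℕ
    b = 2 ^ suc J
    ls : List ℕ
    ls = filter (¬? ∘ (_≤? b)) ps
    large : product (map suc ls) * 1 ≤ 4 * product ls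
    large = *-cancelʳ-≤ _ _ (b ^ length ls) {{m^n≢0 b (length ls) {{2^≢0 (suc J)}}}} (begin
      product (map suc ls) * 1 * b ^ length ls   ≡⟨ cong (_* b ^ length ls) (*-identityʳ (product (map suc ls))) ⟩
      product (map suc ls) * b ^ length ls       ≤⟨ product-suc (all-> b ps) ⟩
      suc b ^ length ls * product ls             ≤⟨ *-monoˡ-≤ (product ls) (smaller-exponent {b} {b} {length ls} {4} {{2^≢0 (suc J)}} len′
                                                      (subst (λ m → suc m ^ m ≤ 4 * m ^ m) (sym (2^suc J)) ([1+1/M]^M≤4 (2 ^ J) {{2^≢0 J}}))) ⟩
      4 * b ^ length ls * product ls             ≡⟨ solve 2 (λ x y → con 4 :* x :* y := con 4 :* y :* x) refl (b ^ length ls) (product ls) ⟩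
      4 * product ls * b ^ length ls             ∎)
      where
      len′ : length ls ≤ b
      len′ = ≤-trans (length-filter (¬? ∘ (_≤? b)) ps) (≤-trans len (^-monoʳ-≤ 2 (n≤1+n J)))

  -- Bernoulli gives 1 + e/p ≤ (1 + 1/p)^e prime by prime, so replacing 1 by e costs only a power.
  amplification-bound : ∀ e τ ps → All Prime ps → product (map suc ps) ≤ τ * product ps →
    product (map (_+ e) ps) ≤ τ ^ e * product ps
  amplification-bound e τ ps h Π≤ = *-cancelʳ-≤ _ _ (product ps ^ e) {{m^n≢0 (product ps) e {{productOfPrimes≢0 h}}}} (begin
    product (map (_+ e) ps) * product ps ^ e       ≤⟨ go ps ⟩
    product ps * product (map suc ps) ^ e          ≤⟨ *-monoʳ-≤ (product ps) (^-monoˡ-≤ e Π≤) ⟩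
    product ps * (τ * product ps) ^ e              ≡⟨ cong (product ps *_) (^-distribʳ-* τ (product ps) e) ⟩
    product ps * (τ ^ e * product ps ^ e)          ≡⟨ solve 3 (λ a b c → a :* (b :* c) := b :* a :* c) refl (product ps) (τ ^ e) (product ps ^ e) ⟩
    τ ^ e * product ps * product ps ^ e            ∎)
    where
    open ≤-Reasoning
    go : ∀ ps → product (map (_+ e) ps) * product ps ^ e ≤ product ps * product (map suc ps) ^ e
    go []       = ≤-refl
    go (p ∷ ps) = begin
      (p + e) * E * (p * P) ^ e             ≡⟨ cong ((p + e) * E *_) (^-distribʳ-* p P e) ⟩
      (p + e) * E * (p ^ e * P ^ e)         ≡⟨ *-interchange (p + e) E (p ^ e) (P ^ e) ⟩
      (p + e) * p ^ e * (E * P ^ e)         ≤⟨ *-mono-≤ (bernoulli p e) (go ps) ⟩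
      p * suc p ^ e * (P * S ^ e)           ≡⟨ *-interchange p (suc p ^ e) P (S ^ e) ⟩
      p * P * (suc p ^ e * S ^ e)           ≡⟨ cong (p * P *_) (sym (^-distribʳ-* (suc p) S e)) ⟩
      p * P * (suc p * S) ^ e               ∎
      where
      E P S : ℕ
      E = product (map (_+ e) ps)
      P = product ps
      S = product (map suc ps)

open import Data.Integer as ℤ using (+_; ℤ; 0ℤ; 1ℤ; -[1+_]; -1ℤ)
import Data.Integer.Properties as ℤ
open import Data.List using (List; []; _∷_; map; _++_; concatMap; length; filter; upTo; foldr; cartesianProductWith)
open import Data.List.Membership.Propositional using (_∈_; find; lose; _∉_)
open import Data.List.Membership.Propositional.Properties using (∈-concatMap⁻; ∈-++⁻; ∈-++⁺ˡ; ∈-∃++; ∈-filter⁺; ∈-filter⁻; ∈-upTo⁺; ∈-map⁺; ∈-map⁻; ∈-++⁺ʳ; ∈-cartesianProductWith⁺)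
import Data.List.Membership.Propositional.Properties.WithK as WithK
open import Data.List.Properties using (map-++; ++-assoc; length-map; ++-identityʳ)
open import Data.List.Relation.Binary.BagAndSetEquality using (∼bag⇒↭)
open import Data.List.Relation.Binary.Permutation.Propositional using (_↭_; ↭-refl; ↭-sym; ↭-trans; ↭-reflexive; ↭⇒↭ₛ)
open import Data.List.Relation.Binary.Permutation.Propositional.Properties using (map⁺; shift; ++⁺; ++⁺ˡ; ++-comm; ∈-resp-↭; ↭-length)
import Data.List.Relation.Binary.Permutation.Setoid.Properties as ↭ₛ
open import Data.List.Relation.Unary.All as All using (All; []; _∷_)
import Data.List.Relation.Unary.All.Properties as All
open import Data.List.Relation.Unary.Any as Any using (here; there; Any)
open import Data.List.Relation.Unary.Unique.Propositional using (Unique; []; _∷_)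
import Data.List.Relation.Unary.Unique.Propositional.Properties as Unique
open import Data.Nat as ℕ using (ℕ; zero; suc; ∣_-_∣; _⊓_; _⊔_; _∸_)
import Data.Nat.Coprimality as Coprime
import Data.Nat.DivMod as ℕ
open import Data.Nat.Divisibility as ∣ using (_∣_; divides; _∤_; _∣?_)
open import Data.Nat.GCD using (gcd; gcd-comm; c*gcd[m,n]≡gcd[cm,cn])
open import Data.Nat.LCM using (lcm; gcd*lcm; lcm-least; m∣lcm[m,n]; n∣lcm[m,n])
open import Data.Nat.ListAction using (sum; product)
open import Data.Nat.ListAction.Properties using (sum-++; sum-↭; product-↭)
open import Data.Nat.Primality using (Prime; euclidsLemma; prime⇒irreducible; prime⇒nonZero; ¬prime[0]; ¬prime[1]; productOfPrimes≢0; prime?; prime⇒nonTrivial)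
open import Data.Nat.Primality.Factorisation using (factorise; PrimeFactorisation)
import Data.Nat.Properties as ℕ
open import Data.List.Membership.DecPropositional ℕ._≟_ using (_∈?_)
import Data.Nat.Solver as ℕ-Solver
open import Data.Product using (_×_; _,_; proj₁; proj₂; ∃; ∃-syntax)
open import Data.Rational as ℚ using (ℚ; 0ℚ; 1ℚ; ½; _+_; _*_; -_; _-_; _≤_; _<_; _/_; mkℚ; *≤*; *<*)
import Data.Rational.Properties as ℚ
open import Data.Rational.Solver using (module +-*-Solver)
import Data.Rational.Unnormalised as ℚᵘ
import Data.Rational.Unnormalised.Properties as ℚᵘ
open import Data.Sum using (inj₁; inj₂; _⊎_)
open import Data.Vec using (Vec; []; _∷_; head; tail; zipWith; fromList; replicate)
open import Data.Vec.Relation.Binary.Pointwise.Inductive as Pointwise using (Pointwise; []; _∷_)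
open import Data.Vec.Relation.Unary.All as AllV using ([]; _∷_)
open import Defs
open import Function.Bundles using (mk⇔)
open import Relation.Binary.PropositionalEquality
open import Relation.Nullary using (¬_; yes; no; contradiction; Dec; ¬?)
open import Relation.Nullary.Decidable using (_×-dec_)
open import Relation.Unary using (Decidable)
open +-*-Solver using (solve; _:=_; _:+_; _:*_; _:-_; :-_; con)
open ℕ-Solver.+-*-Solver using () renaming (solve to ℕ-solve; _:+_ to _⊕_; _:*_ to _⊗_; _:=_ to _⊜_)

-- Finite sums and the kernel r^|i - j|

0≤+ : ∀ {a b} → 0ℚ ≤ a → 0ℚ ≤ b → 0ℚ ≤ a + b
0≤+ p q = ℚ.+-mono-≤ p q

0≤* : ∀ {a b} → 0ℚ ≤ a → 0ℚ ≤ b → 0ℚ ≤ a * b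
0≤* {a} {b} p q =
  subst (_≤ a * b) (ℚ.*-zeroʳ a) (ℚ.*-monoˡ-≤-nonNeg a {{ℚ.nonNegative p}} q)

*-monoˡ : ∀ {a b} c → 0ℚ ≤ c → a ≤ b → c * a ≤ c * b
*-monoˡ c p = ℚ.*-monoˡ-≤-nonNeg c {{ℚ.nonNegative p}}

*-monoʳ : ∀ {a b} c → 0ℚ ≤ c → a ≤ b → a * c ≤ b * c
*-monoʳ c p = ℚ.*-monoʳ-≤-nonNeg c {{ℚ.nonNegative p}}

0≤-⇒≤ : ∀ {a b} → 0ℚ ≤ b - a → a ≤ b
0≤-⇒≤ {a} {b} p = subst₂ _≤_ (ℚ.+-identityʳ a)
  (solve 2 (λ a b → a :+ (b :- a) := b) refl a b) (ℚ.+-monoʳ-≤ a p)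

≤⇒0≤- : ∀ {a b} → a ≤ b → 0ℚ ≤ b - a
≤⇒0≤- {a} {b} p = subst (_≤ b - a) (ℚ.+-inverseʳ a) (ℚ.+-monoˡ-≤ (- a) p)

≤-excess : ∀ {a b} e → b ≡ a + e → 0ℚ ≤ e → a ≤ b
≤-excess {a} e refl p = subst (_≤ a + e) (ℚ.+-identityʳ a) (ℚ.+-monoʳ-≤ a p)

module _ {P : Set} where

  ∑ : List P → (P → ℚ) → ℚ
  ∑ []      F = 0ℚ
  ∑ (x ∷ L) F = F x + ∑ L F

  ∑-cong∈ : ∀ L {F G} → (∀ x → x ∈ L → F x ≡ G x) → ∑ L F ≡ ∑ L G
  ∑-cong∈ []      h = refl
  ∑-cong∈ (x ∷ L) h = cong₂ _+_ (h x (here refl)) (∑-cong∈ L (λ y y∈ → h y (there y∈)))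

  ∑-cong : ∀ L {F G} → (∀ x → F x ≡ G x) → ∑ L F ≡ ∑ L G
  ∑-cong L h = ∑-cong∈ L (λ x _ → h x)

  ∑-+ : ∀ L {F G} → ∑ L (λ x → F x + G x) ≡ ∑ L F + ∑ L G
  ∑-+ []              = refl
  ∑-+ (x ∷ L) {F} {G} = trans (cong (_+_ (F x + G x)) (∑-+ L))
    (solve 4 (λ a b c d → (a :+ b) :+ (c :+ d) := (a :+ c) :+ (b :+ d)) refl
      (F x) (G x) (∑ L F) (∑ L G))

  ∑-*ˡ : ∀ L {F} c → ∑ L (λ x → c * F x) ≡ c * ∑ L F
  ∑-*ˡ []          c = sym (ℚ.*-zeroʳ c)
  ∑-*ˡ (x ∷ L) {F} c = trans (cong (_+_ (c * F x)) (∑-*ˡ L c)) (sym (ℚ.*-distribˡ-+ c (F x) (∑ L F)))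

  ∑-mono∈ : ∀ L {F G} → (∀ x → x ∈ L → F x ≤ G x) → ∑ L F ≤ ∑ L G
  ∑-mono∈ []      h = ℚ.≤-refl
  ∑-mono∈ (x ∷ L) h = ℚ.+-mono-≤ (h x (here refl)) (∑-mono∈ L (λ y y∈ → h y (there y∈)))

  ∑-linear : ∀ L {F G} a b → ∑ L (λ x → a * F x + b * G x) ≡ a * ∑ L F + b * ∑ L G
  ∑-linear L a b = trans (∑-+ L) (cong₂ _+_ (∑-*ˡ L a) (∑-*ˡ L b))

infixr 8 _^_
_^_ : ℚ → ℕ → ℚ
r ^ zero  = 1ℚ
r ^ suc n = r * r ^ n

kernel₁ : ℚ → ℕ → ℕ → ℚ
kernel₁ r i j = r ^ ∣ i - j ∣

kernel : ∀ {n} → Vec ℚ n → Vec ℕ n → Vec ℕ n → ℚ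
kernel []       u v = 1ℚ
kernel (r ∷ rs) u v = kernel₁ r (head u) (head v) * kernel rs (tail u) (tail v)

δ : ℕ → ℕ → ℚ
δ zero    zero    = 1ℚ
δ zero    (suc j) = 0ℚ
δ (suc i) zero    = 0ℚ
δ (suc i) (suc j) = δ i j

kernel₁-zeroʳ : ∀ r i → kernel₁ r i 0 ≡ r ^ i
kernel₁-zeroʳ r zero    = refl
kernel₁-zeroʳ r (suc i) = refl

-- The Kac-Murdock-Szegő matrix r^|i - j| has a tridiagonal inverse. Up to the factor 1 - r², this
-- is its corner row, where the left neighbour is missing and the diagonal entry is 1;
-- `δ-kernel₁-suc` gives the other rows, with 1 + r² on the diagonal.
δ-kernel₁-zero : ∀ r j → (1ℚ - r * r) * δ 0 j ≡ kernel₁ r 0 j - r * kernel₁ r 1 j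
δ-kernel₁-zero r zero    = solve 1 (λ r → (con 1ℚ :- r :* r) :* con 1ℚ := con 1ℚ :- r :* (r :* con 1ℚ)) refl r
δ-kernel₁-zero r (suc j) = solve 2 (λ r x → (con 1ℚ :- r :* r) :* con 0ℚ := r :* x :- r :* x) refl r (r ^ j)

δ-kernel₁-suc : ∀ r i j → (1ℚ - r * r) * δ (suc i) j
  ≡ (1ℚ + r * r) * kernel₁ r (suc i) j - r * kernel₁ r i j - r * kernel₁ r (2 ℕ.+ i) j
δ-kernel₁-suc r i zero rewrite kernel₁-zeroʳ r i =
  solve 2 (λ r x → (con 1ℚ :- r :* r) :* con 0ℚ
    := (con 1ℚ :+ r :* r) :* (r :* x) :- r :* x :- r :* (r :* (r :* x))) refl r (r ^ i)
δ-kernel₁-suc r zero (suc zero) = solve 1 (λ r → (con 1ℚ :- r :* r) :* con 1ℚ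
    := (con 1ℚ :+ r :* r) :* con 1ℚ :- r :* (r :* con 1ℚ) :- r :* (r :* con 1ℚ)) refl r
δ-kernel₁-suc r zero (suc (suc j)) = solve 2 (λ r x → (con 1ℚ :- r :* r) :* con 0ℚ
    := (con 1ℚ :+ r :* r) :* (r :* x) :- r :* (r :* (r :* x)) :- r :* x) refl r (r ^ j)
δ-kernel₁-suc r (suc i) (suc j) = δ-kernel₁-suc r i j

δ-subst : ∀ i j (f : ℕ → ℚ) → δ i j * f j ≡ δ i j * f i
δ-subst zero    zero    f = refl
δ-subst zero    (suc j) f = trans (ℚ.*-zeroˡ (f (suc j))) (sym (ℚ.*-zeroˡ (f 0)))
δ-subst (suc i) zero    f = trans (ℚ.*-zeroˡ (f 0)) (sym (ℚ.*-zeroˡ (f (suc i))))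
δ-subst (suc i) (suc j) f = δ-subst i j (λ x → f (suc x))

-- Built up from `δ`, so that passing from m to m + 1 adds exactly one row of the inverse matrix.
indicator≤ : ℕ → ℕ → ℚ
indicator≤ zero    j = δ 0 j
indicator≤ (suc m) j = indicator≤ m j + δ (suc m) j

indicator≤-suc : ∀ m j → indicator≤ (suc m) (suc j) ≡ indicator≤ m j
indicator≤-suc zero    j = ℚ.+-identityˡ (δ 0 j)
indicator≤-suc (suc m) j = cong (_+ δ (suc m) j) (indicator≤-suc m j)

indicator≤-zero : ∀ m → indicator≤ m 0 ≡ 1ℚ
indicator≤-zero zero    = refl
indicator≤-zero (suc m) = trans (ℚ.+-identityʳ _) (indicator≤-zero m)

indicator≤≡1 : ∀ {j m} → j ℕ.≤ m → indicator≤ m j ≡ 1ℚ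
indicator≤≡1 {zero}  {m}     _           = indicator≤-zero m
indicator≤≡1 {suc j} {suc m} (ℕ.s≤s j≤m) = trans (indicator≤-suc m j) (indicator≤≡1 j≤m)

-- Beyond all points the kernel only decays, which gives the telescoped bound in `∑-amplification`
-- its sign at the right end.
kernel₁-beyond : ∀ r {j m} → j ℕ.≤ m → kernel₁ r (suc m) j ≡ r * kernel₁ r m j
kernel₁-beyond r {j} {m} j≤m
  rewrite ℕ.m≤n⇒∣n-m∣≡n∸m j≤m | ℕ.m≤n⇒∣n-m∣≡n∸m (ℕ.m≤n⇒m≤1+n j≤m) | ℕ.+-∸-assoc 1 j≤m = refl

16ℚ 2ℚ : ℚ
16ℚ = + 16 / 1
2ℚ  = + 2 / 1

amplification : ∀ {n} → Vec ℚ n → ℚ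
amplification []       = 1ℚ
amplification (r ∷ rs) = (1ℚ + 16ℚ * r) * amplification rs

Ratio : ℚ → Set
Ratio r = 0ℚ ≤ r × r ≤ ½

0≤amplification : ∀ {n} {rs : Vec ℚ n} → AllV.All Ratio rs → 0ℚ ≤ amplification rs
0≤amplification []                = ℚ.nonNegative⁻¹ 1ℚ
0≤amplification ((0≤r , _) ∷ hrs) =
  0≤* (0≤+ (ℚ.nonNegative⁻¹ 1ℚ) (0≤* (ℚ.nonNegative⁻¹ 16ℚ) 0≤r)) (0≤amplification hrs)

module _ {P : Set} (L : List P) where

  private
    y≥0 : ∀ {Π y} → 0ℚ ≤ Π → - y ≤ Π * y → 0ℚ ≤ y
    y≥0 {Π} {y} 0≤Π h = ℚ.*-cancelˡ-≤-pos (1ℚ + Π) {{ℚ.positive 0<1+Π}}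
      (subst₂ _≤_ (sym (ℚ.*-zeroʳ (1ℚ + Π)))
        (solve 2 (λ Π y → Π :* y :- (:- y) := (con 1ℚ :+ Π) :* y) refl Π y) (≤⇒0≤- h))
      where
      0<1+Π : 0ℚ < 1ℚ + Π
      0<1+Π = ℚ.+-mono-<-≤ (ℚ.positive⁻¹ 1ℚ) 0≤Π

  -- By induction on the dimension: in the first coordinate,
  --   (1 - r²) δᵢ = (1 + r²) kᵢ - r kᵢ₋₁ - r kᵢ₊₁,   where kᵢ(j) = r^|i - j|,
  -- and pairing c with kᵢ gives weights that satisfy the hypothesis in one
  -- dimension less.  The factor 1 + 16 r comes from
  -- (1 + r)² ≤ (1 + 16 r) (1 - r)² for 0 ≤ r ≤ 1/2.
  ∑-amplification : ∀ {n} {rs : Vec ℚ n} → AllV.All Ratio rs → (c : P → ℚ) (w : P → Vec ℕ n) →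
    (∀ u → 0ℚ ≤ ∑ L (λ d → c d * kernel rs u (w d))) →
    (φ : Vec ℕ n → ℚ) → (∀ v → - 1ℚ ≤ φ v) → (∀ v → φ v ≤ 1ℚ) →
    ∑ L (λ d → c d * φ (w d)) ≤ amplification rs * ∑ L c
  ∑-amplification {rs = []} [] c w V≥0 φ φ≥ φ≤ =
    subst₂ _≤_ (sym eq) refl (*-monoʳ (∑ L c) 0≤∑c (φ≤ []))
    where
    0≤∑c : 0ℚ ≤ ∑ L c
    0≤∑c = subst (0ℚ ≤_) (∑-cong L (λ d → ℚ.*-identityʳ (c d))) (V≥0 [])
    w≡[] : ∀ (v : Vec ℕ 0) → v ≡ []
    w≡[] [] = refl
    eq : ∑ L (λ d → c d * φ (w d)) ≡ φ [] * ∑ L c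
    eq = trans (∑-cong L (λ d → trans (cong (λ v → c d * φ v) (w≡[] (w d))) (ℚ.*-comm (c d) (φ []))))
               (∑-*ˡ L (φ []))
  ∑-amplification {suc n} {r ∷ rs} ((0≤r , r≤½) ∷ hrs) c w V≥0 φ φ≥ φ≤ = conclusion
    where
    Π T Λ : ℚ
    Π = amplification rs
    T = 1ℚ + 16ℚ * r
    Λ = T * Π
    0≤Π : 0ℚ ≤ Π
    0≤Π = 0≤amplification hrs
    hd : P → ℕ
    hd d = head (w d)
    tl : P → Vec ℕ n
    tl d = tail (w d)
    -- The weights live on `P` and not on positions: once the first coordinate is absorbed, points
    -- with different heads may share a tail and must still keep separate weights.
    slice : ℕ → P → ℚ
    slice i d = c d * kernel₁ r i (hd d)
    Y : ℕ → (Vec ℕ n → ℚ) → ℚ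
    Y i f = ∑ L (λ d → slice i d * f (tl d))
    y : ℕ → ℚ
    y i = ∑ L (slice i)
    Y≤ : ∀ i f → (∀ v → - 1ℚ ≤ f v) → (∀ v → f v ≤ 1ℚ) → Y i f ≤ Π * y i
    Y≤ i = ∑-amplification hrs (slice i) tl
      (λ u → subst (0ℚ ≤_) (∑-cong L (λ d → sym (ℚ.*-assoc (c d) _ _))) (V≥0 (i ∷ u)))
    -Y≤ : ∀ i f → (∀ v → - 1ℚ ≤ f v) → (∀ v → f v ≤ 1ℚ) → - Y i f ≤ Π * y i
    -Y≤ i f f≥ f≤ = subst (_≤ Π * y i)
      (trans (∑-cong L (λ d → solve 2 (λ a b → a :* (:- b) := (:- con 1ℚ) :* (a :* b)) refl (slice i d) (f (tl d))))
        (trans (∑-*ˡ L (- 1ℚ)) (solve 1 (λ a → (:- con 1ℚ) :* a := :- a) refl (Y i f))))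
      (Y≤ i (λ v → - f v) (λ v → ℚ.neg-antimono-≤ (f≤ v)) (λ v → ℚ.neg-antimono-≤ (f≥ v)))
    -- The constant test function -1 turns the inequality in one dimension less into
    -- `- y i ≤ Π * y i`.
    0≤y : ∀ i → 0ℚ ≤ y i
    0≤y i = y≥0 0≤Π (subst (_≤ Π * y i)
      (trans (∑-cong L (λ d → ℚ.*-comm (slice i d) (- 1ℚ)))
        (trans (∑-*ˡ L (- 1ℚ)) (solve 1 (λ a → (:- con 1ℚ) :* a := :- a) refl (y i))))
      (Y≤ i (λ _ → - 1ℚ) (λ _ → ℚ.≤-refl) (λ _ → ℚ.≤ᵇ⇒≤ _)))
    φ⟨_⟩ : ℕ → Vec ℕ n → ℚ
    φ⟨ i ⟩ v = φ (i ∷ v)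
    -- In terms of `ψ` the claim is that the sum of c ψ is at most 0.
    ψ : Vec ℕ (suc n) → ℚ
    ψ v = φ v - Λ
    Yψ : ∀ j i → ∑ L (λ d → slice j d * ψ (i ∷ tl d)) ≡ Y j φ⟨ i ⟩ - Λ * y j
    Yψ j i = trans
      (∑-cong L (λ d → solve 3 (λ s f l → s :* (f :- l) := con 1ℚ :* (s :* f) :+ (:- l) :* s) refl
                         (slice j d) (φ (i ∷ tl d)) Λ))
      (trans (∑-linear L 1ℚ (- Λ))
        (solve 3 (λ a l b → con 1ℚ :* a :+ (:- l) :* b := a :- l :* b) refl (Y j φ⟨ i ⟩) Λ (y j)))
    ε : ℚ
    ε = 1ℚ - r * r
    E : ℕ → ℚ
    E i = ∑ L (λ d → c d * δ i (hd d) * ψ (w d))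
    -- `δ` fixes the head at i, so `φ` becomes a function of the tail alone, to which the induction
    -- hypothesis applies.
    ψ-δ : ∀ i d → δ i (hd d) * ψ (w d) ≡ δ i (hd d) * ψ (i ∷ tl d)
    ψ-δ i d with w d
    ... | j ∷ v = δ-subst i j (λ x → ψ (x ∷ v))
    E₀ : ε * E 0 ≡ (Y 0 φ⟨ 0 ⟩ - Λ * y 0) - r * (Y 1 φ⟨ 0 ⟩ - Λ * y 1)
    E₀ = trans (sym (∑-*ˡ L ε)) (trans (∑-cong L term)
      (trans (∑-linear L 1ℚ (- r)) (trans (cong₂ (λ a b → 1ℚ * a + (- r) * b) (Yψ 0 0) (Yψ 1 0))
        (solve 3 (λ a r b → con 1ℚ :* a :+ (:- r) :* b := a :- r :* b) refl (Y 0 φ⟨ 0 ⟩ - Λ * y 0) r (Y 1 φ⟨ 0 ⟩ - Λ * y 1)))))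
      where
      term : ∀ d → ε * (c d * δ 0 (hd d) * ψ (w d))
             ≡ 1ℚ * (slice 0 d * ψ (0 ∷ tl d)) + (- r) * (slice 1 d * ψ (0 ∷ tl d))
      term d = trans (cong (ε *_) (trans (ℚ.*-assoc (c d) _ _) (cong (c d *_) (ψ-δ 0 d))))
        (trans (solve 4 (λ e c x p → e :* (c :* (x :* p)) := (c :* p) :* (e :* x)) refl ε (c d) (δ 0 (hd d)) (ψ (0 ∷ tl d)))
        (trans (cong (c d * ψ (0 ∷ tl d) *_) (δ-kernel₁-zero r (hd d)))
        (solve 5 (λ c p r a b → c :* p :* (a :- r :* b) := con 1ℚ :* (c :* a :* p) :+ (:- r) :* (c :* b :* p)) refl
          (c d) (ψ (0 ∷ tl d)) r (kernel₁ r 0 (hd d)) (kernel₁ r 1 (hd d)))))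
    Eₛ : ∀ i → ε * E (suc i) ≡ (1ℚ + r * r) * (Y (suc i) φ⟨ suc i ⟩ - Λ * y (suc i))
      - r * (Y i φ⟨ suc i ⟩ - Λ * y i) - r * (Y (2 ℕ.+ i) φ⟨ suc i ⟩ - Λ * y (2 ℕ.+ i))
    Eₛ i = trans (sym (∑-*ˡ L ε)) (trans (∑-cong L term) (trans (∑-+ L)
      (trans (cong₂ _+_ (∑-linear L (1ℚ + r * r) (- r)) (∑-*ˡ L (- r)))
      (trans (cong₂ _+_ (cong₂ (λ a b → (1ℚ + r * r) * a + (- r) * b) (Yψ (suc i) (suc i)) (Yψ i (suc i)))
                        (cong ((- r) *_) (Yψ (2 ℕ.+ i) (suc i))))
        (solve 4 (λ r a b x → (con 1ℚ :+ r :* r) :* a :+ (:- r) :* b :+ (:- r) :* x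
                     := (con 1ℚ :+ r :* r) :* a :- r :* b :- r :* x) refl r (Y (suc i) φ⟨ suc i ⟩ - Λ * y (suc i)) (Y i φ⟨ suc i ⟩ - Λ * y i) (Y (2 ℕ.+ i) φ⟨ suc i ⟩ - Λ * y (2 ℕ.+ i)))))))
      where
      term : ∀ d → ε * (c d * δ (suc i) (hd d) * ψ (w d))
             ≡ ((1ℚ + r * r) * (slice (suc i) d * ψ (suc i ∷ tl d)) + (- r) * (slice i d * ψ (suc i ∷ tl d)))
               + (- r) * (slice (2 ℕ.+ i) d * ψ (suc i ∷ tl d))
      term d = trans (cong (ε *_) (trans (ℚ.*-assoc (c d) _ _) (cong (c d *_) (ψ-δ (suc i) d))))
        (trans (solve 4 (λ e c x p → e :* (c :* (x :* p)) := (c :* p) :* (e :* x)) refl ε (c d) (δ (suc i) (hd d)) (ψ (suc i ∷ tl d)))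
        (trans (cong (c d * ψ (suc i ∷ tl d) *_) (δ-kernel₁-suc r i (hd d)))
        (solve 6 (λ c p r a b x → c :* p :* ((con 1ℚ :+ r :* r) :* a :- r :* b :- r :* x)
            := ((con 1ℚ :+ r :* r) :* (c :* a :* p) :+ (:- r) :* (c :* b :* p)) :+ (:- r) :* (c :* x :* p)) refl
          (c d) (ψ (suc i ∷ tl d)) r (kernel₁ r (suc i) (hd d)) (kernel₁ r i (hd d)) (kernel₁ r (2 ℕ.+ i) (hd d)))))
    Q : ℕ → ℚ
    Q m = ∑ L (λ d → c d * indicator≤ m (hd d) * ψ (w d))
    Q-suc : ∀ m → Q (suc m) ≡ Q m + E (suc m)
    Q-suc m = trans (∑-cong L (λ d →
      solve 4 (λ c a b p → c :* (a :+ b) :* p := c :* a :* p :+ c :* b :* p) refl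
        (c d) (indicator≤ m (hd d)) (δ (suc m) (hd d)) (ψ (w d)))) (∑-+ L)
    κ : ℚ
    κ = r * (2ℚ + 16ℚ * r)
    0≤½-r : 0ℚ ≤ ½ - r
    0≤½-r = ≤⇒0≤- r≤½
    16Πr g h : ℚ
    16Πr = 16ℚ * r * Π
    g    = Π * κ
    h    = (1ℚ + r * r) * 16Πr
    centre : ∀ i j → Y j φ⟨ i ⟩ - Λ * y j ≤ - (16Πr * y j)
    centre i j = subst (Y j φ⟨ i ⟩ - Λ * y j ≤_)
      (solve 3 (λ r Π y → Π :* y :- (con 1ℚ :+ con 16ℚ :* r) :* Π :* y := :- (con 16ℚ :* r :* Π :* y)) refl r Π (y j))
      (ℚ.+-monoˡ-≤ (- (Λ * y j)) (Y≤ j φ⟨ i ⟩ (λ v → φ≥ _) (λ v → φ≤ _)))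
    side : ∀ i j → - (r * (Y j φ⟨ i ⟩ - Λ * y j)) ≤ g * y j
    side i j = subst₂ _≤_
      (solve 3 (λ r Y z → r :* (:- Y :+ z) := :- (r :* (Y :- z))) refl r (Y j φ⟨ i ⟩) (Λ * y j))
      (solve 3 (λ r Π y → r :* (Π :* y :+ (con 1ℚ :+ con 16ℚ :* r) :* Π :* y)
                  := Π :* (r :* (con 2ℚ :+ con 16ℚ :* r)) :* y) refl r Π (y j))
      (*-monoˡ r 0≤r (ℚ.+-monoˡ-≤ (Λ * y j) (-Y≤ j φ⟨ i ⟩ (λ v → φ≥ _) (λ v → φ≤ _))))
    -- The difference is Π ((1 + 16 r)(1 - r)² - (1 + r)²). It vanishes at r = 1/2, so it is the
    -- prime 2 that dictates the constant 16.
    2g≤h : g + g ≤ h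
    2g≤h = ≤-excess (Π * r * (16ℚ * ((½ - r) * (½ - r)) + 16ℚ * (½ - r)))
      (solve 2 (λ r Π → (con 1ℚ :+ r :* r) :* (con 16ℚ :* r :* Π) :=
         (Π :* (r :* (con 2ℚ :+ con 16ℚ :* r)) :+ Π :* (r :* (con 2ℚ :+ con 16ℚ :* r)))
         :+ Π :* r :* (con 16ℚ :* ((con ½ :- r) :* (con ½ :- r)) :+ con 16ℚ :* (con ½ :- r))) refl r Π)
      (0≤* (0≤* 0≤Π 0≤r) (0≤+ (0≤* (ℚ.nonNegative⁻¹ 16ℚ) (0≤* 0≤½-r 0≤½-r)) (0≤* (ℚ.nonNegative⁻¹ 16ℚ) 0≤½-r)))
    g≤16Πr : g ≤ 16Πr
    g≤16Πr = ≤-excess (Π * r * ((+ 6 / 1) + 16ℚ * (½ - r)))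
      (solve 2 (λ r Π → con 16ℚ :* r :* Π :=
         Π :* (r :* (con 2ℚ :+ con 16ℚ :* r)) :+ Π :* r :* (con (+ 6 / 1) :+ con 16ℚ :* (con ½ :- r))) refl r Π)
      (0≤* (0≤* 0≤Π 0≤r) (0≤+ (ℚ.nonNegative⁻¹ (+ 6 / 1)) (0≤* (ℚ.nonNegative⁻¹ 16ℚ) 0≤½-r)))
    -- Row m + 1 contributes at most g y(m) - h y(m+1) + g y(m+2). As h ≥ 2g, this is at most g
    -- times the increment of the difference y(m+1) - y(m), so the partial sums telescope. Row 0 has
    -- a single neighbour and needs only `g≤16Πr`.
    Q≤ : ∀ m → ε * Q m ≤ g * (y (suc m) - y m)
    Q≤ zero = begin
      ε * Q 0                                                    ≡⟨ E₀ ⟩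
      (Y 0 φ⟨ 0 ⟩ - Λ * y 0) - r * (Y 1 φ⟨ 0 ⟩ - Λ * y 1)        ≤⟨ ℚ.+-mono-≤ (centre 0 0) (side 0 1) ⟩
      - (16Πr * y 0) + g * y 1                                   ≤⟨ ℚ.+-monoˡ-≤ (g * y 1) (ℚ.neg-antimono-≤ (*-monoʳ (y 0) (0≤y 0) g≤16Πr)) ⟩
      - (g * y 0) + g * y 1                                      ≡⟨ solve 3 (λ g a b → :- (g :* a) :+ g :* b := g :* (b :- a)) refl g (y 0) (y 1) ⟩
      g * (y 1 - y 0)                                            ∎
      where open ℚ.≤-Reasoning
    Q≤ (suc m) = begin
      ε * Q (suc m)               ≡⟨ cong (ε *_) (Q-suc m) ⟩
      ε * (Q m + E (suc m))       ≡⟨ ℚ.*-distribˡ-+ ε (Q m) (E (suc m)) ⟩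
      ε * Q m + ε * E (suc m)     ≡⟨ cong (_+_ (ε * Q m)) (Eₛ m) ⟩
      ε * Q m + ((1ℚ + r * r) * (Y (suc m) φ⟨ suc m ⟩ - Λ * b)
        - r * (Y m φ⟨ suc m ⟩ - Λ * a) - r * (Y (2 ℕ.+ m) φ⟨ suc m ⟩ - Λ * x))
                                  ≤⟨ ℚ.+-mono-≤ (Q≤ m) (ℚ.+-mono-≤ (ℚ.+-mono-≤
                                       (*-monoˡ (1ℚ + r * r) 0≤1+r² (centre (suc m) (suc m)))
                                       (side (suc m) m)) (side (suc m) (2 ℕ.+ m))) ⟩
      g * (b - a) + ((1ℚ + r * r) * (- (16Πr * b)) + g * a + g * x)
                                  ≡⟨ solve 6 (λ g a b x s t → g :* (b :- a) :+ (s :* (:- (t :* b)) :+ g :* a :+ g :* x)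
                                       := g :* (x :+ b) :- (s :* t) :* b) refl g a b x (1ℚ + r * r) 16Πr ⟩
      g * (x + b) - h * b         ≤⟨ ℚ.+-monoʳ-≤ (g * (x + b)) (ℚ.neg-antimono-≤ (*-monoʳ b (0≤y (suc m)) 2g≤h)) ⟩
      g * (x + b) - (g + g) * b   ≡⟨ solve 3 (λ g x b → g :* (x :+ b) :- (g :+ g) :* b := g :* (x :- b)) refl g x b ⟩
      g * (x - b)                 ∎
      where
      open ℚ.≤-Reasoning
      a b x : ℚ
      a = y m
      b = y (suc m)
      x = y (2 ℕ.+ m)
      0≤1+r² : 0ℚ ≤ 1ℚ + r * r
      0≤1+r² = 0≤+ (ℚ.nonNegative⁻¹ 1ℚ) (0≤* 0≤r 0≤r)
    -- Any bound on all the heads will do; the sum is the easiest one to compare with.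
    m : ℕ
    m = sum (map hd L)
    hd≤m : ∀ {L′ d} → d ∈ L′ → hd d ℕ.≤ sum (map hd L′)
    hd≤m {x ∷ L′} (here refl) = ℕ.m≤m+n (hd x) _
    hd≤m {x ∷ L′} (there d∈)  = ℕ.≤-trans (hd≤m d∈) (ℕ.m≤n+m _ (hd x))
    y-beyond : y (suc m) ≡ r * y m
    y-beyond = trans (∑-cong∈ L (λ d d∈ → trans (cong (c d *_) (kernel₁-beyond r (hd≤m d∈)))
        (solve 3 (λ c r k → c :* (r :* k) := r :* (c :* k)) refl (c d) r (kernel₁ r m (hd d)))))
      (∑-*ˡ L r)
    y-beyond≤ : y (suc m) - y m ≤ 0ℚ
    y-beyond≤ = subst (y (suc m) - y m ≤_) (ℚ.+-inverseʳ (y m)) (ℚ.+-monoˡ-≤ (- y m)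
      (subst₂ _≤_ (sym y-beyond) (ℚ.*-identityˡ (y m)) (*-monoʳ {r} {1ℚ} (y m) (0≤y m) (ℚ.≤-trans r≤½ (ℚ.≤ᵇ⇒≤ _)))))
    Q-total : Q m ≡ ∑ L (λ d → c d * φ (w d)) - Λ * ∑ L c
    Q-total = trans (∑-cong∈ L (λ d d∈ → trans (cong (λ z → c d * z * ψ (w d)) (indicator≤≡1 (hd≤m d∈)))
        (solve 3 (λ c f l → c :* con 1ℚ :* (f :- l) := con 1ℚ :* (c :* f) :+ (:- l) :* c) refl (c d) (φ (w d)) Λ)))
      (trans (∑-linear L {λ d → c d * φ (w d)} {c} 1ℚ (- Λ)) (solve 3 (λ a l b → con 1ℚ :* a :+ (:- l) :* b := a :- l :* b) refl (∑ L (λ d → c d * φ (w d))) Λ (∑ L c)))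
    0<ε : 0ℚ < ε
    0<ε = subst (0ℚ <_) (solve 1 (λ r → con (+ 3 / 4) :+ ((con ½ :- r) :* r :+ con ½ :* (con ½ :- r))
                                := con 1ℚ :- r :* r) refl r)
      (ℚ.+-mono-<-≤ (ℚ.positive⁻¹ (+ 3 / 4)) (0≤+ (0≤* 0≤½-r 0≤r) (0≤* (ℚ.nonNegative⁻¹ ½) 0≤½-r)))
    0≤g : 0ℚ ≤ g
    0≤g = 0≤* 0≤Π (0≤* 0≤r (0≤+ (ℚ.nonNegative⁻¹ 2ℚ) (0≤* (ℚ.nonNegative⁻¹ 16ℚ) 0≤r)))
    Q≤0 : ∑ L (λ d → c d * φ (w d)) - Λ * ∑ L c ≤ 0ℚ
    Q≤0 = ℚ.*-cancelˡ-≤-pos ε {{ℚ.positive 0<ε}} (begin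
      ε * (∑ L (λ d → c d * φ (w d)) - Λ * ∑ L c)  ≡⟨ cong (ε *_) (sym Q-total) ⟩
      ε * Q m                                      ≤⟨ Q≤ m ⟩
      g * (y (suc m) - y m)                        ≤⟨ *-monoˡ g 0≤g y-beyond≤ ⟩
      g * 0ℚ                                       ≡⟨ ℚ.*-zeroʳ g ⟩
      0ℚ                                           ≡⟨ sym (ℚ.*-zeroʳ ε) ⟩
      ε * 0ℚ                                       ∎)
      where open ℚ.≤-Reasoning
    conclusion : ∑ L (λ d → c d * φ (w d)) ≤ Λ * ∑ L c
    conclusion = 0≤-⇒≤ (subst (0ℚ ≤_) (solve 2 (λ a b → :- (a :- b) := b :- a) refl (∑ L (λ d → c d * φ (w d))) (Λ * ∑ L c)) (ℚ.neg-antimono-≤ Q≤0))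

-- Boxes and distances of exponent vectors

-- Given in lowest terms, so that numerator and denominator compute; `z / 1` would pass through a
-- gcd.
ι : ℤ → ℚ
ι z = mkℚ z 0 (Coprime.sym (Coprime.1-coprimeTo ℤ.∣ z ∣))

ι-+ : ∀ a b → ι (a ℤ.+ b) ≡ ι a + ι b
ι-+ a b = ℚ.toℚᵘ-injective (ℚᵘ.≃-trans (ℚᵘ.*≡* eq) (ℚᵘ.≃-sym (ℚ.toℚᵘ-homo-+ (ι a) (ι b))))
  where
  eq : (a ℤ.+ b) ℤ.* (1ℤ ℤ.* 1ℤ) ≡ (a ℤ.* 1ℤ ℤ.+ b ℤ.* 1ℤ) ℤ.* 1ℤ
  eq = trans (ℤ.*-identityʳ _) (sym (trans (ℤ.*-identityʳ _) (cong₂ ℤ._+_ (ℤ.*-identityʳ a) (ℤ.*-identityʳ b))))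

ι-* : ∀ a b → ι (a ℤ.* b) ≡ ι a * ι b
ι-* a b = ℚ.toℚᵘ-injective (ℚᵘ.≃-trans (ℚᵘ.*≡* refl) (ℚᵘ.≃-sym (ℚ.toℚᵘ-homo-* (ι a) (ι b))))

ι-mono : ∀ {a b} → a ℤ.≤ b → ι a ≤ ι b
ι-mono p = *≤* (ℤ.*-monoʳ-≤-nonNeg 1ℤ p)

ι-cancel : ∀ {a b} → ι a ≤ ι b → a ℤ.≤ b
ι-cancel (*≤* p) = ℤ.*-cancelʳ-≤-pos _ _ 1ℤ p

ι-cancel-< : ∀ {a b} → ι a < ι b → a ℤ.< b
ι-cancel-< (*<* p) = ℤ.*-cancelʳ-<-nonNeg 1ℤ p

ιℕ : ℕ → ℚ
ιℕ n = ι (+ n)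

ιℕ-+ : ∀ a b → ιℕ (a ℕ.+ b) ≡ ιℕ a + ιℕ b
ιℕ-+ a b = ι-+ (+ a) (+ b)

ιℕ-* : ∀ a b → ιℕ (a ℕ.* b) ≡ ιℕ a * ιℕ b
ιℕ-* a b = trans (cong ι (ℤ.pos-* a b)) (ι-* (+ a) (+ b))

ιℕ-mono : ∀ {a b} → a ℕ.≤ b → ιℕ a ≤ ιℕ b
ιℕ-mono p = ι-mono (ℤ.+≤+ p)

0≤ιℕ : ∀ n → 0ℚ ≤ ιℕ n
0≤ιℕ n = ιℕ-mono ℕ.z≤n

clamp₁ : ℕ → ℕ → ℕ → ℕ
clamp₁ l h x = l ⊔ (h ⊓ x)

∣-∣-split : ∀ {a b c} → a ℕ.≤ b → b ℕ.≤ c → ∣ a - c ∣ ≡ ∣ a - b ∣ ℕ.+ ∣ b - c ∣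
∣-∣-split {a} {b} {c} a≤b b≤c
  rewrite ℕ.m≤n⇒∣m-n∣≡n∸m a≤b | ℕ.m≤n⇒∣m-n∣≡n∸m b≤c | ℕ.m≤n⇒∣m-n∣≡n∸m (ℕ.≤-trans a≤b b≤c) =
  ℕ.+-cancelˡ-≡ a _ _ (trans (ℕ.m+[n∸m]≡n (ℕ.≤-trans a≤b b≤c))
    (sym (trans (sym (ℕ.+-assoc a (b ∸ a) (c ∸ b)))
      (trans (cong (ℕ._+ (c ∸ b)) (ℕ.m+[n∸m]≡n a≤b)) (ℕ.m+[n∸m]≡n b≤c)))))

clamp₁-between : ∀ {l h t} x → l ℕ.≤ t → t ℕ.≤ h →
  ∣ t - x ∣ ≡ ∣ t - clamp₁ l h x ∣ ℕ.+ ∣ clamp₁ l h x - x ∣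
clamp₁-between {l} {h} {t} x l≤t t≤h with ℕ.≤-total h x
... | inj₁ h≤x rewrite ℕ.m≤n⇒m⊓n≡m h≤x | ℕ.m≤n⇒m⊔n≡n (ℕ.≤-trans l≤t t≤h) = ∣-∣-split t≤h h≤x
... | inj₂ x≤h rewrite ℕ.m≥n⇒m⊓n≡n x≤h with ℕ.≤-total l x
... | inj₁ l≤x rewrite ℕ.m≤n⇒m⊔n≡n l≤x | ℕ.∣n-n∣≡0 x = sym (ℕ.+-identityʳ _)
... | inj₂ x≤l rewrite ℕ.m≥n⇒m⊔n≡m x≤l
  | ℕ.∣-∣-comm t x | ℕ.∣-∣-comm t l | ℕ.∣-∣-comm l x = trans (∣-∣-split x≤l l≤t) (ℕ.+-comm ∣ x - l ∣ ∣ l - t ∣)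

clamp₁-≤ : ∀ {l h} x → l ℕ.≤ h → clamp₁ l h x ℕ.≤ h
clamp₁-≤ {l} {h} x l≤h = ℕ.⊔-lub l≤h (ℕ.m⊓n≤m h x)

clamp₁-id : ∀ {l h x} → l ℕ.≤ x → x ℕ.≤ h → clamp₁ l h x ≡ x
clamp₁-id l≤x x≤h rewrite ℕ.m≥n⇒m⊓n≡n x≤h = ℕ.m≤n⇒m⊔n≡n l≤x

-- The hull is covered by the two intervals and the gap between b, a point of the second, and the
-- first.
hull₁ : ∀ {l h l′ h′} b → l ℕ.≤ h → l′ ℕ.≤ b → b ℕ.≤ h′ →
  ∣ l ⊓ l′ - h ⊔ h′ ∣ ℕ.≤ ∣ l - h ∣ ℕ.+ ∣ l′ - h′ ∣ ℕ.+ ∣ clamp₁ l h b - b ∣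
hull₁ {l} {h} {l′} {h′} b l≤h l′≤b b≤h′
  rewrite ℕ.m≤n⇒∣m-n∣≡n∸m (ℕ.≤-trans (ℕ.m⊓n≤m l l′) (ℕ.≤-trans l≤h (ℕ.m≤m⊔n h h′))) =
  ℕ.m≤n+o⇒m∸n≤o (h ⊔ h′) (l ⊓ l′) (ℕ.⊔-lub
    (case l l′ (ℕ.≤-trans h≤ (ℕ.+-monoʳ-≤ l (ℕ.≤-trans (ℕ.m≤m+n _ _) (ℕ.m≤m+n _ e))))
      (ℕ.≤-trans h≤ (ℕ.≤-trans (ℕ.+-monoˡ-≤ D (ℕ.≤-trans (ℕ.m≤m⊔n l _) (ℕ.≤-trans (ℕ.m≤n+∣m-n∣ c b) (ℕ.+-monoˡ-≤ e (ℕ.≤-trans b≤h′ h′≤)))))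
        (ℕ.≤-reflexive (ℕ-solve 4 (λ l D D′ e → l ⊕ D′ ⊕ e ⊕ D ⊜ l ⊕ (D ⊕ D′ ⊕ e)) refl l′ D D′ e)))))
    (case l l′ (ℕ.≤-trans h′≤ (ℕ.≤-trans (ℕ.+-monoˡ-≤ D′ (ℕ.≤-trans l′≤b (ℕ.≤-trans (ℕ.m≤n+∣n-m∣ b c) (ℕ.+-monoˡ-≤ e (ℕ.≤-trans (clamp₁-≤ b l≤h) h≤)))))
        (ℕ.≤-reflexive (ℕ-solve 4 (λ l D D′ e → l ⊕ D ⊕ e ⊕ D′ ⊜ l ⊕ (D ⊕ D′ ⊕ e)) refl l D D′ e))))
      (ℕ.≤-trans h′≤ (ℕ.+-monoʳ-≤ l′ (ℕ.≤-trans (ℕ.m≤n+m _ D) (ℕ.m≤m+n _ e))))))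
  where
  c D D′ e : ℕ
  c  = clamp₁ l h b
  D  = ∣ l - h ∣
  D′ = ∣ l′ - h′ ∣
  e  = ∣ c - b ∣
  h≤ : h ℕ.≤ l ℕ.+ D
  h≤ = ℕ.m≤n+∣n-m∣ h l
  h′≤ : h′ ℕ.≤ l′ ℕ.+ D′
  h′≤ = ℕ.m≤n+∣n-m∣ h′ l′
  case : ∀ {x s} a b → x ℕ.≤ a ℕ.+ s → x ℕ.≤ b ℕ.+ s → x ℕ.≤ a ⊓ b ℕ.+ s
  case a b p q with ℕ.⊓-sel a b
  ... | inj₁ eq rewrite eq = p
  ... | inj₂ eq rewrite eq = q

dist : ∀ {n} → Vec ℕ n → Vec ℕ n → Vec ℕ n → ℕ
dist []       []      []      = 1
dist (p ∷ ps) (i ∷ u) (j ∷ v) = p ℕ.^ ∣ i - j ∣ ℕ.* dist ps u v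

clamp : ∀ {n} → Vec ℕ n → Vec ℕ n → Vec ℕ n → Vec ℕ n
clamp []       []       []      = []
clamp (l ∷ lo) (h ∷ hi) (x ∷ v) = clamp₁ l h x ∷ clamp lo hi v

InBox : ∀ {n} → Vec ℕ n → Vec ℕ n → Vec ℕ n → Set
InBox lo hi v = Pointwise ℕ._≤_ lo v × Pointwise ℕ._≤_ v hi

clamp-InBox : ∀ {n} {lo hi : Vec ℕ n} v → Pointwise ℕ._≤_ lo hi → InBox lo hi (clamp lo hi v)
clamp-InBox []                        []         = [] , []
clamp-InBox {lo = l ∷ _} {h ∷ _} (x ∷ v) (l≤h ∷ lo≤hi) with clamp-InBox v lo≤hi
... | p , q = ℕ.m≤m⊔n l _ ∷ p , clamp₁-≤ x l≤h ∷ q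

clamp-id : ∀ {n} {lo hi v : Vec ℕ n} → InBox lo hi v → clamp lo hi v ≡ v
clamp-id ([] , [])                   = refl
clamp-id (l≤x ∷ lo≤v , x≤h ∷ v≤hi) = cong₂ _∷_ (clamp₁-id l≤x x≤h) (clamp-id (lo≤v , v≤hi))

InBox⇒≤ : ∀ {n} {lo hi v : Vec ℕ n} → InBox lo hi v → Pointwise ℕ._≤_ lo hi
InBox⇒≤ (p , q) = Pointwise.trans ℕ.≤-trans p q

-- Taken over all coordinates, sums of lengths become products of distances. Hence a merge raises
-- the product of the diameters by at most the gap, measured from the first box to any one point of
-- the second.
hull-dist : ∀ {n} {ps lo hi lo′ hi′ b : Vec ℕ n} → AllV.All (1 ℕ.≤_) ps →
  Pointwise ℕ._≤_ lo hi → InBox lo′ hi′ b →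
  dist ps (zipWith _⊓_ lo lo′) (zipWith _⊔_ hi hi′) ℕ.≤
  dist ps lo hi ℕ.* dist ps lo′ hi′ ℕ.* dist ps (clamp lo hi b) b
hull-dist [] [] ([] , []) = ℕ.≤-refl
hull-dist {ps = p@(suc _) ∷ ps} {l ∷ lo} {h ∷ hi} {l′ ∷ lo′} {h′ ∷ hi′} {x ∷ b}
  (1≤p ∷ 1≤ps) (l≤h ∷ lo≤hi) (l≤x ∷ lo≤b , x≤h ∷ b≤hi) = begin
    p ℕ.^ ∣ l ⊓ l′ - h ⊔ h′ ∣ ℕ.* _
      ≤⟨ ℕ.*-mono-≤ (ℕ.^-monoʳ-≤ p (hull₁ x l≤h l≤x x≤h)) (hull-dist 1≤ps lo≤hi (lo≤b , b≤hi)) ⟩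
    p ℕ.^ (i ℕ.+ j ℕ.+ k) ℕ.* (A ℕ.* B ℕ.* C)
      ≡⟨ cong (ℕ._* (A ℕ.* B ℕ.* C)) (trans (ℕ.^-distribˡ-+-* p (i ℕ.+ j) k) (cong (ℕ._* p ℕ.^ k) (ℕ.^-distribˡ-+-* p i j))) ⟩
    p ℕ.^ i ℕ.* p ℕ.^ j ℕ.* p ℕ.^ k ℕ.* (A ℕ.* B ℕ.* C)
      ≡⟨ ℕ-solve 6 (λ x y z A B C → x ⊗ y ⊗ z ⊗ (A ⊗ B ⊗ C) ⊜ x ⊗ A ⊗ (y ⊗ B) ⊗ (z ⊗ C)) refl (p ℕ.^ i) (p ℕ.^ j) (p ℕ.^ k) A B C ⟩
    p ℕ.^ i ℕ.* A ℕ.* (p ℕ.^ j ℕ.* B) ℕ.* (p ℕ.^ k ℕ.* C) ∎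
  where
  open ℕ.≤-Reasoning
  i j k A B C : ℕ
  i = ∣ l - h ∣
  j = ∣ l′ - h′ ∣
  k = ∣ clamp₁ l h x - x ∣
  A = dist ps lo hi
  B = dist ps lo′ hi′
  C = dist ps (clamp lo hi b) b

dist≥1 : ∀ {n} {ps : Vec ℕ n} → AllV.All (1 ℕ.≤_) ps → ∀ u v → 1 ℕ.≤ dist ps u v
dist≥1 []           []      []      = ℕ.≤-refl
dist≥1 {ps = p@(suc _) ∷ _} (_ ∷ 1≤ps) (i ∷ u) (j ∷ v) = ℕ.*-mono-≤ (ℕ.>-nonZero⁻¹ _ {{ℕ.m^n≢0 p ∣ i - j ∣}}) (dist≥1 1≤ps u v)

-- Divisibility and not just an inequality, because the diameter has to clear the denominators of
-- the kernel on the box.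
dist-∣-box : ∀ {n} (ps : Vec ℕ n) {lo hi u v} → InBox lo hi u → InBox lo hi v → dist ps u v ∣ dist ps lo hi
dist-∣-box []       ([] , []) ([] , [])          = ∣.∣-refl
dist-∣-box (p ∷ ps) {l ∷ _} {h ∷ _} {i ∷ _} {j ∷ _} (a ∷ as , b ∷ bs) (c ∷ cs , d ∷ ds) =
  ∣.*-pres-∣ (^-∣ (le a b c d)) (dist-∣-box ps (as , bs) (cs , ds))
  where
  ^-∣ : ∀ {x y} → x ℕ.≤ y → p ℕ.^ x ∣ p ℕ.^ y
  ^-∣ {x} {y} x≤y = divides (p ℕ.^ (y ∸ x))
    (trans (cong (p ℕ.^_) (sym (ℕ.m∸n+n≡m x≤y))) (ℕ.^-distribˡ-+-* p (y ∸ x) x))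
  le : l ℕ.≤ i → i ℕ.≤ h → l ℕ.≤ j → j ℕ.≤ h → ∣ i - j ∣ ℕ.≤ ∣ l - h ∣
  le l≤i i≤h l≤j j≤h rewrite ℕ.m≤n⇒∣m-n∣≡n∸m (ℕ.≤-trans l≤i i≤h) with ℕ.∣m-n∣≡[m∸n]∨[n∸m] i j
  ... | inj₁ eq rewrite eq = ℕ.∸-mono i≤h l≤j
  ... | inj₂ eq rewrite eq = ℕ.∸-mono j≤h l≤i

*-interchange : ∀ a b c d → (a * b) * (c * d) ≡ (a * c) * (b * d)
*-interchange = solve 4 (λ a b c d → (a :* b) :* (c :* d) := (a :* c) :* (b :* d)) refl

^-+ : ∀ r i j → r ^ (i ℕ.+ j) ≡ r ^ i * r ^ j
^-+ r zero    j = sym (ℚ.*-identityˡ _)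
^-+ r (suc i) j = trans (cong (r *_) (^-+ r i j)) (sym (ℚ.*-assoc r _ _))

kernel-sym : ∀ {n} (rs : Vec ℚ n) u v → kernel rs u v ≡ kernel rs v u
kernel-sym []       u v = refl
kernel-sym (r ∷ rs) u v = cong₂ _*_ (cong (r ^_) (ℕ.∣-∣-comm (head u) (head v))) (kernel-sym rs (tail u) (tail v))

kernel-refl : ∀ {n} (rs : Vec ℚ n) u → kernel rs u u ≡ 1ℚ
kernel-refl []       u = refl
kernel-refl (r ∷ rs) u rewrite ℕ.∣n-n∣≡0 (head u) | kernel-refl rs (tail u) = refl

-- Boxes are gated: in each coordinate the clamped v lies between v and every t of the box, so all
-- distances from v into the box pass through this one point. This is why clusters are enclosed in
-- boxes.
kernel-clamp : ∀ {n} (rs : Vec ℚ n) {lo hi t} → InBox lo hi t → ∀ v →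
  kernel rs t v ≡ kernel rs t (clamp lo hi v) * kernel rs (clamp lo hi v) v
kernel-clamp []       _                 v = refl
kernel-clamp (r ∷ rs) {l ∷ lo} {h ∷ hi} {i ∷ t} (a ∷ as , b ∷ bs) (x ∷ v)
  rewrite clamp₁-between x a b | ^-+ r ∣ i - clamp₁ l h x ∣ ∣ clamp₁ l h x - x ∣ | kernel-clamp rs (as , bs) v =
  *-interchange (r ^ ∣ i - clamp₁ l h x ∣) (r ^ ∣ clamp₁ l h x - x ∣) _ _

Reciprocal : ∀ {n} → Vec ℚ n → Vec ℕ n → Set
Reciprocal = Pointwise (λ r p → r * ιℕ p ≡ 1ℚ)

kernel-dist : ∀ {n} {rs : Vec ℚ n} {ps} → Reciprocal rs ps → ∀ u v → kernel rs u v * ιℕ (dist ps u v) ≡ 1ℚ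
kernel-dist [] [] [] = refl
kernel-dist {rs = r ∷ rs} {p ∷ ps} (rp≡1 ∷ h) (i ∷ u) (j ∷ v) =
  trans (cong (kernel₁ r i j * kernel rs u v *_) (ιℕ-* (p ℕ.^ ∣ i - j ∣) (dist ps u v)))
  (trans (*-interchange (kernel₁ r i j) (kernel rs u v) (ιℕ (p ℕ.^ ∣ i - j ∣)) (ιℕ (dist ps u v)))
  (cong₂ _*_ (pow ∣ i - j ∣) (kernel-dist h u v)))
  where
  pow : ∀ m → r ^ m * ιℕ (p ℕ.^ m) ≡ 1ℚ
  pow zero    = refl
  pow (suc m) = trans (cong (r * r ^ m *_) (ιℕ-* p (p ℕ.^ m)))
    (trans (*-interchange r (r ^ m) (ιℕ p) (ιℕ (p ℕ.^ m)))
      (cong₂ _*_ rp≡1 (pow m)))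

0≤kernel : ∀ {n} {rs : Vec ℚ n} → AllV.All Ratio rs → ∀ u v → 0ℚ ≤ kernel rs u v
0≤kernel []                u v = ℚ.nonNegative⁻¹ 1ℚ
0≤kernel {rs = r ∷ _} ((0≤r , _) ∷ h) u v = 0≤* (pow ∣ head u - head v ∣) (0≤kernel h (tail u) (tail v))
  where
  pow : ∀ m → 0ℚ ≤ r ^ m
  pow zero    = ℚ.nonNegative⁻¹ 1ℚ
  pow (suc m) = 0≤* 0≤r (pow m)

-- Potentials of clusters

module _ {P : Set} where

  ∑-++ : ∀ (L M : List P) {F} → ∑ (L ++ M) F ≡ ∑ L F + ∑ M F
  ∑-++ []          M {F} = sym (ℚ.+-identityˡ (∑ M F))
  ∑-++ (x ∷ L) M {F} = trans (cong (_+_ (F x)) (∑-++ L M)) (sym (ℚ.+-assoc (F x) (∑ L F) (∑ M F)))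

  ∑-↭ : ∀ {L M : List P} {F} → L ↭ M → ∑ L F ≡ ∑ M F
  ∑-↭ _↭_.refl           = refl
  ∑-↭ {F = F} (_↭_.prep x p) = cong (_+_ (F x)) (∑-↭ p)
  ∑-↭ {x ∷ y ∷ L} {_ ∷ _ ∷ M} {F} (_↭_.swap x y p) =
    trans (cong (λ z → F x + (F y + z)) (∑-↭ p))
      (solve 3 (λ a b c → a :+ (b :+ c) := b :+ (a :+ c)) refl (F x) (F y) (∑ M F))
  ∑-↭ (_↭_.trans p q)   = trans (∑-↭ p) (∑-↭ q)

  ∑-ιℕ : ∀ (L : List P) (m : P → ℕ) → ∑ L (λ v → ιℕ (m v)) ≡ ιℕ (sum (map m L))
  ∑-ιℕ []      m = refl
  ∑-ιℕ (v ∷ L) m = trans (cong (_+_ (ιℕ (m v))) (∑-ιℕ L m)) (sym (ιℕ-+ (m v) _))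

sgn : ℤ → ℤ
sgn (+ _)    = 1ℤ
sgn -[1+ _ ] = -1ℤ

-1≤sgn : ∀ z → - 1ℚ ≤ ι (sgn z)
-1≤sgn (+ _)    = ℚ.≤ᵇ⇒≤ _
-1≤sgn -[1+ _ ] = ℚ.≤-refl

sgn≤1 : ∀ z → ι (sgn z) ≤ 1ℚ
sgn≤1 (+ _)    = ℚ.≤-refl
sgn≤1 -[1+ _ ] = ℚ.≤ᵇ⇒≤ _

∣_∣ℚ : ℤ → ℚ
∣ z ∣ℚ = ιℕ ℤ.∣ z ∣

ι*sgn : ∀ z → ι z * ι (sgn z) ≡ ∣ z ∣ℚ
ι*sgn z = trans (sym (ι-* z (sgn z))) (cong ι (z*sgn z))
  where
  z*sgn : ∀ z → z ℤ.* sgn z ≡ + ℤ.∣ z ∣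
  z*sgn (+ n)    = ℤ.*-identityʳ (+ n)
  z*sgn -[1+ n ] = trans (ℤ.*-comm -[1+ n ] -1ℤ) (ℤ.-1*i≡-i -[1+ n ])

ι≤∣∣ : ∀ z → ι z ≤ ∣ z ∣ℚ
ι≤∣∣ (+ n)    = ℚ.≤-refl
ι≤∣∣ -[1+ n ] = ι-mono ℤ.-≤+

-∣∣≤ι : ∀ z → - ∣ z ∣ℚ ≤ ι z
-∣∣≤ι z = subst₂ _≤_ refl (ι-neg z) (ℚ.neg-antimono-≤ (subst (ι (ℤ.- z) ≤_) (cong ιℕ (ℤ.∣-i∣≡∣i∣ z)) (ι≤∣∣ (ℤ.- z))))
  where
  ι-neg : ∀ z → - ι (ℤ.- z) ≡ ι z
  ι-neg (+ zero)    = refl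
  ι-neg ℤ.+[1+ n ]  = refl
  ι-neg -[1+ n ]    = refl

-∣∣≤ι*sgn : ∀ z y → - ∣ z ∣ℚ ≤ ι z * ι (sgn y)
-∣∣≤ι*sgn z (+ _)    = subst (- ∣ z ∣ℚ ≤_) (sym (ℚ.*-identityʳ (ι z))) (-∣∣≤ι z)
-∣∣≤ι*sgn z -[1+ _ ] = subst (- ∣ z ∣ℚ ≤_) (solve 1 (λ a → :- a := a :* (:- con 1ℚ)) refl (ι z)) (ℚ.neg-antimono-≤ (ι≤∣∣ z))

-- Points in a box are reached from u through the clamped u, so the potential at u is that at the
-- clamped point, damped by one kernel factor. Nonnegativity therefore needs checking on the box
-- only.
∑-kernel-clamp : ∀ {n} (rs : Vec ℚ n) L (x : Vec ℕ n → ℚ) {lo hi} → (∀ v → v ∈ L → InBox lo hi v) → ∀ u →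
  kernel rs (clamp lo hi u) u * ∑ L (λ v → x v * kernel rs (clamp lo hi u) v) ≡ ∑ L (λ v → x v * kernel rs u v)
∑-kernel-clamp {n} rs L x {lo} {hi} L⊆box u = trans (sym (∑-*ˡ L (kernel rs πu u))) (∑-cong∈ L (λ v v∈ → begin
  kernel rs πu u * (x v * kernel rs πu v)
    ≡⟨ solve 3 (λ a b c → a :* (b :* c) := b :* (c :* a)) refl (kernel rs πu u) (x v) (kernel rs πu v) ⟩
  x v * (kernel rs πu v * kernel rs πu u)
    ≡⟨ cong (λ k → x v * (k * kernel rs πu u)) (kernel-sym rs πu v) ⟩
  x v * (kernel rs v πu * kernel rs πu u)
    ≡⟨ cong (x v *_) (trans (sym (kernel-clamp rs (L⊆box v v∈) u)) (kernel-sym rs v u)) ⟩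
  x v * kernel rs u v ∎))
  where
  open ≡-Reasoning
  πu : Vec ℕ n
  πu = clamp lo hi u

module _ {n} {rs : Vec ℚ n} {ps : Vec ℕ n} (ratios : AllV.All Ratio rs) (recip : Reciprocal rs ps) where

  kernel≤ : ∀ {R u v} → R ℕ.≤ dist ps u v → kernel rs u v * ιℕ R ≤ 1ℚ
  kernel≤ {R} {u} {v} R≤ = subst (kernel rs u v * ιℕ R ≤_) (kernel-dist recip u v)
    (*-monoˡ (kernel rs u v) (0≤kernel ratios u v) (ιℕ-mono R≤))

  -- Balayage: sweeping every point onto the box, with its weight damped by the kernel, leaves the
  -- potential on the box unchanged. At any other u the new potential is the old one at the clamped
  -- u, damped likewise.
  ∑-clamped≥0 : ∀ {P : Set} (S : List P) (x : P → ℚ) (p : P → Vec ℕ n) {lo hi} → Pointwise ℕ._≤_ lo hi →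
    (∀ u → 0ℚ ≤ ∑ S (λ v → x v * kernel rs u (p v))) →
    ∀ u → 0ℚ ≤ ∑ S (λ v → x v * kernel rs (clamp lo hi (p v)) (p v) * kernel rs u (clamp lo hi (p v)))
  ∑-clamped≥0 S x p {lo} {hi} lo≤hi V≥0 u = subst (0ℚ ≤_)
    (trans (sym (∑-*ˡ S (kernel rs πu u))) (∑-cong S term))
    (0≤* (0≤kernel ratios πu u) (V≥0 πu))
    where
    πu : Vec ℕ n
    πu = clamp lo hi u
    term : ∀ v → kernel rs πu u * (x v * kernel rs πu (p v))
      ≡ x v * kernel rs (clamp lo hi (p v)) (p v) * kernel rs u (clamp lo hi (p v))
    term v = begin
      kernel rs πu u * (x v * kernel rs πu (p v))
        ≡⟨ cong (λ k → kernel rs πu u * (x v * k)) (kernel-clamp rs (clamp-InBox u lo≤hi) (p v)) ⟩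
      kernel rs πu u * (x v * (kernel rs πu πv * kernel rs πv (p v)))
        ≡⟨ cong (λ k → kernel rs πu u * (x v * (k * kernel rs πv (p v)))) (kernel-sym rs πu πv) ⟩
      kernel rs πu u * (x v * (kernel rs πv πu * kernel rs πv (p v)))
        ≡⟨ solve 4 (λ a b c d → a :* (b :* (c :* d)) := (b :* d) :* (c :* a)) refl
             (kernel rs πu u) (x v) (kernel rs πv πu) (kernel rs πv (p v)) ⟩
      x v * kernel rs πv (p v) * (kernel rs πv πu * kernel rs πu u)
        ≡⟨ cong (x v * kernel rs πv (p v) *_) (trans (sym (kernel-clamp rs (clamp-InBox (p v) lo≤hi) u)) (kernel-sym rs πv u)) ⟩
      x v * kernel rs πv (p v) * kernel rs u πv ∎
      where
      open ≡-Reasoning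
      πv : Vec ℕ n
      πv = clamp lo hi (p v)

  module _ (1≤ps : AllV.All (1 ℕ.≤_) ps) (X : Vec ℕ n → ℤ) where

    private
      x : Vec ℕ n → ℚ
      x v = ι (X v)

    potential : List (Vec ℕ n) → Vec ℕ n → ℚ
    potential L u = ∑ L (λ v → x v * kernel rs u v)

    total : List (Vec ℕ n) → ℚ
    total L = ∑ L x

    mass : List (Vec ℕ n) → ℕ
    mass L = sum (map (λ v → ℤ.∣ X v ∣) L)

    mass-↭ : ∀ {L M} → L ↭ M → mass L ≡ mass M
    mass-↭ p = sum-↭ (map⁺ _ p)

    mass-++ : ∀ L M → mass (L ++ M) ≡ mass L ℕ.+ mass M
    mass-++ L M = trans (cong sum (map-++ _ L M)) (sum-++ (map _ L) _)

    -- The sign of X is the test function that turns the weights into their absolute values.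
    mass-bound : ∀ {S} σ k → (∀ u → 0ℚ ≤ potential S u) → amplification rs ≤ ιℕ σ → total S ≤ ιℕ k →
      mass S ℕ.≤ σ ℕ.* k
    mass-bound {S} σ k V≥0 Π≤σ tot≤k = ℤ.drop‿+≤+ (ι-cancel (begin
      ιℕ (mass S)                      ≡⟨ sym (∑-ιℕ S _) ⟩
      ∑ S (λ v → ∣ X v ∣ℚ)             ≡⟨ ∑-cong S (λ v → sym (ι*sgn (X v))) ⟩
      ∑ S (λ v → x v * ι (sgn (X v)))  ≤⟨ ∑-amplification S ratios x (λ v → v) V≥0 (λ v → ι (sgn (X v)))
                                            (λ v → -1≤sgn (X v)) (λ v → sgn≤1 (X v)) ⟩
      amplification rs * total S       ≤⟨ *-monoˡ _ (0≤amplification ratios) tot≤k ⟩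
      amplification rs * ιℕ k          ≤⟨ *-monoʳ (ιℕ k) (0≤ιℕ k) Π≤σ ⟩
      ιℕ σ * ιℕ k                      ≡⟨ sym (ιℕ-* σ k) ⟩
      ιℕ (σ ℕ.* k)                     ∎))
      where open ℚ.≤-Reasoning

    module _ {S A O : List (Vec ℕ n)} {lo hi} (lo≤hi : Pointwise ℕ._≤_ lo hi)
      (S↭A++O : S ↭ A ++ O) (A⊆box : ∀ v → v ∈ A → InBox lo hi v)
      {s R} (mass≤s : mass S ℕ.≤ s) (far : ∀ v → v ∈ O → R ℕ.≤ dist ps (clamp lo hi v) v)
      (V≥0 : ∀ u → 0ℚ ≤ potential S u) where

      private
        -- The most that v can weigh after being swept onto the box; for v in `O`, separation makes
        -- it at most |X v| / R.
        leak : Vec ℕ n → ℚ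
        leak v = ∣ X v ∣ℚ * kernel rs (clamp lo hi v) v

        0≤leak : 0ℚ ≤ ∑ O leak
        0≤leak = subst (_≤ ∑ O leak) (∑-zero O)
          (∑-mono∈ O (λ v _ → 0≤* (0≤ιℕ ℤ.∣ X v ∣) (0≤kernel ratios (clamp lo hi v) v)))
          where
          ∑-zero : ∀ L → ∑ L (λ (_ : Vec ℕ n) → 0ℚ) ≡ 0ℚ
          ∑-zero []      = refl
          ∑-zero (_ ∷ L) = trans (ℚ.+-identityˡ _) (∑-zero L)

        leak-bound : ιℕ R * ∑ O leak ≤ ιℕ s
        leak-bound = begin
          ιℕ R * ∑ O leak             ≡⟨ sym (∑-*ˡ O (ιℕ R)) ⟩
          ∑ O (λ v → ιℕ R * leak v)   ≤⟨ ∑-mono∈ O (λ v v∈ → subst₂ _≤_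
              (solve 3 (λ a k r → a :* (k :* r) := r :* (a :* k)) refl ∣ X v ∣ℚ (kernel rs (clamp lo hi v) v) (ιℕ R))
              (ℚ.*-identityʳ ∣ X v ∣ℚ)
              (*-monoˡ ∣ X v ∣ℚ (0≤ιℕ ℤ.∣ X v ∣) (kernel≤ {R} {clamp lo hi v} {v} (far v v∈)))) ⟩
          ∑ O (λ v → ∣ X v ∣ℚ)        ≡⟨ ∑-ιℕ O _ ⟩
          ιℕ (mass O)                 ≤⟨ ιℕ-mono (ℕ.≤-trans (ℕ.m≤n+m (mass O) (mass A))
                                           (ℕ.≤-trans (ℕ.≤-reflexive (sym (trans (mass-↭ S↭A++O) (mass-++ A O)))) mass≤s)) ⟩
          ιℕ s                        ∎
          where open ℚ.≤-Reasoning

      -- Sweep all of S onto the box and test with the sign of X. Points of A stay in place and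
      -- those of O count at most for the leak, so mass A - leak ≤ Π (total A + leak). If total A ≤
      -- 0, the positive integer mass A would be at most (1 + σ) s / R < 1.
      total-positive : ∀ {σ} → amplification rs ≤ ιℕ σ → (1 ℕ.+ σ) ℕ.* s ℕ.< R → 1 ℕ.≤ mass A → 0ℚ < total A
      total-positive {σ} Π≤σ R> 1≤mass = ℚ.≰⇒> λ tot≤0 → ℕ.<⇒≱ R> (ℤ.drop‿+≤+ (ι-cancel (begin
        ιℕ R                        ≡⟨ sym (ℚ.*-identityʳ (ιℕ R)) ⟩
        ιℕ R * 1ℚ                   ≤⟨ *-monoˡ (ιℕ R) (0≤ιℕ R) (ιℕ-mono 1≤mass) ⟩
        ιℕ R * ιℕ (mass A)          ≤⟨ *-monoˡ (ιℕ R) (0≤ιℕ R) (mass≤ tot≤0) ⟩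
        ιℕ R * (ιℕ (1 ℕ.+ σ) * ∑ O leak)
          ≡⟨ solve 3 (λ a b c → a :* (b :* c) := b :* (a :* c)) refl (ιℕ R) (ιℕ (1 ℕ.+ σ)) (∑ O leak) ⟩
        ιℕ (1 ℕ.+ σ) * (ιℕ R * ∑ O leak)  ≤⟨ *-monoˡ (ιℕ (1 ℕ.+ σ)) (0≤ιℕ (1 ℕ.+ σ)) leak-bound ⟩
        ιℕ (1 ℕ.+ σ) * ιℕ s         ≡⟨ sym (ιℕ-* (1 ℕ.+ σ) s) ⟩
        ιℕ ((1 ℕ.+ σ) ℕ.* s)        ∎)))
        where
        open ℚ.≤-Reasoning
        c : Vec ℕ n → ℚ
        c v = x v * kernel rs (clamp lo hi v) v
        c≡x : ∀ v → v ∈ A → c v ≡ x v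
        c≡x v v∈ rewrite clamp-id (A⊆box v v∈) | kernel-refl rs v = ℚ.*-identityʳ (x v)
        φ : Vec ℕ n → ℚ
        φ v = ι (sgn (X v))
        lower : - ∑ O leak ≤ ∑ O (λ v → c v * φ (clamp lo hi v))
        lower = subst (_≤ ∑ O (λ v → c v * φ (clamp lo hi v)))
          (trans (∑-*ˡ O (- 1ℚ)) (solve 1 (λ a → (:- con 1ℚ) :* a := :- a) refl (∑ O leak)))
          (∑-mono∈ O (λ v _ → subst₂ _≤_
            (solve 2 (λ a k → k :* (:- a) := (:- con 1ℚ) :* (a :* k)) refl ∣ X v ∣ℚ (kernel rs (clamp lo hi v) v))
            (solve 3 (λ a k f → k :* (a :* f) := (a :* k) :* f) refl (x v) (kernel rs (clamp lo hi v) v) (φ (clamp lo hi v)))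
            (*-monoˡ _ (0≤kernel ratios (clamp lo hi v) v) (-∣∣≤ι*sgn (X v) (X (clamp lo hi v))))))
        upper : ∑ O c ≤ ∑ O leak
        upper = ∑-mono∈ O (λ v _ → *-monoʳ _ (0≤kernel ratios (clamp lo hi v) v) (ι≤∣∣ (X v)))
        amplified : ιℕ (mass A) - ∑ O leak ≤ amplification rs * (total A + ∑ O c)
        amplified = begin
          ιℕ (mass A) - ∑ O leak ≤⟨ ℚ.+-monoʳ-≤ (ιℕ (mass A)) lower ⟩
          ιℕ (mass A) + ∑ O (λ v → c v * φ (clamp lo hi v))
            ≡⟨ cong (_+ ∑ O (λ v → c v * φ (clamp lo hi v))) (trans (sym (∑-ιℕ A _)) (∑-cong∈ A (λ v v∈ →
                 trans (sym (ι*sgn (X v))) (cong₂ _*_ (sym (c≡x v v∈)) (cong φ (sym (clamp-id (A⊆box v v∈)))))))) ⟩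
          ∑ A (λ v → c v * φ (clamp lo hi v)) + ∑ O (λ v → c v * φ (clamp lo hi v))
            ≡⟨ sym (trans (∑-↭ S↭A++O) (∑-++ A O)) ⟩
          ∑ S (λ v → c v * φ (clamp lo hi v))
            ≤⟨ ∑-amplification S ratios c (clamp lo hi) (∑-clamped≥0 S x (λ v → v) lo≤hi V≥0) φ
                 (λ v → -1≤sgn (X v)) (λ v → sgn≤1 (X v)) ⟩
          amplification rs * ∑ S c
            ≡⟨ cong (amplification rs *_) (trans (∑-↭ S↭A++O) (trans (∑-++ A O) (cong (_+ ∑ O c) (∑-cong∈ A c≡x)))) ⟩
          amplification rs * (total A + ∑ O c) ∎
        mass≤ : total A ≤ 0ℚ → ιℕ (mass A) ≤ ιℕ (1 ℕ.+ σ) * ∑ O leak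
        mass≤ tot≤0 = begin
          ιℕ (mass A)  ≡⟨ solve 2 (λ a e → a := (a :- e) :+ e) refl (ιℕ (mass A)) (∑ O leak) ⟩
          (ιℕ (mass A) - ∑ O leak) + ∑ O leak  ≤⟨ ℚ.+-monoˡ-≤ (∑ O leak) amplified ⟩
          amplification rs * (total A + ∑ O c) + ∑ O leak
            ≤⟨ ℚ.+-monoˡ-≤ (∑ O leak) (*-monoˡ _ (0≤amplification ratios) (ℚ.+-mono-≤ tot≤0 upper)) ⟩
          amplification rs * (0ℚ + ∑ O leak) + ∑ O leak
            ≡⟨ cong (λ z → amplification rs * z + ∑ O leak) (ℚ.+-identityˡ (∑ O leak)) ⟩
          amplification rs * ∑ O leak + ∑ O leak
            ≤⟨ ℚ.+-monoˡ-≤ (∑ O leak) (*-monoʳ (∑ O leak) 0≤leak Π≤σ) ⟩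
          ιℕ σ * ∑ O leak + ∑ O leak
            ≡⟨ solve 2 (λ a e → a :* e :+ e := (con 1ℚ :+ a) :* e) refl (ιℕ σ) (∑ O leak) ⟩
          (1ℚ + ιℕ σ) * ∑ O leak  ≡⟨ cong (_* ∑ O leak) (sym (ιℕ-+ 1 σ)) ⟩
          ιℕ (1 ℕ.+ σ) * ∑ O leak ∎

      private
        integral : ∀ L {t} → (∀ v → v ∈ L → InBox lo hi v) → InBox lo hi t →
          ∃ λ z → potential L t * ιℕ (dist ps lo hi) ≡ ι z
        integral []      {t} _   _  = 0ℤ , ℚ.*-zeroˡ (ιℕ (dist ps lo hi))
        integral (v ∷ L) {t} L⊆ t∈ with integral L (λ w w∈ → L⊆ w (there w∈)) t∈ | dist-∣-box ps t∈ (L⊆ v (here refl))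
        ... | z , eq | divides q D≡ = X v ℤ.* + q ℤ.+ z , trans (ℚ.*-distribʳ-+ (ιℕ (dist ps lo hi)) (x v * kernel rs t v) (potential L t))
          (trans (cong₂ _+_ (trans (ℚ.*-assoc (x v) (kernel rs t v) (ιℕ (dist ps lo hi))) (trans (cong (x v *_) kernel*D) (sym (ι-* (X v) (+ q))))) eq)
            (sym (ι-+ (X v ℤ.* + q) z)))
          where
          kernel*D : kernel rs t v * ιℕ (dist ps lo hi) ≡ ιℕ q
          kernel*D = trans (cong (λ D → kernel rs t v * ιℕ D) D≡) (trans (cong (kernel rs t v *_) (ιℕ-* q (dist ps t v)))
            (trans (solve 3 (λ k a b → k :* (a :* b) := a :* (k :* b)) refl (kernel rs t v) (ιℕ q) (ιℕ (dist ps t v)))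
              (trans (cong (ιℕ q *_) (kernel-dist recip t v)) (ℚ.*-identityʳ (ιℕ q)))))

        leak-potential : ∀ {t} → InBox lo hi t → potential O t ≤ ∑ O leak
        leak-potential {t} t∈ = ∑-mono∈ O (λ v _ → begin
          x v * kernel rs t v       ≤⟨ *-monoʳ (kernel rs t v) (0≤kernel ratios t v) (ι≤∣∣ (X v)) ⟩
          ∣ X v ∣ℚ * kernel rs t v  ≤⟨ *-monoˡ ∣ X v ∣ℚ (0≤ιℕ ℤ.∣ X v ∣) (kernel≤leak v) ⟩
          leak v                    ∎)
          where
          open ℚ.≤-Reasoning
          kernel≤leak : ∀ v → kernel rs t v ≤ kernel rs (clamp lo hi v) v
          kernel≤leak v = begin
            kernel rs t v                    ≡⟨ kernel-clamp rs t∈ v ⟩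
            kernel rs t πv * kernel rs πv v  ≤⟨ *-monoʳ (kernel rs πv v) (0≤kernel ratios πv v)
                                                  (subst (_≤ 1ℚ) (ℚ.*-identityʳ (kernel rs t πv)) (kernel≤ {1} {t} {πv} (dist≥1 1≤ps t πv))) ⟩
            1ℚ * kernel rs πv v              ≡⟨ ℚ.*-identityˡ _ ⟩
            kernel rs πv v                   ∎
            where
            πv : Vec ℕ n
            πv = clamp lo hi v

      -- Inside the box the potential of A has denominator dist lo hi, while it is
      -- at least -s / R; so it cannot be negative.
      potential-nonneg : s ℕ.* dist ps lo hi ℕ.< R → ∀ u → 0ℚ ≤ potential A u
      potential-nonneg sD<R u = subst (0ℚ ≤_) extend (0≤* (0≤kernel ratios πu u) (in-box (clamp-InBox u lo≤hi)))
        where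
        πu : Vec ℕ n
        πu = clamp lo hi u
        extend : kernel rs πu u * potential A πu ≡ potential A u
        extend = ∑-kernel-clamp rs A x A⊆box u
        in-box : ∀ {t} → InBox lo hi t → 0ℚ ≤ potential A t
        in-box {t} t∈ with integral A A⊆box t∈
        ... | z , eq = ℚ.*-cancelʳ-≤-pos (ιℕ D) {{ℚ.positive 0<D}}
            (subst₂ _≤_ (sym (ℚ.*-zeroˡ (ιℕ D))) (sym eq) (ι-mono 0≤z))
          where
          D : ℕ
          D = dist ps lo hi
          0<D : 0ℚ < ιℕ D
          0<D = ℚ.<-≤-trans (ℚ.positive⁻¹ 1ℚ) (ιℕ-mono (dist≥1 1≤ps lo hi))
          0≤Rz+sD : 0ℚ ≤ ιℕ R * ι z + ιℕ s * ιℕ D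
          0≤Rz+sD = begin
            0ℚ                                                ≡⟨ sym (ℚ.*-zeroʳ (ιℕ R * ιℕ D)) ⟩
            ιℕ R * ιℕ D * 0ℚ                                  ≤⟨ *-monoˡ (ιℕ R * ιℕ D) (0≤* (0≤ιℕ R) (0≤ιℕ D)) (V≥0 t) ⟩
            ιℕ R * ιℕ D * potential S t                       ≡⟨ cong (ιℕ R * ιℕ D *_) (trans (∑-↭ S↭A++O) (∑-++ A O)) ⟩
            ιℕ R * ιℕ D * (potential A t + potential O t)     ≤⟨ *-monoˡ (ιℕ R * ιℕ D) (0≤* (0≤ιℕ R) (0≤ιℕ D))
                                                                   (ℚ.+-monoʳ-≤ (potential A t) (leak-potential t∈)) ⟩
            ιℕ R * ιℕ D * (potential A t + ∑ O leak)
              ≡⟨ solve 4 (λ R D a e → R :* D :* (a :+ e) := R :* (a :* D) :+ R :* e :* D) refl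
                   (ιℕ R) (ιℕ D) (potential A t) (∑ O leak) ⟩
            ιℕ R * (potential A t * ιℕ D) + ιℕ R * ∑ O leak * ιℕ D
              ≤⟨ ℚ.+-mono-≤ (ℚ.≤-reflexive (cong (ιℕ R *_) eq)) (*-monoʳ (ιℕ D) (0≤ιℕ D) leak-bound) ⟩
            ιℕ R * ι z + ιℕ s * ιℕ D ∎
            where open ℚ.≤-Reasoning
          not-negative : ∀ z → 0ℚ ≤ ιℕ R * ι z + ιℕ s * ιℕ D → 0ℤ ℤ.≤ z
          not-negative (+ _)    _ = ℤ.+≤+ ℕ.z≤n
          not-negative -[1+ m ] p = contradiction (ℤ.drop‿+≤+ (ι-cancel R≤sD)) (ℕ.<⇒≱ sD<R)
            where
            R≤sD : ιℕ R ≤ ιℕ (s ℕ.* D)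
            R≤sD = begin
              ιℕ R                                ≡⟨ solve 1 (λ r → r := con 0ℚ :- r :* (:- con 1ℚ)) refl (ιℕ R) ⟩
              0ℚ - ιℕ R * ι -1ℤ                   ≤⟨ ℚ.+-mono-≤ p (ℚ.neg-antimono-≤
                                                       (*-monoˡ (ιℕ R) (0≤ιℕ R) (ι-mono (ℤ.-≤- (ℕ.z≤n {m}))))) ⟩
              (ιℕ R * ι -[1+ m ] + ιℕ s * ιℕ D) - ιℕ R * ι -[1+ m ]
                ≡⟨ solve 2 (λ a b → (a :+ b) :- a := b) refl (ιℕ R * ι -[1+ m ]) (ιℕ s * ιℕ D) ⟩
              ιℕ s * ιℕ D                         ≡⟨ sym (ιℕ-* s D) ⟩
              ιℕ (s ℕ.* D)                        ∎
              where open ℚ.≤-Reasoning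
          0≤z : 0ℤ ℤ.≤ z
          0≤z = not-negative z 0≤Rz+sD

-- Merging clusters

concatMap-↭ : ∀ {A B : Set} (f : A → List B) {xs ys} → xs ↭ ys → concatMap f xs ↭ concatMap f ys
concatMap-↭ f _↭_.refl         = ↭-refl
concatMap-↭ f (_↭_.prep x p)   = ++⁺ˡ (f x) (concatMap-↭ f p)
concatMap-↭ f {_ ∷ _ ∷ xs} {_ ∷ _ ∷ ys} (_↭_.swap x y p) =
  ↭-trans (++⁺ˡ (f x) (++⁺ˡ (f y) (concatMap-↭ f p)))
  (↭-trans (↭-reflexive (sym (++-assoc (f x) (f y) _)))
  (↭-trans (++⁺ (++-comm (f x) (f y)) ↭-refl) (↭-reflexive (++-assoc (f y) (f x) _))))
concatMap-↭ f (_↭_.trans p q)  = ↭-trans (concatMap-↭ f p) (concatMap-↭ f q)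

∈⇒↭ : ∀ {A : Set} {x : A} {xs} → x ∈ xs → ∃[ ys ] xs ↭ x ∷ ys
∈⇒↭ {x = x} x∈ with ∈-∃++ x∈
... | ys , zs , refl = ys ++ zs , shift x ys zs

-- Elements are singled out by position, so no equality of clusters has to be decided.
picks : ∀ {A : Set} → List A → List (A × List A)
picks []       = []
picks (x ∷ xs) = (x , xs) ∷ map (λ (y , ys) → y , x ∷ ys) (picks xs)

picks-↭ : ∀ {A : Set} (xs : List A) → All (λ (y , ys) → xs ↭ y ∷ ys) (picks xs)
picks-↭ []       = []
picks-↭ (x ∷ xs) = ↭-refl ∷ push (picks-↭ xs)
  where
  push : ∀ {ps} → All (λ (y , ys) → xs ↭ y ∷ ys) ps →
    All (λ (y , ys) → x ∷ xs ↭ y ∷ ys) (map (λ (y , ys) → y , x ∷ ys) ps)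
  push []                             = []
  push (_∷_ {x = y , ys} p h) = ↭-trans (_↭_.prep x p) (_↭_.swap x y ↭-refl) ∷ push h

∈-picks : ∀ {A : Set} {x : A} {xs} → x ∈ xs → ∃[ ys ] (x , ys) ∈ picks xs
∈-picks (here refl) = _ , here refl
∈-picks {xs = z ∷ _} (there x∈) with ∈-picks x∈
... | ys , p∈ = z ∷ ys , there (∈-map p∈)
  where
  ∈-map : ∀ {ps p} → p ∈ ps → (proj₁ p , z ∷ proj₂ p) ∈ map (λ (y , ys) → y , z ∷ ys) ps
  ∈-map (here refl) = here refl
  ∈-map (there p∈)  = there (∈-map p∈)

-- Bounds the product of the diameters after m merges, starting from D, when the merging distance
-- `R D` follows the current product.
growth : (ℕ → ℕ) → ℕ → ℕ → ℕ
growth R zero    D = D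
growth R (suc m) D = growth R m (R D ℕ.* D)

growth-monoʳ : ∀ {R} → (∀ {a b} → a ℕ.≤ b → R a ℕ.≤ R b) → ∀ m {a b} → a ℕ.≤ b → growth R m a ℕ.≤ growth R m b
growth-monoʳ R↗ zero    a≤b = a≤b
growth-monoʳ R↗ (suc m) a≤b = growth-monoʳ R↗ m (ℕ.*-mono-≤ (R↗ a≤b) a≤b)

growth-inflationary : ∀ {R} → (∀ D → 1 ℕ.≤ R D) → ∀ m D → D ℕ.≤ growth R m D
growth-inflationary     1≤R zero    D = ℕ.≤-refl
growth-inflationary {R} 1≤R (suc m) D = ℕ.≤-trans
  (ℕ.≤-trans (ℕ.≤-reflexive (sym (ℕ.*-identityˡ D))) (ℕ.*-monoˡ-≤ D (1≤R D))) (growth-inflationary 1≤R m (R D ℕ.* D))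

growth-monoˡ : ∀ {R} → (∀ D → 1 ℕ.≤ R D) → ∀ {m m′} D → m ℕ.≤ m′ → growth R m D ℕ.≤ growth R m′ D
growth-monoˡ     1≤R {zero} {m′} D _           = growth-inflationary 1≤R m′ D
growth-monoˡ {R} 1≤R {suc m} {suc m′} D (ℕ.s≤s p) = growth-monoˡ 1≤R (R D ℕ.* D) p

module _ {n} (ps : Vec ℕ n) (1≤ps : AllV.All (1 ℕ.≤_) ps) where

  -- The distinguished point keeps the cluster nonempty: it yields `lo≤hi` and the positive mass
  -- that `total-positive` asks for.
  record Cluster : Set where
    field
      points  : List (Vec ℕ n)
      lo hi   : Vec ℕ n
      inBox   : ∀ v → v ∈ points → InBox lo hi v
      point   : Vec ℕ n
      point∈  : point ∈ points

    lo≤hi : Pointwise ℕ._≤_ lo hi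
    lo≤hi = InBox⇒≤ (inBox point point∈)

    diameter : ℕ
    diameter = dist ps lo hi

    reach : Vec ℕ n → ℕ
    reach v = dist ps (clamp lo hi v) v

  open Cluster public

  gather : List Cluster → List (Vec ℕ n)
  gather = concatMap points

  diameters : List Cluster → ℕ
  diameters Cs = product (map diameter Cs)

  diameters≥1 : ∀ Cs → 1 ℕ.≤ diameters Cs
  diameters≥1 []       = ℕ.≤-refl
  diameters≥1 (C ∷ Cs) = ℕ.*-mono-≤ (dist≥1 1≤ps (lo C) (hi C)) (diameters≥1 Cs)

  diameter≤diameters : ∀ {C Cs} → C ∈ Cs → diameter C ℕ.≤ diameters Cs
  diameter≤diameters {C} {_ ∷ Cs} (here refl) = subst (ℕ._≤ diameter C ℕ.* diameters Cs) (ℕ.*-identityʳ _)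
    (ℕ.*-monoʳ-≤ (diameter C) (diameters≥1 Cs))
  diameter≤diameters {C} {C′ ∷ Cs} (there C∈) = ℕ.≤-trans (diameter≤diameters C∈)
    (subst (ℕ._≤ diameter C′ ℕ.* diameters Cs) (ℕ.*-identityˡ _)
      (ℕ.*-monoˡ-≤ (diameters Cs) (dist≥1 1≤ps (lo C′) (hi C′))))

  singleton : Vec ℕ n → Cluster
  singleton v = record
    { points = v ∷ [] ; lo = v ; hi = v ; inBox = λ { _ (here refl) → v≤v , v≤v } ; point = v ; point∈ = here refl }
    where
    v≤v : Pointwise ℕ._≤_ v v
    v≤v = Pointwise.refl ℕ.≤-refl

  diameter-singleton : ∀ v → diameter (singleton v) ≡ 1
  diameter-singleton = go ps
    where
    go : ∀ {n} (ps v : Vec ℕ n) → dist ps v v ≡ 1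
    go []       []      = refl
    go (p ∷ ps) (i ∷ v) rewrite ℕ.∣n-n∣≡0 i | go ps v = refl

  diameters-singletons : ∀ S → diameters (map singleton S) ≡ 1
  diameters-singletons []      = refl
  diameters-singletons (v ∷ S) = cong₂ ℕ._*_ (diameter-singleton v) (diameters-singletons S)

  merge : Cluster → Cluster → Cluster
  merge A B = record
    { points = points A ++ points B
    ; lo     = zipWith _⊓_ (lo A) (lo B)
    ; hi     = zipWith _⊔_ (hi A) (hi B)
    ; inBox  = λ v v∈ → widen v (∈-++⁻ (points A) v∈)
    ; point  = point A
    ; point∈ = ∈-++⁺ˡ (point∈ A)
    }
    where
    ⊓ˡ : ∀ {n} {u v w : Vec ℕ n} → Pointwise ℕ._≤_ u w → Pointwise ℕ._≤_ (zipWith _⊓_ u v) w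
    ⊓ˡ {v = []}    []      = []
    ⊓ˡ {v = y ∷ _} (p ∷ h) = ℕ.m≤n⇒m⊓o≤n y p ∷ ⊓ˡ h
    ⊓ʳ : ∀ {n} {u v w : Vec ℕ n} → Pointwise ℕ._≤_ v w → Pointwise ℕ._≤_ (zipWith _⊓_ u v) w
    ⊓ʳ {u = []}    []      = []
    ⊓ʳ {u = x ∷ _} (p ∷ h) = ℕ.m≤n⇒o⊓m≤n x p ∷ ⊓ʳ h
    ⊔ˡ : ∀ {n} {u v w : Vec ℕ n} → Pointwise ℕ._≤_ w u → Pointwise ℕ._≤_ w (zipWith _⊔_ u v)
    ⊔ˡ {v = []}    []      = []
    ⊔ˡ {v = y ∷ _} (p ∷ h) = ℕ.m≤n⇒m≤n⊔o y p ∷ ⊔ˡ h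
    ⊔ʳ : ∀ {n} {u v w : Vec ℕ n} → Pointwise ℕ._≤_ w v → Pointwise ℕ._≤_ w (zipWith _⊔_ u v)
    ⊔ʳ {u = []}    []      = []
    ⊔ʳ {u = x ∷ _} (p ∷ h) = ℕ.m≤n⇒m≤o⊔n x p ∷ ⊔ʳ h
    widen : ∀ v → v ∈ points A ⊎ v ∈ points B → InBox (zipWith _⊓_ (lo A) (lo B)) (zipWith _⊔_ (hi A) (hi B)) v
    widen v (inj₁ v∈) = ⊓ˡ (proj₁ (inBox A v v∈)) , ⊔ˡ (proj₂ (inBox A v v∈))
    widen v (inj₂ v∈) = ⊓ʳ (proj₁ (inBox B v v∈)) , ⊔ʳ (proj₂ (inBox B v v∈))

  -- Measured from the box of one cluster to the points of the others, not between boxes: its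
  -- negation is the separation that `total-positive` and `potential-nonneg` assume.
  Close : ℕ → List Cluster → Set
  Close R Cs = Any (λ (A , rest) → Any (λ b → reach A b ℕ.< R) (gather rest)) (picks Cs)

  diameters-merge : ∀ {R} A B Cs b → b ∈ points B → reach A b ℕ.≤ R →
    diameters (merge A B ∷ Cs) ℕ.≤ R ℕ.* diameters (A ∷ B ∷ Cs)
  diameters-merge {R} A B Cs b b∈B near = begin
    diameter (merge A B) ℕ.* diameters Cs
      ≤⟨ ℕ.*-monoˡ-≤ (diameters Cs) (hull-dist 1≤ps (lo≤hi A) (inBox B b b∈B)) ⟩
    diameter A ℕ.* diameter B ℕ.* reach A b ℕ.* diameters Cs
      ≤⟨ ℕ.*-monoˡ-≤ (diameters Cs) (ℕ.*-monoʳ-≤ (diameter A ℕ.* diameter B) near) ⟩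
    diameter A ℕ.* diameter B ℕ.* R ℕ.* diameters Cs
      ≡⟨ rearrange (diameter A) (diameter B) R (diameters Cs) ⟩
    R ℕ.* (diameter A ℕ.* (diameter B ℕ.* diameters Cs)) ∎
    where
    open ℕ.≤-Reasoning
    rearrange : ∀ a b r d → a ℕ.* b ℕ.* r ℕ.* d ≡ r ℕ.* (a ℕ.* (b ℕ.* d))
    rearrange = ℕ-solve 4 (λ a b r d → a ⊗ b ⊗ r ⊗ d ⊜ r ⊗ (a ⊗ (b ⊗ d))) refl

  merge-step : ∀ {R Cs} → Close R Cs → ∃[ Cs′ ]
    gather Cs ↭ gather Cs′ × length Cs ≡ suc (length Cs′) × diameters Cs′ ℕ.≤ R ℕ.* diameters Cs
  merge-step {R} {Cs} close with find close
  ... | (A , rest) , A∈ , any with find any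
  ... | b , b∈ , near with find (∈-concatMap⁻ points {xs = rest} b∈)
  ... | B , B∈ , b∈B with ∈⇒↭ B∈
  ... | Cs′ , rest↭ = step (↭-trans (All.lookup (picks-↭ Cs) A∈) (_↭_.prep A rest↭))
    where
    step : Cs ↭ A ∷ B ∷ Cs′ → ∃[ Cs′ ]
      gather Cs ↭ gather Cs′ × length Cs ≡ suc (length Cs′) × diameters Cs′ ℕ.≤ R ℕ.* diameters Cs
    step Cs↭ = merge A B ∷ Cs′
      , ↭-trans (concatMap-↭ points Cs↭) (↭-reflexive (sym (++-assoc (points A) (points B) _)))
      , ↭-length Cs↭
      , subst (λ D → diameters (merge A B ∷ Cs′) ℕ.≤ R ℕ.* D) (sym (product-↭ (map⁺ diameter Cs↭)))
          (diameters-merge A B Cs′ b b∈B (ℕ.<⇒≤ near))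

  close? : ∀ R Cs → Dec (Close R Cs)
  close? R Cs = Any.any? (λ (A , rest) → Any.any? (λ b → reach A b ℕ.<? R) (gather rest)) (picks Cs)

  Separation : (ℕ → ℕ) → ℕ → List Cluster → Set
  Separation R m Cs = ∃[ Cs′ ] gather Cs ↭ gather Cs′ × length Cs′ ℕ.≤ m
    × ¬ Close (R (diameters Cs′)) Cs′ × diameters Cs′ ℕ.≤ growth R m (diameters Cs)

  -- Each merge lowers the number of clusters by one, which drives the recursion. The threshold is
  -- recomputed from the product after each merge, so the remaining clusters are far apart with
  -- respect to the final product.
  separate : ∀ {R} → (∀ {a b} → a ℕ.≤ b → R a ℕ.≤ R b) → (∀ D → 1 ℕ.≤ R D) →
    ∀ m Cs → length Cs ≡ m → Separation R m Cs
  separate {R} R↗ 1≤R zero    []       len = [] , ↭-refl , ℕ.z≤n , (λ ()) , ℕ.≤-refl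
  separate {R} R↗ 1≤R (suc m) Cs len = decide (close? (R (diameters Cs)) Cs)
    where
    decide : Dec (Close (R (diameters Cs)) Cs) → Separation R (suc m) Cs
    decide (no ¬close) = Cs , ↭-refl , ℕ.≤-reflexive len , ¬close , growth-inflationary 1≤R (suc m) (diameters Cs)
    decide (yes close) =
      let Cs₁ , p , len₁ , D₁≤           = merge-step close
          Cs₂ , q , len₂ , far₂ , D₂≤ = separate R↗ 1≤R m Cs₁ (ℕ.suc-injective (trans (sym len₁) len))
      in  Cs₂ , ↭-trans p q , ℕ.m≤n⇒m≤1+n len₂ , far₂ , ℕ.≤-trans D₂≤ (growth-monoʳ R↗ m D₁≤)

  far-apart : ∀ {R Cs A rest} → ¬ Close R Cs → (A , rest) ∈ picks Cs → ∀ b → b ∈ gather rest → R ℕ.≤ reach A b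
  far-apart ¬close A∈ b b∈ = ℕ.≮⇒≥ (λ near → ¬close (lose A∈ (lose b∈ near)))

-- The inner `growth` is for the pass with fixed threshold, starting from at most s points of
-- diameter 1; the outer one is for the pass whose threshold follows the diameters, starting from at
-- most k clusters.
clusterBound : ℕ → ℕ → ℕ
clusterBound σ k = growth (λ D → suc (s ℕ.* D)) k (growth (λ _ → suc ((1 ℕ.+ σ) ℕ.* s)) s 1)
  where
  s : ℕ
  s = σ ℕ.* k

module _ {n} {rs : Vec ℚ n} {ps : Vec ℕ n} (ratios : AllV.All Ratio rs) (recip : Reciprocal rs ps)
  (1≤ps : AllV.All (1 ℕ.≤_) ps) (X : Vec ℕ n → ℤ) where

  private
    V : List (Vec ℕ n) → Vec ℕ n → ℚ
    V = potential ratios recip 1≤ps X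
    tot : List (Vec ℕ n) → ℚ
    tot = total ratios recip 1≤ps X
    wt : List (Vec ℕ n) → ℕ
    wt = mass ratios recip 1≤ps X
    Cl : Set
    Cl = Cluster ps 1≤ps
    gath : List Cl → List (Vec ℕ n)
    gath = gather ps 1≤ps

  Splits : List (Vec ℕ n) → Set
  Splits S = ∃[ A ] ∃[ O ] S ↭ A ++ O × (∃[ a ] a ∈ A) × (∃[ o ] o ∈ O)
    × (∀ u → 0ℚ ≤ V A u) × (∀ u → 0ℚ ≤ V O u)

  Boxed : List (Vec ℕ n) → ℕ → Set
  Boxed S B = ∃[ lo ] ∃[ hi ] (∀ v → v ∈ S → InBox lo hi v) × dist ps lo hi ℕ.≤ B

  module _ {S} (σ k : ℕ) (X≢0 : ∀ v → v ∈ S → X v ≢ 0ℤ) (V≥0 : ∀ u → 0ℚ ≤ V S u)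
    (Π≤σ : amplification rs ≤ ιℕ σ) (tot≤k : tot S ≤ ιℕ k) where

    private
      s : ℕ
      s = σ ℕ.* k

      mass≤s : wt S ℕ.≤ s
      mass≤s = mass-bound ratios recip 1≤ps X {S} σ k V≥0 Π≤σ tot≤k

      1≤∣X∣ : ∀ {v} → v ∈ S → 1 ℕ.≤ ℤ.∣ X v ∣
      1≤∣X∣ {v} v∈ = ℕ.n≢0⇒n>0 (λ e → X≢0 v v∈ (ℤ.∣i∣≡0⇒i≡0 e))

      -- Nonzero integers count at least 1 each, so the mass also limits the number of initial
      -- clusters.
      length≤mass : ∀ {L} → (∀ v → v ∈ L → v ∈ S) → length L ℕ.≤ wt L
      length≤mass {[]}    _  = ℕ.z≤n
      length≤mass {v ∷ L} L⊆ = ℕ.+-mono-≤ (1≤∣X∣ (L⊆ v (here refl))) (length≤mass (λ w w∈ → L⊆ w (there w∈)))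

      1≤mass : ∀ {L v} → (∀ v → v ∈ L → v ∈ S) → v ∈ L → 1 ℕ.≤ wt L
      1≤mass L⊆ v∈ = ℕ.≤-trans (nonempty v∈) (length≤mass L⊆)
        where
        nonempty : ∀ {L : List (Vec ℕ n)} {v} → v ∈ L → 1 ℕ.≤ length L
        nonempty (here _)  = ℕ.s≤s ℕ.z≤n
        nonempty (there _) = ℕ.s≤s ℕ.z≤n

      picked : ∀ {Cs C rest} → S ↭ gath Cs → (C , rest) ∈ picks Cs → S ↭ points C ++ gath rest
      picked {Cs} S↭ C∈ = ↭-trans S↭ (concatMap-↭ points (All.lookup (picks-↭ Cs) C∈))

      total≥1 : ∀ {ρ Cs C rest} → (1 ℕ.+ σ) ℕ.* s ℕ.< ρ → S ↭ gath Cs → ¬ Close ps 1≤ps ρ Cs →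
        (C , rest) ∈ picks Cs → 1ℚ ≤ tot (points C)
      total≥1 {ρ} {Cs} {C} {rest} ρ> S↭ far C∈ = integral (points C)
        (total-positive ratios recip 1≤ps X {S} {points C} {gath rest} (lo≤hi C) S↭′ (inBox C) {s} {ρ} mass≤s
          (far-apart ps 1≤ps far C∈) V≥0 Π≤σ ρ>
          (1≤mass (λ v v∈ → ∈-resp-↭ (↭-sym S↭′) (∈-++⁺ˡ v∈)) (point∈ C)))
        where
        S↭′ : S ↭ points C ++ gath rest
        S↭′ = picked S↭ C∈
        tot-ι : ∀ L → ∃[ z ] tot L ≡ ι z
        tot-ι []      = 0ℤ , refl
        tot-ι (v ∷ L) = X v ℤ.+ proj₁ (tot-ι L) , trans (cong (_+_ (ι (X v))) (proj₂ (tot-ι L))) (sym (ι-+ (X v) _))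
        integral : ∀ L → 0ℚ < tot L → 1ℚ ≤ tot L
        integral L 0<L = subst (1ℚ ≤_) (sym (proj₂ (tot-ι L)))
          (ι-mono (ℤ.i<j⇒suc[i]≤j (ι-cancel-< (subst (0ℚ <_) (proj₂ (tot-ι L)) 0<L))))

      length≤total : ∀ {Cs} → (∀ C → C ∈ Cs → 1ℚ ≤ tot (points C)) → ιℕ (length Cs) ≤ tot (gath Cs)
      length≤total {[]}     h = ℚ.≤-refl
      length≤total {C ∷ Cs} h = subst₂ _≤_ (sym (ιℕ-+ 1 (length Cs))) (sym (∑-++ (points C) (gath Cs)))
        (ℚ.+-mono-≤ (h C (here refl)) (length≤total (λ C′ C∈ → h C′ (there C∈))))

      V-nonneg : ∀ {Cs C rest} → S ↭ gath Cs → ¬ Close ps 1≤ps (suc (s ℕ.* diameters ps 1≤ps Cs)) Cs →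
        C ∈ Cs → (C , rest) ∈ picks Cs → ∀ u → 0ℚ ≤ V (points C) u
      V-nonneg {Cs} {C} {rest} S↭ far C∈ C∈p = potential-nonneg ratios recip 1≤ps X
        {S} {points C} {gath rest} (lo≤hi C) (picked S↭ C∈p) (inBox C) {s} mass≤s (far-apart ps 1≤ps far C∈p) V≥0
        (ℕ.s≤s (ℕ.*-monoʳ-≤ s (diameter≤diameters ps 1≤ps C∈)))

      V-gather : ∀ {Cs} → (∀ C → C ∈ Cs → ∀ u → 0ℚ ≤ V (points C) u) → ∀ u → 0ℚ ≤ V (gath Cs) u
      V-gather {[]}     h u = ℚ.≤-refl
      V-gather {C ∷ Cs} h u = subst (0ℚ ≤_) (sym (∑-++ (points C) (gath Cs)))
        (0≤+ (h C (here refl) u) (V-gather (λ C′ C∈ → h C′ (there C∈)) u))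

    splits-or-boxed : (∃[ v ] v ∈ S) → Splits S ⊎ Boxed S (clusterBound σ k)
    splits-or-boxed (v₀ , v₀∈) = second (separate ps 1≤ps R₁↗ 1≤R₁ _ Cs₀ refl)
      where
      R₁ R₂ : ℕ → ℕ
      R₁ _ = suc ((1 ℕ.+ σ) ℕ.* s)
      R₂ D = suc (s ℕ.* D)
      R₁↗ : ∀ {a b} → a ℕ.≤ b → R₁ a ℕ.≤ R₁ b
      R₁↗ _ = ℕ.≤-refl
      1≤R₁ : ∀ D → 1 ℕ.≤ R₁ D
      1≤R₁ _ = ℕ.s≤s ℕ.z≤n
      R₂↗ : ∀ {a b} → a ℕ.≤ b → R₂ a ℕ.≤ R₂ b
      R₂↗ a≤b = ℕ.s≤s (ℕ.*-monoʳ-≤ s a≤b)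
      1≤R₂ : ∀ D → 1 ℕ.≤ R₂ D
      1≤R₂ _ = ℕ.s≤s ℕ.z≤n
      Cs₀ : List Cl
      Cs₀ = map (singleton ps 1≤ps) S
      gather₀ : ∀ L → gath (map (singleton ps 1≤ps) L) ≡ L
      gather₀ []      = refl
      gather₀ (v ∷ L) = cong (v ∷_) (gather₀ L)
      diam : List Cl → ℕ
      diam = diameters ps 1≤ps
      length₀ : length Cs₀ ℕ.≤ s
      length₀ = ℕ.≤-trans (ℕ.≤-reflexive (length-map _ S)) (ℕ.≤-trans (length≤mass (λ _ v∈ → v∈)) mass≤s)
      third : ∀ {Cs₁} → S ↭ gath Cs₁ → Separation ps 1≤ps R₂ (length Cs₁) Cs₁ →
        growth R₂ (length Cs₁) (diam Cs₁) ℕ.≤ clusterBound σ k → Splits S ⊎ Boxed S (clusterBound σ k)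
      third S↭₁ ([] , p , _) _ = contradiction (∈-resp-↭ (↭-trans S↭₁ p) v₀∈) λ ()
      third S↭₁ (C ∷ [] , p , _ , _ , D≤) B≤ = inj₂ (lo C , hi C
        , (λ v v∈ → inBox C v (subst (v ∈_) (++-identityʳ (points C)) (∈-resp-↭ (↭-trans S↭₁ p) v∈)))
        , ℕ.≤-trans (ℕ.≤-reflexive (sym (ℕ.*-identityʳ _))) (ℕ.≤-trans D≤ B≤))
      -- One cluster is split off from the union of all the others, whose potential is a sum of
      -- nonnegative ones.
      third S↭₁ (C ∷ C′ ∷ Cs , p , _ , far , _) _ = inj₁ (points C , gath (C′ ∷ Cs) , ↭-trans S↭₁ p
        , (point C , point∈ C) , (point C′ , ∈-++⁺ˡ (point∈ C′))
        , V≥ C (here refl)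
        , V-gather (λ D D∈ → V≥ D (there D∈)))
        where
        V≥ : ∀ D → D ∈ C ∷ C′ ∷ Cs → ∀ u → 0ℚ ≤ V (points D) u
        V≥ D D∈ = V-nonneg (↭-trans S↭₁ p) far D∈ (proj₂ (∈-picks D∈))
      second : Separation ps 1≤ps R₁ (length Cs₀) Cs₀ → Splits S ⊎ Boxed S (clusterBound σ k)
      second (Cs₁ , p , _ , far , D≤) = third {Cs₁} S↭₁ (separate ps 1≤ps R₂↗ 1≤R₂ (length Cs₁) Cs₁ refl)
          (ℕ.≤-trans (growth-monoˡ 1≤R₂ (diam Cs₁) length₁)
            (growth-monoʳ R₂↗ k (ℕ.≤-trans D≤ (ℕ.≤-trans (ℕ.≤-reflexive (cong (growth R₁ (length Cs₀)) (diameters-singletons ps 1≤ps S)))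
              (growth-monoˡ 1≤R₁ 1 length₀)))))
        where
        S↭₁ : S ↭ gath Cs₁
        S↭₁ = ↭-trans (↭-reflexive (sym (gather₀ S))) p
        length₁ : length Cs₁ ℕ.≤ k
        length₁ = ℤ.drop‿+≤+ (ι-cancel (ℚ.≤-trans
          (length≤total (λ C C∈ → total≥1 ℕ.≤-refl S↭₁ far (proj₂ (∈-picks C∈))))
          (ℚ.≤-trans (ℚ.≤-reflexive (sym (∑-↭ S↭₁))) tot≤k)))

-- Divisors as exponent vectors

decode : ∀ (pl : List ℕ) → Vec ℕ (length pl) → ℕ
decode []       []      = 1
decode (p ∷ pl) (i ∷ u) = p ℕ.^ i ℕ.* decode pl u

decode-+ : ∀ (pl : List ℕ) u v → decode pl (zipWith ℕ._+_ u v) ≡ decode pl u ℕ.* decode pl v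
decode-+ []       []      []      = refl
decode-+ (p ∷ pl) (i ∷ u) (j ∷ v) = trans (cong₂ ℕ._*_ (ℕ.^-distribˡ-+-* p i j) (decode-+ pl u v))
  (PrimeProducts.*-interchange (p ℕ.^ i) (p ℕ.^ j) (decode pl u) (decode pl v))

decode-zero : ∀ (pl : List ℕ) → decode pl (replicate (length pl) 0) ≡ 1
decode-zero []       = refl
decode-zero (p ∷ pl) = trans (ℕ.+-identityʳ _) (decode-zero pl)

decode≢0 : ∀ {pl : List ℕ} → All Prime pl → ∀ u → ℕ.NonZero (decode pl u)
decode≢0 []               []      = _
decode≢0 {p ∷ pl} (pp ∷ h) (i ∷ u) =
  ℕ.m*n≢0 (p ℕ.^ i) (decode pl u) {{ℕ.m^n≢0 p i {{prime⇒nonZero pp}}}} {{decode≢0 h u}}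

bump : ∀ {pl : List ℕ} {q} → q ∈ pl → ∀ u → ∃[ u′ ] decode pl u′ ≡ q ℕ.* decode pl u
bump {p ∷ pl} (here refl) (i ∷ u) = suc i ∷ u , ℕ.*-assoc p (p ℕ.^ i) (decode pl u)
bump {p ∷ pl} {q} (there q∈) (i ∷ u) with bump q∈ u
... | u′ , eq = i ∷ u′ , trans (cong (p ℕ.^ i ℕ.*_) eq)
  (ℕ-solve 3 (λ a b c → a ⊗ (b ⊗ c) ⊜ b ⊗ (a ⊗ c)) refl (p ℕ.^ i) q (decode pl u))

encode : ∀ {pl : List ℕ} d → .{{_ : ℕ.NonZero d}} → (∀ {q} → Prime q → q ∣ d → q ∈ pl) → ∃[ u ] decode pl u ≡ d
encode {pl} d h = go′ (factors d′) (isFactorisation d′) (factorsPrime d′)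
  where
  open PrimeFactorisation
  d′ : PrimeFactorisation d
  d′ = factorise d
  go : ∀ {qs : List ℕ} → All Prime qs → product qs ∣ d → ∃[ u ] decode pl u ≡ product qs
  go []                    _  = replicate (length pl) 0 , decode-zero pl
  go {q ∷ qs} (pq ∷ pqs) q∣d with go pqs (∣.∣-trans (∣.n∣m*n q) q∣d)
  ... | u , eq with bump (h pq (∣.∣-trans (∣.m∣m*n (product qs)) q∣d)) u
  ... | u′ , eq′ = u′ , trans eq′ (cong (q ℕ.*_) eq)
  go′ : ∀ qs → d ≡ product qs → All Prime qs → ∃[ u ] decode pl u ≡ d
  go′ qs eq pqs with go pqs (∣.∣-reflexive (sym eq))
  ... | u , eq′ = u , trans eq′ (sym eq)

prime-∣-^ : ∀ {p} q i → Prime p → p ∣ q ℕ.^ i → p ∣ q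
prime-∣-^ q zero    pp p∣1 with refl ← ∣.∣1⇒≡1 p∣1 = contradiction pp ¬prime[1]
prime-∣-^ q (suc i) pp p∣ with euclidsLemma q (q ℕ.^ i) pp p∣
... | inj₁ p∣q = p∣q
... | inj₂ p∣^ = prime-∣-^ q i pp p∣^

prime-∤-decode : ∀ {p} {pl : List ℕ} → Prime p → All Prime pl → All (p ≢_) pl → ∀ u → p ∤ decode pl u
prime-∤-decode pp [] [] [] p∣1 with refl ← ∣.∣1⇒≡1 p∣1 = ¬prime[1] pp
prime-∤-decode {p} {q ∷ pl} pp (pq ∷ h) (p≢q ∷ p≢) (i ∷ u) p∣ with euclidsLemma (q ℕ.^ i) (decode pl u) pp p∣
... | inj₁ p∣q^ = p≢q (PrimeProducts.prime-∣-prime pp pq (prime-∣-^ q i pp p∣q^))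
... | inj₂ p∣D  = prime-∤-decode pp h p≢ u p∣D

coprime-^* : ∀ {p x y} i → Prime p → p ∤ y → Coprime.Coprime x y → Coprime.Coprime (p ℕ.^ i ℕ.* x) y
coprime-^* {x = x} {y} zero pp p∤y c = subst (λ z → Coprime.Coprime z y) (sym (ℕ.+-identityʳ x)) c
coprime-^* {p} {x} {y} (suc i) pp p∤y c {d} (d∣ , d∣y) =
  coprime-^* i pp p∤y c (Coprime.coprime-divisor d⊥p (subst (d ∣_) (ℕ.*-assoc p (p ℕ.^ i) x) d∣) , d∣y)
  where
  d⊥p : Coprime.Coprime d p
  d⊥p {e} (e∣d , e∣p) with prime⇒irreducible pp e∣p
  ... | inj₁ e≡1  = e≡1
  ... | inj₂ refl = contradiction (∣.∣-trans e∣d d∣y) p∤y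

-- In every coordinate one of the two truncated differences is 0, so no prime occurs on both sides.
decode-∸-coprime : ∀ {pl : List ℕ} → Unique pl → All Prime pl → ∀ u v →
  Coprime.Coprime (decode pl (zipWith _∸_ u v)) (decode pl (zipWith _∸_ v u))
decode-∸-coprime []       []       []      []      = Coprime.1-coprimeTo 1
decode-∸-coprime {p ∷ pl} (p≢ ∷ un) (pp ∷ h) (i ∷ u) (j ∷ v) with ℕ.≤-total i j
... | inj₁ i≤j rewrite ℕ.m≤n⇒m∸n≡0 i≤j = subst (λ z → Coprime.Coprime z (p ℕ.^ (j ∸ i) ℕ.* decode pl (zipWith _∸_ v u))) (sym (ℕ.+-identityʳ (decode pl (zipWith _∸_ u v))))
  (Coprime.sym (coprime-^* (j ∸ i) pp (prime-∤-decode pp h p≢ _) (Coprime.sym (decode-∸-coprime un h u v))))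
... | inj₂ j≤i rewrite ℕ.m≤n⇒m∸n≡0 j≤i = subst (Coprime.Coprime (p ℕ.^ (i ∸ j) ℕ.* decode pl (zipWith _∸_ u v))) (sym (ℕ.+-identityʳ (decode pl (zipWith _∸_ v u))))
  (coprime-^* (i ∸ j) pp (prime-∤-decode pp h p≢ _) (decode-∸-coprime un h u v))

dist-∸ : ∀ (pl : List ℕ) u v → dist (fromList pl) u v ≡ decode pl (zipWith _∸_ u v) ℕ.* decode pl (zipWith _∸_ v u)
dist-∸ []       []      []      = refl
dist-∸ (p ∷ pl) (i ∷ u) (j ∷ v) = trans (cong₂ ℕ._*_ (trans (cong (p ℕ.^_) ∣i-j∣) (ℕ.^-distribˡ-+-* p (i ∸ j) (j ∸ i))) (dist-∸ pl u v))
  (PrimeProducts.*-interchange (p ℕ.^ (i ∸ j)) (p ℕ.^ (j ∸ i)) _ _)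
  where
  ∣i-j∣ : ∣ i - j ∣ ≡ (i ∸ j) ℕ.+ (j ∸ i)
  ∣i-j∣ with ℕ.≤-total i j
  ... | inj₁ i≤j = trans (ℕ.m≤n⇒∣m-n∣≡n∸m i≤j) (cong (ℕ._+ (j ∸ i)) (sym (ℕ.m≤n⇒m∸n≡0 i≤j)))
  ... | inj₂ j≤i = trans (ℕ.m≤n⇒∣n-m∣≡n∸m j≤i) (trans (sym (ℕ.+-identityʳ (i ∸ j))) (cong ((i ∸ j) ℕ.+_) (sym (ℕ.m≤n⇒m∸n≡0 j≤i))))

meet₁ : ∀ i j → i ≡ i ⊓ j ℕ.+ (i ∸ j)
meet₁ i j = trans (sym (ℕ.m⊓n+n∸m≡n j i)) (cong (ℕ._+ (i ∸ j)) (ℕ.⊓-comm j i))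

meet-∸ˡ : ∀ {n} (u v : Vec ℕ n) → u ≡ zipWith ℕ._+_ (zipWith _⊓_ u v) (zipWith _∸_ u v)
meet-∸ˡ []      []      = refl
meet-∸ˡ (i ∷ u) (j ∷ v) = cong₂ _∷_ (meet₁ i j) (meet-∸ˡ u v)

decode-meetˡ : ∀ (pl : List ℕ) u v → decode pl u ≡ decode pl (zipWith _⊓_ u v) ℕ.* decode pl (zipWith _∸_ u v)
decode-meetˡ pl u v = trans (cong (decode pl) (meet-∸ˡ u v)) (decode-+ pl (zipWith _⊓_ u v) (zipWith _∸_ u v))

decode-meetʳ : ∀ (pl : List ℕ) u v → decode pl v ≡ decode pl (zipWith _⊓_ u v) ℕ.* decode pl (zipWith _∸_ v u)
decode-meetʳ pl u v = trans (decode-meetˡ pl v u) (cong (λ w → decode pl w ℕ.* decode pl (zipWith _∸_ v u)) (⊓-sym v u))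
  where
  ⊓-sym : ∀ {n} (u v : Vec ℕ n) → zipWith _⊓_ u v ≡ zipWith _⊓_ v u
  ⊓-sym []      []      = refl
  ⊓-sym (i ∷ u) (j ∷ v) = cong₂ _∷_ (ℕ.⊓-comm i j) (⊓-sym u v)

-- Taking the decoded meet out of both numbers leaves coprime cofactors, which avoids comparing
-- valuations.
gcd-decode : ∀ {pl : List ℕ} → Unique pl → All Prime pl → ∀ u v → gcd (decode pl u) (decode pl v) ≡ decode pl (zipWith _⊓_ u v)
gcd-decode {pl} un h u v = begin
  gcd (decode pl u) (decode pl v)   ≡⟨ cong₂ gcd (decode-meetˡ pl u v) (decode-meetʳ pl u v) ⟩
  gcd (m ℕ.* a) (m ℕ.* b)           ≡⟨ sym (c*gcd[m,n]≡gcd[cm,cn] m a b) ⟩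
  m ℕ.* gcd a b                     ≡⟨ cong (m ℕ.*_) (Coprime.coprime⇒gcd≡1 (decode-∸-coprime un h u v)) ⟩
  m ℕ.* 1                           ≡⟨ ℕ.*-identityʳ m ⟩
  m                                 ∎
  where
  open ≡-Reasoning
  m a b : ℕ
  m = decode pl (zipWith _⊓_ u v)
  a = decode pl (zipWith _∸_ u v)
  b = decode pl (zipWith _∸_ v u)

-- This ties the coordinatewise `dist` to the gcd(d, t)² in the order at a cusp.
dist-gcd : ∀ {pl : List ℕ} → Unique pl → All Prime pl → ∀ u v →
  gcd (decode pl v) (decode pl u) ℕ.^ 2 ℕ.* dist (fromList pl) u v ≡ decode pl u ℕ.* decode pl v
dist-gcd {pl} un h u v = begin
  gcd (decode pl v) (decode pl u) ℕ.^ 2 ℕ.* dist (fromList pl) u v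
    ≡⟨ cong₂ (λ g D → g ℕ.^ 2 ℕ.* D) (trans (gcd-comm (decode pl v) (decode pl u)) (gcd-decode un h u v)) (dist-∸ pl u v) ⟩
  m ℕ.^ 2 ℕ.* (a ℕ.* b)              ≡⟨ cong (λ z → m ℕ.* z ℕ.* (a ℕ.* b)) (ℕ.*-identityʳ m) ⟩
  m ℕ.* m ℕ.* (a ℕ.* b)              ≡⟨ PrimeProducts.*-interchange m m a b ⟩
  (m ℕ.* a) ℕ.* (m ℕ.* b)            ≡⟨ cong₂ ℕ._*_ (sym (decode-meetˡ pl u v)) (sym (decode-meetʳ pl u v)) ⟩
  decode pl u ℕ.* decode pl v        ∎
  where
  open ≡-Reasoning

  m a b : ℕ
  m = decode pl (zipWith _⊓_ u v)
  a = decode pl (zipWith _∸_ u v)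
  b = decode pl (zipWith _∸_ v u)

-- The gcd is cancelled from gcd · lcm = product; on exponents, i + j is the minimum plus the
-- maximum.
lcm-decode : ∀ {pl : List ℕ} → Unique pl → All Prime pl → ∀ u v → lcm (decode pl u) (decode pl v) ≡ decode pl (zipWith _⊔_ u v)
lcm-decode {pl} un h u v = ℕ.*-cancelˡ-≡ _ _ (decode pl (zipWith _⊓_ u v)) {{decode≢0 h _}} (begin
  decode pl (zipWith _⊓_ u v) ℕ.* lcm (decode pl u) (decode pl v)
    ≡⟨ cong (ℕ._* lcm (decode pl u) (decode pl v)) (sym (gcd-decode un h u v)) ⟩
  gcd (decode pl u) (decode pl v) ℕ.* lcm (decode pl u) (decode pl v)   ≡⟨ gcd*lcm (decode pl u) (decode pl v) ⟩
  decode pl u ℕ.* decode pl v                                           ≡⟨ sym (decode-+ pl u v) ⟩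
  decode pl (zipWith ℕ._+_ u v)                                         ≡⟨ cong (decode pl) (meet+join u v) ⟩
  decode pl (zipWith ℕ._+_ (zipWith _⊓_ u v) (zipWith _⊔_ u v))         ≡⟨ decode-+ pl _ _ ⟩
  decode pl (zipWith _⊓_ u v) ℕ.* decode pl (zipWith _⊔_ u v)           ∎)
  where
  open ≡-Reasoning
  meet+join₁ : ∀ i j → i ℕ.+ j ≡ i ⊓ j ℕ.+ (i ⊔ j)
  meet+join₁ i j with ℕ.≤-total i j
  ... | inj₁ i≤j = sym (cong₂ ℕ._+_ (ℕ.m≤n⇒m⊓n≡m i≤j) (ℕ.m≤n⇒m⊔n≡n i≤j))
  ... | inj₂ j≤i = trans (ℕ.+-comm i j) (sym (cong₂ ℕ._+_ (ℕ.m≥n⇒m⊓n≡n j≤i) (ℕ.m≥n⇒m⊔n≡m j≤i)))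
  meet+join : ∀ {n} (u v : Vec ℕ n) → zipWith ℕ._+_ u v ≡ zipWith ℕ._+_ (zipWith _⊓_ u v) (zipWith _⊔_ u v)
  meet+join []      []      = refl
  meet+join (i ∷ u) (j ∷ v) = cong₂ _∷_ (meet+join₁ i j) (meet+join u v)

decode-dist : ∀ (pl : List ℕ) {lo hi} → Pointwise ℕ._≤_ lo hi → decode pl hi ≡ decode pl lo ℕ.* dist (fromList pl) lo hi
decode-dist []       []              = refl
decode-dist (p ∷ pl) {l ∷ lo} {h ∷ hi} (l≤h ∷ lo≤hi) = trans
  (cong₂ ℕ._*_ (trans (cong (p ℕ.^_) (sym (trans (cong (l ℕ.+_) (ℕ.m≤n⇒∣m-n∣≡n∸m l≤h)) (ℕ.m+[n∸m]≡n l≤h)))) (ℕ.^-distribˡ-+-* p l ∣ l - h ∣)) (decode-dist pl lo≤hi))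
  (PrimeProducts.*-interchange (p ℕ.^ l) (p ℕ.^ ∣ l - h ∣) _ _)

decode-mono-∣ : ∀ (pl : List ℕ) {u v} → Pointwise ℕ._≤_ u v → decode pl u ∣ decode pl v
decode-mono-∣ pl {u} {v} u≤v = divides (dist (fromList pl) u v) (trans (decode-dist pl u≤v) (ℕ.*-comm (decode pl u) _))

reciprocal : ℕ → ℚ
reciprocal zero    = 0ℚ
reciprocal (suc p) = ℚ.1/ ιℕ (suc p)

reciprocals : ∀ (pl : List ℕ) → Vec ℚ (length pl)
reciprocals []       = []
reciprocals (p ∷ pl) = reciprocal p ∷ reciprocals pl

reciprocals-Reciprocal : ∀ {pl : List ℕ} → All Prime pl → Reciprocal (reciprocals pl) (fromList pl)
reciprocals-Reciprocal []                     = []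
reciprocals-Reciprocal {zero ∷ _}  (pp ∷ _) = contradiction pp ¬prime[0]
reciprocals-Reciprocal {suc p ∷ _} (_ ∷ h)  = ℚ.*-inverseˡ (ιℕ (suc p)) ∷ reciprocals-Reciprocal h

reciprocals-Ratio : ∀ {pl : List ℕ} → All Prime pl → AllV.All Ratio (reciprocals pl)
reciprocals-Ratio []                           = []
reciprocals-Ratio {zero ∷ _}        (pp ∷ _) = contradiction pp ¬prime[0]
reciprocals-Ratio {suc zero ∷ _}    (pp ∷ _) = contradiction pp ¬prime[1]
reciprocals-Ratio {suc (suc p) ∷ _} (_ ∷ h)  =
  (*≤* (ℤ.+≤+ ℕ.z≤n) , *≤* (ℤ.+≤+ (ℕ.s≤s (ℕ.s≤s ℕ.z≤n)))) ∷ reciprocals-Ratio h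

amplification-product : ∀ {pl : List ℕ} → All Prime pl →
  amplification (reciprocals pl) * ιℕ (product pl) ≡ ιℕ (product (map (ℕ._+ 16) pl))
amplification-product []                    = refl
amplification-product {zero ∷ _}   (pp ∷ _) = contradiction pp ¬prime[0]
amplification-product {suc p ∷ pl} (_ ∷ h)  = begin
  (1ℚ + 16ℚ * r) * A * ιℕ (suc p ℕ.* product pl)   ≡⟨ cong ((1ℚ + 16ℚ * r) * A *_) (ιℕ-* (suc p) (product pl)) ⟩
  (1ℚ + 16ℚ * r) * A * (q * P)
    ≡⟨ solve 4 (λ t A q P → t :* A :* (q :* P) := (t :* q) :* (A :* P)) refl (1ℚ + 16ℚ * r) A q P ⟩
  (1ℚ + 16ℚ * r) * q * (A * P)
    ≡⟨ cong₂ _*_ (trans (solve 2 (λ r q → (con 1ℚ :+ con 16ℚ :* r) :* q := q :+ con 16ℚ :* (r :* q)) refl r q)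
         (trans (cong (λ z → q + 16ℚ * z) (ℚ.*-inverseˡ (ιℕ (suc p)))) (sym (ιℕ-+ (suc p) 16)))) (amplification-product h) ⟩
  ιℕ (suc p ℕ.+ 16) * ιℕ (product (map (ℕ._+ 16) pl))  ≡⟨ sym (ιℕ-* (suc p ℕ.+ 16) _) ⟩
  ιℕ ((suc p ℕ.+ 16) ℕ.* product (map (ℕ._+ 16) pl))   ∎
  where
  open ≡-Reasoning
  r A q P : ℚ
  r = reciprocal (suc p)
  A = amplification (reciprocals pl)
  q = ιℕ (suc p)
  P = ιℕ (product pl)

opaque
  sucBound : ℕ → ℕ
  sucBound L = 8 ℕ.* suc L ℕ.^ 4

  sucBound-≡ : ∀ L → sucBound L ≡ 8 ℕ.* suc L ℕ.^ 4
  sucBound-≡ L = refl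

amplification≤ : ∀ {pl τ} → All Prime pl → product (map suc pl) ℕ.≤ τ ℕ.* product pl →
  amplification (reciprocals pl) ≤ ιℕ (τ ℕ.^ 16)
amplification≤ {pl} {τ} h Π≤ = ℚ.*-cancelʳ-≤-pos (ιℕ (product pl)) {{ℚ.positive 0<Π}} (begin
  amplification (reciprocals pl) * ιℕ (product pl)   ≡⟨ amplification-product h ⟩
  ιℕ (product (map (ℕ._+ 16) pl))                    ≤⟨ ιℕ-mono (PrimeProducts.amplification-bound 16 τ pl h Π≤) ⟩
  ιℕ (τ ℕ.^ 16 ℕ.* product pl)                       ≡⟨ ιℕ-* (τ ℕ.^ 16) (product pl) ⟩
  ιℕ (τ ℕ.^ 16) * ιℕ (product pl)                    ∎)
  where
  open ℚ.≤-Reasoning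
  0<Π : 0ℚ < ιℕ (product pl)
  0<Π = ℚ.<-≤-trans (ℚ.positive⁻¹ 1ℚ) (ιℕ-mono (ℕ.>-nonZero⁻¹ _ {{productOfPrimes≢0 h}}))

amplification≤sucBound : ∀ L {pl} → Unique pl → All Prime pl → length pl ℕ.≤ 2 ℕ.^ L →
  amplification (reciprocals pl) ≤ ιℕ (sucBound L ℕ.^ 16)
amplification≤sucBound L {pl} un h len = amplification≤ {pl} {sucBound L} h
  (subst (λ τ → product (map suc pl) ℕ.≤ τ ℕ.* product pl) (sym (sucBound-≡ L)) (PrimeProducts.product-suc-bound L un h len))

-- Orders at cusps as potentials

0≤/⇒0≤ : ∀ z n .{{_ : ℕ.NonZero n}} → 0ℚ ≤ z / n → 0ℤ ℤ.≤ z
0≤/⇒0≤ (+ _)    n _ = ℤ.+≤+ ℕ.z≤n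
0≤/⇒0≤ -[1+ m ] n p = contradiction (ℚ.≤-<-trans p (ℚ.negative⁻¹ _ {{ℚ.neg-pos {ℚ.normalize (suc m) n} (ℚ.normalize-pos (suc m) n)}})) (ℚ.<-irrefl refl)

0≤⇒0≤/ : ∀ z n .{{_ : ℕ.NonZero n}} → 0ℤ ℤ.≤ z → 0ℚ ≤ z / n
0≤⇒0≤/ (+ m) n _ = ℚ.nonNegative⁻¹ _ {{ℚ.normalize-nonNeg m n}}

/2-injective : ∀ a b → a / 2 ≡ b / 2 → a ≡ b
/2-injective a b eq with ℚ./-injective-≃ (ℚᵘ.mkℚᵘ a 1) (ℚᵘ.mkℚᵘ b 1) eq
... | ℚᵘ.*≡* eq′ = ℤ.*-cancelʳ-≡ a b (+ 2) eq′

ι-sum : ∀ {P : Set} (F : P → ℤ) L → ι (sumℤ (map F L)) ≡ ∑ L (λ x → ι (F x))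
ι-sum F []      = refl
ι-sum F (x ∷ L) = trans (ι-+ (F x) _) (cong (_+_ (ι (F x))) (ι-sum F L))

∑-map : ∀ {P Q : Set} (h : P → Q) L {F : Q → ℚ} → ∑ (map h L) F ≡ ∑ L (λ x → F (h x))
∑-map h []          = refl
∑-map h (x ∷ L) {F} = cong (_+_ (F (h x))) (∑-map h L)

∑-filter : ∀ {P : Set} {Q : P → Set} (Q? : Decidable Q) L {F : P → ℚ} → (∀ x → ¬ Q x → F x ≡ 0ℚ) →
  ∑ L F ≡ ∑ (filter Q? L) F
∑-filter Q? []          F≡0 = refl
∑-filter Q? (x ∷ L) {F} F≡0 with Q? x
... | yes _ = cong (_+_ (F x)) (∑-filter Q? L F≡0)
... | no ¬q = trans (cong₂ _+_ (F≡0 x ¬q) (∑-filter Q? L F≡0)) (ℚ.+-identityˡ _)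

unique∧set⇒↭ : ∀ {A : Set} {xs ys : List A} → Unique xs → Unique ys →
  (∀ {x} → x ∈ xs → x ∈ ys) → (∀ {x} → x ∈ ys → x ∈ xs) → xs ↭ ys
unique∧set⇒↭ u v f g = ∼bag⇒↭ (WithK.unique∧set⇒bag u v (mk⇔ f g))

∈-support⁺ : ∀ f {d} → exponent f d ≢ 0ℤ → d ∈ support f
∈-support⁺ f {d} X≢0 = ∈-filter⁺ (λ d → ¬? (exponent f d ℤ.≟ 0ℤ))
  (∈-upTo⁺ (ℕ.≮⇒≥ (λ b<d → X≢0 (vanishes f d (ℕ.≤-pred b<d))))) X≢0

∈-support⁻ : ∀ f {d} → d ∈ support f → exponent f d ≢ 0ℤ
∈-support⁻ f d∈ = proj₂ (∈-filter⁻ (λ d → ¬? (exponent f d ℤ.≟ 0ℤ)) {xs = upTo (suc (bound f))} d∈)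

support-unique : ∀ f → Unique (support f)
support-unique f = Unique.filter⁺ (λ d → ¬? (exponent f d ℤ.≟ 0ℤ)) (Unique.upTo⁺ (suc (bound f)))

support-≢0 : ∀ f {d} → d ∈ support f → d ≢ 0
support-≢0 f d∈ refl = ∈-support⁻ f d∈ (exponent-0 f)

∣-foldr-lcm : ∀ {d} {L : List ℕ} → d ∈ L → d ∣ foldr lcm 1 L
∣-foldr-lcm {L = x ∷ L} (here refl) = m∣lcm[m,n] x _
∣-foldr-lcm {L = x ∷ L} (there d∈)  = ∣.∣-trans (∣-foldr-lcm d∈) (n∣lcm[m,n] x _)

foldr-lcm-∣ : ∀ {n} (L : List ℕ) → (∀ {d} → d ∈ L → d ∣ n) → foldr lcm 1 L ∣ n
foldr-lcm-∣ []      h = ∣.1∣ _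
foldr-lcm-∣ (x ∷ L) h = lcm-least (h (here refl)) (foldr-lcm-∣ L (λ d∈ → h (there d∈)))

module _ (g : EtaQuotient) (M t : ℕ) .{{_ : ℕ.NonZero M}} where

  orderTerm : ℕ → ℤ
  orderTerm i = + ((M ℕ./ suc i) ℕ.* gcd (suc i) t ℕ.^ 2) ℤ.* exponent g (suc i)

  orderNumerator : ℤ
  orderNumerator = sumℤ (map orderTerm (filter (λ i → suc i ∣? M) (upTo M)))

  private
    divisors nonzeros : List ℕ
    divisors = filter (λ i → suc i ∣? M) (upTo M)
    nonzeros = filter (λ i → ¬? (exponent g (suc i) ℤ.≟ 0ℤ)) divisors

    -- Indexed by the divisor d itself instead of d - 1; the value at 0 is a dummy, as 0 is never in
    -- the support.
    G : ℕ → ℚ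
    G zero    = 0ℚ
    G (suc i) = ι (orderTerm i)

  numerator-support : (∀ {d} → d ∈ support g → d ∣ M) → ι orderNumerator ≡ ∑ (support g) G
  numerator-support ∣M = begin
    ι orderNumerator                    ≡⟨ ι-sum orderTerm divisors ⟩
    ∑ divisors (λ i → G (suc i))        ≡⟨ ∑-filter (λ i → ¬? (exponent g (suc i) ℤ.≟ 0ℤ)) divisors vanish ⟩
    ∑ nonzeros (λ i → G (suc i))        ≡⟨ sym (∑-map suc nonzeros) ⟩
    ∑ (map suc nonzeros) G              ≡⟨ ∑-↭ (unique∧set⇒↭
      (Unique.map⁺ ℕ.suc-injective (Unique.filter⁺ _ (Unique.filter⁺ _ (Unique.upTo⁺ M)))) (support-unique g) to from) ⟩
    ∑ (support g) G                     ∎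
    where
    open ≡-Reasoning
    vanish : ∀ i → ¬ (exponent g (suc i) ≢ 0ℤ) → G (suc i) ≡ 0ℚ
    vanish i ¬¬ with exponent g (suc i) ℤ.≟ 0ℤ
    ... | yes eq = cong ι (trans (cong (+ ((M ℕ./ suc i) ℕ.* gcd (suc i) t ℕ.^ 2) ℤ.*_) eq) (ℤ.*-zeroʳ (+ ((M ℕ./ suc i) ℕ.* gcd (suc i) t ℕ.^ 2))))
    ... | no ≢0  = contradiction ≢0 ¬¬
    to : ∀ {d} → d ∈ map suc nonzeros → d ∈ support g
    to d∈ with ∈-map⁻ suc d∈
    ... | i , i∈ , refl = ∈-support⁺ g (proj₂ (∈-filter⁻ (λ i → ¬? (exponent g (suc i) ℤ.≟ 0ℤ)) {xs = divisors} i∈))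
    from : ∀ {d} → d ∈ support g → d ∈ map suc nonzeros
    from {zero}  d∈ = contradiction refl (support-≢0 g d∈)
    from {suc i} d∈ = ∈-map⁺ suc (∈-filter⁺ _ (∈-filter⁺ _ (∈-upTo⁺ (∣.∣⇒≤ (∣M d∈))) (∣M d∈)) (∈-support⁻ g d∈))

  module _ {pl : List ℕ} (un : Unique pl) (pr : All Prime pl) where

    -- By `dist-gcd` the coefficient (M / d) gcd(d, t)² is M t / dist(t, d), so M t comes out of the
    -- sum and the kernel remains. The list `pl` may contain primes that do not divide M, as happens
    -- for factors of smaller level.
    numerator-potential : ∀ {A w} → (∀ {d} → d ∈ support g → d ∣ M) → decode pl w ≡ t → support g ↭ map (decode pl) A →
      ι orderNumerator ≡ ιℕ (M ℕ.* t) * ∑ A (λ v → ι (exponent g (decode pl v)) * kernel (reciprocals pl) w v)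
    numerator-potential {A} {w} ∣M refl supp↭ = begin
      ι orderNumerator                 ≡⟨ numerator-support ∣M ⟩
      ∑ (support g) G                  ≡⟨ ∑-↭ supp↭ ⟩
      ∑ (map (decode pl) A) G          ≡⟨ ∑-map (decode pl) A ⟩
      ∑ A (λ v → G (decode pl v))      ≡⟨ ∑-cong∈ A (λ v v∈ → term v _ refl
                                            (∣M (∈-resp-↭ (↭-sym supp↭) (∈-map⁺ (decode pl) v∈)))) ⟩
      ∑ A (λ v → ιℕ (M ℕ.* t) * (ι (exponent g (decode pl v)) * K v))   ≡⟨ ∑-*ˡ A (ιℕ (M ℕ.* t)) ⟩
      ιℕ (M ℕ.* t) * ∑ A (λ v → ι (exponent g (decode pl v)) * K v)     ∎
      where
      open ≡-Reasoning
      K : Vec ℕ (length pl) → ℚ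
      K v = kernel (reciprocals pl) w v
      term : ∀ v d → decode pl v ≡ d → d ∣ M → G d ≡ ιℕ (M ℕ.* t) * (ι (exponent g d) * K v)
      term v zero    eq _   = contradiction eq (ℕ.≢-nonZero⁻¹ _ {{decode≢0 pr v}})
      term v (suc i) eq d∣M = trans (ι-* (+ (m ℕ.* g²)) (exponent g (suc i)))
        (trans (cong (_* x) weight-eq) (solve 3 (λ a k x → (a :* k) :* x := a :* (x :* k)) refl (ιℕ (M ℕ.* t)) (K v) x))
        where
        m g² D : ℕ
        m  = M ℕ./ suc i
        g² = gcd (suc i) t ℕ.^ 2
        D  = dist (fromList pl) w v
        x : ℚ
        x = ι (exponent g (suc i))
        g²D : g² ℕ.* D ≡ t ℕ.* suc i
        g²D = subst (λ e → gcd e t ℕ.^ 2 ℕ.* D ≡ t ℕ.* e) eq (dist-gcd un pr w v)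
        weight-eq : ιℕ (m ℕ.* g²) ≡ ιℕ (M ℕ.* t) * K v
        weight-eq = begin
          ιℕ (m ℕ.* g²)                      ≡⟨ sym (ℚ.*-identityʳ _) ⟩
          ιℕ (m ℕ.* g²) * 1ℚ                 ≡⟨ cong (ιℕ (m ℕ.* g²) *_) (sym (kernel-dist (reciprocals-Reciprocal pr) w v)) ⟩
          ιℕ (m ℕ.* g²) * (K v * ιℕ D)       ≡⟨ solve 3 (λ a k d → a :* (k :* d) := (a :* d) :* k) refl (ιℕ (m ℕ.* g²)) (K v) (ιℕ D) ⟩
          ιℕ (m ℕ.* g²) * ιℕ D * K v         ≡⟨ cong (_* K v) (sym (ιℕ-* (m ℕ.* g²) D)) ⟩
          ιℕ (m ℕ.* g² ℕ.* D) * K v          ≡⟨ cong (λ z → ιℕ z * K v) (begin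
            m ℕ.* g² ℕ.* D                     ≡⟨ ℕ.*-assoc m g² D ⟩
            m ℕ.* (g² ℕ.* D)                   ≡⟨ cong (m ℕ.*_) (trans g²D (ℕ.*-comm t (suc i))) ⟩
            m ℕ.* (suc i ℕ.* t)                ≡⟨ sym (ℕ.*-assoc m (suc i) t) ⟩
            m ℕ.* suc i ℕ.* t                  ≡⟨ cong (ℕ._* t) (ℕ.m/n*n≡m d∣M) ⟩
            M ℕ.* t                            ∎) ⟩
          ιℕ (M ℕ.* t) * K v                 ∎

    0≤order⇔ : ∀ {A w} .{{_ : ℕ.NonZero t}} → (∀ {d} → d ∈ support g → d ∣ M) → decode pl w ≡ t → support g ↭ map (decode pl) A →
      (0ℚ ≤ order M t g → 0ℚ ≤ ∑ A (λ v → ι (exponent g (decode pl v)) * kernel (reciprocals pl) w v)) ×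
      (0ℚ ≤ ∑ A (λ v → ι (exponent g (decode pl v)) * kernel (reciprocals pl) w v) → 0ℚ ≤ order M t g)
    0≤order⇔ {A} {w} ∣M t≡ supp↭ =
        (λ 0≤ord → ℚ.*-cancelˡ-≤-pos (ιℕ (M ℕ.* t)) {{ℚ.positive 0<Mt}} (subst₂ _≤_
          (sym (ℚ.*-zeroʳ (ιℕ (M ℕ.* t)))) (numerator-potential ∣M t≡ supp↭) (ι-mono (0≤/⇒0≤ orderNumerator (24 ℕ.* gcd (t ℕ.^ 2) M) {{cuspDenominator≢0 M t}} 0≤ord))))
      , (λ 0≤V → 0≤⇒0≤/ orderNumerator (24 ℕ.* gcd (t ℕ.^ 2) M) {{cuspDenominator≢0 M t}} (ι-cancel
          (subst (0ℚ ≤_) (sym (numerator-potential ∣M t≡ supp↭)) (0≤* (0≤ιℕ (M ℕ.* t)) 0≤V))))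
      where
      0<Mt : 0ℚ < ιℕ (M ℕ.* t)
      0<Mt = ℚ.<-≤-trans (ℚ.positive⁻¹ 1ℚ) (ιℕ-mono (ℕ.>-nonZero⁻¹ _ {{ℕ.m*n≢0 M t}}))

-- Restricting an eta quotient to a part of its support

Unique-resp-↭ : ∀ {xs ys : List ℕ} → xs ↭ ys → Unique xs → Unique ys
Unique-resp-↭ p = ↭ₛ.Unique-resp-↭ (setoid ℕ) (↭⇒↭ₛ p)

Unique-++-disjoint : ∀ {xs ys : List ℕ} {d} → Unique (xs ++ ys) → d ∈ xs → d ∉ ys
Unique-++-disjoint {x ∷ xs} (x≢ ∷ u) (here refl) d∈ys = All.lookup x≢ (∈-++⁺ʳ xs d∈ys) refl
Unique-++-disjoint {x ∷ xs} (_ ∷ u)  (there d∈)  d∈ys = Unique-++-disjoint u d∈ d∈ys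

restrictExponent : List ℕ → (ℕ → ℤ) → ℕ → ℤ
restrictExponent L X d with d ∈? L
... | yes _ = X d
... | no  _ = 0ℤ

restrict-∈ : ∀ {L d} X → d ∈ L → restrictExponent L X d ≡ X d
restrict-∈ {L} {d} X d∈ with d ∈? L
... | yes _ = refl
... | no d∉ = contradiction d∈ d∉

restrict-∉ : ∀ {L d} X → d ∉ L → restrictExponent L X d ≡ 0ℤ
restrict-∉ {L} {d} X d∉ with d ∈? L
... | yes d∈ = contradiction d∈ d∉
... | no _   = refl

restrict-zero : ∀ L {X : ℕ → ℤ} {d} → X d ≡ 0ℤ → restrictExponent L X d ≡ 0ℤ
restrict-zero L {X} {d} X≡0 with d ∈? L
... | yes _ = X≡0
... | no  _ = refl

restrict : List ℕ → EtaQuotient → EtaQuotient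
restrict L f = record
  { exponent   = restrictExponent L (exponent f)
  ; exponent-0 = restrict-zero L (exponent-0 f)
  ; bound      = bound f
  ; vanishes   = λ d b<d → restrict-zero L (vanishes f d b<d)
  }

support-restrict : ∀ f {L} → Unique L → (∀ {d} → d ∈ L → d ∈ support f) → support (restrict L f) ↭ L
support-restrict f {L} u L⊆ = unique∧set⇒↭ (support-unique (restrict L f)) u to from
  where
  to : ∀ {d} → d ∈ support (restrict L f) → d ∈ L
  to {d} d∈ with d ∈? L
  ... | yes d∈L = d∈L
  ... | no  d∉L = contradiction (restrict-∉ (exponent f) d∉L) (∈-support⁻ (restrict L f) d∈)
  from : ∀ {d} → d ∈ L → d ∈ support (restrict L f)
  from d∈ = ∈-support⁺ (restrict L f) (λ e → ∈-support⁻ f (L⊆ d∈) (trans (sym (restrict-∈ (exponent f) d∈)) e))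

-- The level and its prime factors

foldr-lcm≢0 : ∀ L → (∀ {d} → d ∈ L → d ≢ 0) → foldr lcm 1 L ≢ 0
foldr-lcm≢0 []      h ()
foldr-lcm≢0 (x ∷ L) h eq with ℕ.m*n≡0⇒m≡0∨n≡0 x {foldr lcm 1 L} (trans (sym (gcd*lcm x _)) (trans (cong (gcd x (foldr lcm 1 L) ℕ.*_) eq) (ℕ.*-zeroʳ (gcd x (foldr lcm 1 L)))))
... | inj₁ x≡0 = h (here refl) x≡0
... | inj₂ l≡0 = foldr-lcm≢0 L (λ d∈ → h (there d∈)) l≡0

level≢0 : ∀ f → ℕ.NonZero (level f)
level≢0 f = ℕ.≢-nonZero (foldr-lcm≢0 (support f) (support-≢0 f))

support-∣-level : ∀ f {d} → d ∈ support f → d ∣ level f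
support-∣-level f = ∣-foldr-lcm

primesOf : ℕ → List ℕ
primesOf N = filter (λ p → prime? p ×-dec (p ∣? N)) (upTo (suc N))

module _ (N : ℕ) .{{_ : ℕ.NonZero N}} where

  primesOf-unique : Unique (primesOf N)
  primesOf-unique = Unique.filter⁺ (λ p → prime? p ×-dec (p ∣? N)) (Unique.upTo⁺ (suc N))

  primesOf-prime : All Prime (primesOf N)
  primesOf-prime = All.map proj₁ (All.all-filter (λ p → prime? p ×-dec (p ∣? N)) (upTo (suc N)))

  ∈-primesOf : ∀ {q} → Prime q → q ∣ N → q ∈ primesOf N
  ∈-primesOf pq q∣N = ∈-filter⁺ (λ p → prime? p ×-dec (p ∣? N)) (∈-upTo⁺ (ℕ.s≤s (∣.∣⇒≤ q∣N))) (pq , q∣N)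

  -- The product of these distinct primes, each at least 2, divides N. This controls their number,
  -- the one datum that `product-suc-bound` asks for.
  2^length-primesOf : 2 ℕ.^ length (primesOf N) ℕ.≤ N
  2^length-primesOf = ℕ.≤-trans (2^length≤ primesOf-prime) (∣.∣⇒≤ (PrimeProducts.product-∣ primesOf-unique primesOf-prime
      (All.map proj₂ (All.all-filter (λ p → prime? p ×-dec (p ∣? N)) (upTo (suc N))))))
    where
    2≤ : ∀ {p} → Prime p → 2 ℕ.≤ p
    2≤ pp = ℕ.nonTrivial⇒n>1 _ {{prime⇒nonTrivial pp}}
    2^length≤ : ∀ {ps} → All Prime ps → 2 ℕ.^ length ps ℕ.≤ product ps
    2^length≤ []       = ℕ.≤-refl
    2^length≤ (pp ∷ h) = ℕ.*-mono-≤ (2≤ pp) (2^length≤ h)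

  encodeDivisor : ∀ d → d ∣ N → ∃[ u ] decode (primesOf N) u ≡ d
  encodeDivisor d d∣N = encode d {{ℕ.≢-nonZero λ { refl → ℕ.≢-nonZero⁻¹ N (∣.0∣⇒≡0 d∣N) }}}
    (λ pq q∣d → ∈-primesOf pq (∣.∣-trans q∣d d∣N))

  encodeDivisors : ∀ L → (∀ {d} → d ∈ L → d ∣ N) → ∃[ S ] map (decode (primesOf N)) S ≡ L
  encodeDivisors []      h = [] , refl
  encodeDivisors (d ∷ L) h with encodeDivisor d (h (here refl)) | encodeDivisors L (λ d∈ → h (there d∈))
  ... | u , eq | S , eqs = u ∷ S , cong₂ _∷_ eq eqs

joins : ∀ {n} → List (Vec ℕ n) → Vec ℕ n
joins {n} = foldr (zipWith _⊔_) (replicate n 0)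

zero≤ : ∀ {n} (v : Vec ℕ n) → Pointwise ℕ._≤_ (replicate n 0) v
zero≤ []      = []
zero≤ (_ ∷ v) = ℕ.z≤n ∷ zero≤ v

≤-joins : ∀ {n} {v : Vec ℕ n} {S} → v ∈ S → Pointwise ℕ._≤_ v (joins S)
≤-joins {v = v} {S = w ∷ S} (here refl) = ⊔ˡ v (joins S)
  where
  ⊔ˡ : ∀ {n} (u v : Vec ℕ n) → Pointwise ℕ._≤_ u (zipWith _⊔_ u v)
  ⊔ˡ []      []      = []
  ⊔ˡ (i ∷ u) (j ∷ v) = ℕ.m≤m⊔n i j ∷ ⊔ˡ u v
≤-joins {v = v} {S = w ∷ S} (there v∈) = Pointwise.trans ℕ.≤-trans (≤-joins v∈) (⊔ʳ w (joins S))
  where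
  ⊔ʳ : ∀ {n} (u v : Vec ℕ n) → Pointwise ℕ._≤_ v (zipWith _⊔_ u v)
  ⊔ʳ []      []      = []
  ⊔ʳ (i ∷ u) (j ∷ v) = ℕ.m≤n⊔m i j ∷ ⊔ʳ u v

decode-joins : ∀ {pl} → Unique pl → All Prime pl → ∀ S → foldr lcm 1 (map (decode pl) S) ≡ decode pl (joins S)
decode-joins {pl} un pr []      = sym (decode-zero pl)
decode-joins {pl} un pr (v ∷ S) = trans (cong (lcm (decode pl v)) (decode-joins un pr S)) (lcm-decode un pr v (joins S))

-- For a common divisor ν ≥ 2, the quotient `h` with exponents X(d ν) would satisfy f(z) = h(ν z).
-- To contradict primitivity it must also differ from f: otherwise the nonzero exponent at d₀ would
-- recur at every d₀ ν^j, beyond any bound.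
gcd-support-trivial : ∀ f → Primitive f → ∀ {d₀} → d₀ ∈ support f → ∀ ν → (∀ {d} → d ∈ support f → ν ∣ d) → ν ≡ 1
gcd-support-trivial f prim {d₀} d₀∈ 0 ν∣ = contradiction (∣.0∣⇒≡0 (ν∣ d₀∈)) (support-≢0 f d₀∈)
gcd-support-trivial f prim {d₀} d₀∈ 1 ν∣ = refl
gcd-support-trivial f prim {d₀} d₀∈ ν@(suc (suc ν-2)) ν∣ = contradiction (h , ν , _ , h≉f , f≈) prim
  where
  h : EtaQuotient
  h = record
    { exponent   = λ d → exponent f (d ℕ.* ν)
    ; exponent-0 = exponent-0 f
    ; bound      = bound f
    ; vanishes   = λ d b<d → vanishes f (d ℕ.* ν) (ℕ.<-≤-trans b<d (ℕ.m≤m*n d ν))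
    }
  f≈ : f ≈ rescale ν h
  f≈ d with ν ∣? d
  ... | yes ν∣d = cong (exponent f) (sym (ℕ.m/n*n≡m ν∣d))
  ... | no  ν∤d with exponent f d ℤ.≟ 0ℤ
  ... | yes X≡0 = X≡0
  ... | no  X≢0 = contradiction (ν∣ (∈-support⁺ f X≢0)) ν∤d
  h≉f : ¬ (h ≈ f)
  h≉f h≈f = ∈-support⁻ f d₀∈ (trans (sym (iterate (bound f))) (vanishes f _ (large (bound f))))
    where
    iterate : ∀ j → exponent f (d₀ ℕ.* ν ℕ.^ j) ≡ exponent f d₀
    iterate zero    = cong (exponent f) (ℕ.*-identityʳ d₀)
    iterate (suc j) = trans (cong (exponent f) (trans (cong (d₀ ℕ.*_) (ℕ.*-comm ν (ν ℕ.^ j))) (sym (ℕ.*-assoc d₀ (ν ℕ.^ j) ν))))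
      (trans (h≈f (d₀ ℕ.* ν ℕ.^ j)) (iterate j))
    large : ∀ j → j ℕ.< d₀ ℕ.* ν ℕ.^ j
    large j = ℕ.<-≤-trans (j<ν^ j) (ℕ.≤-trans (ℕ.≤-reflexive (sym (ℕ.+-identityʳ _))) (ℕ.*-monoˡ-≤ (ν ℕ.^ j) (ℕ.n≢0⇒n>0 (support-≢0 f d₀∈))))
      where
      j<ν^ : ∀ j → j ℕ.< ν ℕ.^ j
      j<ν^ zero    = ℕ.s≤s ℕ.z≤n
      j<ν^ (suc j) = ℕ.≤-trans (ℕ.s≤s (j<ν^ j)) (ℕ.≤-trans (ℕ.+-monoˡ-≤ (ν ℕ.^ j) (ℕ.m^n>0 ν j))
        (ℕ.+-monoʳ-≤ (ν ℕ.^ j) (ℕ.m≤m+n (ν ℕ.^ j) _)))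

Unique-++ : ∀ (xs : List ℕ) {ys} → Unique (xs ++ ys) → Unique xs × Unique ys
Unique-++ []       u        = [] , u
Unique-++ (x ∷ xs) (x≢ ∷ u) with Unique-++ xs u
... | ux , uy = All.tabulate (λ y∈ → All.lookup x≢ (∈-++⁺ˡ y∈)) ∷ ux , uy

1≤primes : ∀ {pl} → All Prime pl → AllV.All (1 ℕ.≤_) (fromList pl)
1≤primes []       = []
1≤primes (pp ∷ h) = ℕ.>-nonZero⁻¹ _ {{prime⇒nonZero pp}} ∷ 1≤primes h

-- The level of a simple eta quotient

module _ (f : EtaQuotient) (hol : Holomorphic f) (k : ℤ) (wt≡ : weight f ≡ k / 2)
  (σ : ℕ) (Π≤σ : amplification (reciprocals (primesOf (level f))) ≤ ιℕ σ) where

  private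
    instance
      N≢0 : ℕ.NonZero (level f)
      N≢0 = level≢0 f

    N n : ℕ
    N = level f
    pl : List ℕ
    pl = primesOf N
    n = length pl
    un : Unique pl
    un = primesOf-unique N
    pr : All Prime pl
    pr = primesOf-prime N
    e : Vec ℕ n → ℕ
    e = decode pl
    rs : Vec ℚ n
    rs = reciprocals pl
    ratios : AllV.All Ratio rs
    ratios = reciprocals-Ratio pr
    recip : Reciprocal rs (fromList pl)
    recip = reciprocals-Reciprocal pr
    1≤ps : AllV.All (1 ℕ.≤_) (fromList pl)
    1≤ps = 1≤primes pr
    S : List (Vec ℕ n)
    S = proj₁ (encodeDivisors N (support f) (support-∣-level f))
    eS≡ : map e S ≡ support f
    eS≡ = proj₂ (encodeDivisors N (support f) (support-∣-level f))
    X : Vec ℕ n → ℤ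
    X v = exponent f (e v)
    V : List (Vec ℕ n) → Vec ℕ n → ℚ
    V = potential ratios recip 1≤ps X

    ∈S⇒∈support : ∀ {v} → v ∈ S → e v ∈ support f
    ∈S⇒∈support {v} v∈ = subst (e v ∈_) eS≡ (∈-map⁺ e v∈)

    ∈support⇒∈S : ∀ {d} → d ∈ support f → ∃[ v ] v ∈ S × d ≡ e v
    ∈support⇒∈S {d} d∈ = ∈-map⁻ e (subst (d ∈_) (sym eS≡) d∈)

    X≢0 : ∀ v → v ∈ S → X v ≢ 0ℤ
    X≢0 v v∈ = ∈-support⁻ f (∈S⇒∈support v∈)

    top : Vec ℕ n
    top = joins S

    N≡ : N ≡ e top
    N≡ = trans (cong (foldr lcm 1) (sym eS≡)) (decode-joins un pr S)

    -- Holomorphy speaks only of divisors t of the level, that is, of vectors below `top`; clamping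
    -- to this box carries it over to all exponent vectors, as the sweeping arguments require.
    V≥0 : ∀ u → 0ℚ ≤ V S u
    V≥0 u = subst (0ℚ ≤_) (∑-kernel-clamp rs S (λ v → ι (X v)) (λ v v∈ → zero≤ v , ≤-joins v∈) u)
      (0≤* (0≤kernel ratios πu u) (proj₁ (0≤order⇔ f N (e πu) un pr {S} {πu} {{decode≢0 pr πu}} (support-∣-level f) refl
        (↭-reflexive (sym eS≡))) (hol (e πu) {{decode≢0 pr πu}} πu∣N)))
      where
      πu : Vec ℕ n
      πu = clamp (replicate n 0) top u
      πu∣N : e πu ∣ N
      πu∣N = subst (e πu ∣_) (sym N≡) (decode-mono-∣ pl (proj₂ (clamp-InBox u (zero≤ top))))

    -- |k| instead of k, since k may be negative while the bounds are natural numbers.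
    tot≤ : total ratios recip 1≤ps X S ≤ ιℕ ℤ.∣ k ∣
    tot≤ = ℚ.≤-trans (ℚ.≤-reflexive tot≡) (ι≤∣∣ k)
      where
      tot≡ : ∑ S (λ v → ι (X v)) ≡ ι k
      tot≡ = begin
        ∑ S (λ v → ι (exponent f (e v)))           ≡⟨ sym (∑-map e S) ⟩
        ∑ (map e S) (λ d → ι (exponent f d))       ≡⟨ cong (λ L → ∑ L (λ d → ι (exponent f d))) eS≡ ⟩
        ∑ (support f) (λ d → ι (exponent f d))     ≡⟨ sym (ι-sum (exponent f) (support f)) ⟩
        ι (sumℤ (map (exponent f) (support f)))    ≡⟨ cong ι (/2-injective _ k wt≡) ⟩
        ι k                                        ∎
        where open ≡-Reasoning

  exponent-bound : ∀ d → ℤ.∣ exponent f d ∣ ℕ.≤ σ ℕ.* ℤ.∣ k ∣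
  exponent-bound d with exponent f d ℤ.≟ 0ℤ
  ... | yes X≡0 = subst (λ z → ℤ.∣ z ∣ ℕ.≤ σ ℕ.* ℤ.∣ k ∣) (sym X≡0) ℕ.z≤n
  ... | no  Xd≢0 with ∈support⇒∈S (∈-support⁺ f Xd≢0)
  ... | v , v∈ , refl = ℕ.≤-trans (∣X∣≤mass v∈) (mass-bound ratios recip 1≤ps X {S} σ ℤ.∣ k ∣ V≥0 Π≤σ tot≤)
    where
    ∣X∣≤mass : ∀ {L v} → v ∈ L → ℤ.∣ X v ∣ ℕ.≤ mass ratios recip 1≤ps X L
    ∣X∣≤mass {w ∷ L} (here refl) = ℕ.m≤m+n ℤ.∣ X w ∣ _
    ∣X∣≤mass {w ∷ L} (there v∈)  = ℕ.≤-trans (∣X∣≤mass v∈) (ℕ.m≤n+m _ ℤ.∣ X w ∣)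

  private
    module Factors {A O : List (Vec ℕ n)} (S↭ : S ↭ A ++ O) where

      support↭ : support f ↭ map e A ++ map e O
      support↭ = ↭-trans (↭-reflexive (sym eS≡)) (↭-trans (map⁺ e S↭) (↭-reflexive (map-++ e A O)))

      unique : Unique (map e A ++ map e O)
      unique = Unique-resp-↭ support↭ (support-unique f)

      factor : ∀ B → Unique (map e B) → (∀ {d} → d ∈ map e B → d ∈ support f) → (∃[ v ] v ∈ B) → (∀ u → 0ℚ ≤ V B u) →
        On-Γ₀ N (restrict (map e B) f) × Holomorphic (restrict (map e B) f) × Nonconstant (restrict (map e B) f)
      factor B u B⊆ (v , v∈) VB≥0 = onΓ₀ , hol-g , nonconstant
        where
        g : EtaQuotient
        g = restrict (map e B) f
        supp : support g ↭ map e B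
        supp = support-restrict f u B⊆
        onΓ₀ : level g ∣ N
        onΓ₀ = foldr-lcm-∣ (support g) (λ d∈ → support-∣-level f (B⊆ (∈-resp-↭ supp d∈)))
        nonconstant : Nonconstant g
        nonconstant g≈1 = ∈-support⁻ f (B⊆ (∈-map⁺ e v∈)) (trans (sym (restrict-∈ (exponent f) (∈-map⁺ e v∈))) (g≈1 (e v)))
        -- The factor is judged at its own level; the divisors of that level divide N, so they have
        -- exponent vectors over the primes of N.
        hol-g : Holomorphic g
        hol-g t t∣M = at (encodeDivisor N t (∣.∣-trans t∣M onΓ₀))
          where
          at : ∃[ w ] decode pl w ≡ t → 0ℚ ≤ order (level g) t g
          at (w , ew≡t) = proj₂ (0≤order⇔ g (level g) t {{level≢0 g}} un pr {B} {w} (support-∣-level g) ew≡t supp)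
            (subst (0ℚ ≤_) (∑-cong∈ B (λ v v∈ → cong (λ z → ι z * kernel rs w v) (sym (restrict-∈ (exponent f) (∈-map⁺ e v∈)))))
              (VB≥0 w))

      f≈ : f ≈ restrict (map e A) f · restrict (map e O) f
      f≈ d with d ∈? map e A | d ∈? map e O
      ... | yes d∈A | yes d∈O = contradiction d∈O (Unique-++-disjoint unique d∈A)
      ... | yes d∈A | no  _   = sym (ℤ.+-identityʳ (exponent f d))
      ... | no  _   | yes d∈O = sym (ℤ.+-identityˡ (exponent f d))
      ... | no  d∉A | no  d∉O with exponent f d ℤ.≟ 0ℤ
      ... | yes X≡0 = X≡0
      ... | no  Xd≢0 with ∈-++⁻ (map e A) (∈-resp-↭ support↭ (∈-support⁺ f Xd≢0))
      ... | inj₁ d∈A = contradiction d∈A d∉A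
      ... | inj₂ d∈O = contradiction d∈O d∉O

    splits⇒factorizable : Splits ratios recip 1≤ps X S → FactorizableOn-Γ₀ N f
    splits⇒factorizable (A , O , S↭ , a∈ , o∈ , VA≥0 , VO≥0) = restrict (map e A) f , restrict (map e O) f
      , factor A (proj₁ (Unique-++ (map e A) unique)) (λ d∈ → ∈-resp-↭ (↭-sym support↭) (∈-++⁺ˡ d∈)) a∈ VA≥0
      , factor O (proj₂ (Unique-++ (map e A) unique)) (λ d∈ → ∈-resp-↭ (↭-sym support↭) (∈-++⁺ʳ (map e A) d∈)) o∈ VO≥0
      , f≈
      where open Factors {A} {O} S↭

  -- The alternative N = 1 is for the empty support, where there is no point to start a cluster
  -- from.
  level-bound : Primitive f → ¬ FactorizableOn-Γ₀ N f → level f ≡ 1 ⊎ level f ℕ.≤ clusterBound σ ℤ.∣ k ∣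
  level-bound prim irreducible = cases (support f) refl
    where
    boxed : ∀ {d₀} → d₀ ∈ support f → Boxed ratios recip 1≤ps X S (clusterBound σ ℤ.∣ k ∣) → N ℕ.≤ clusterBound σ ℤ.∣ k ∣
    boxed d₀∈ (lo , hi′ , inbox , D≤) = ℕ.≤-trans (∣.∣⇒≤ {{decode≢0 pr hi′}} N∣) (ℕ.≤-trans (ℕ.≤-reflexive hi≡) D≤)
      where
      N∣ : N ∣ e hi′
      N∣ = foldr-lcm-∣ (support f) (λ d∈ → let v , v∈ , d≡ = ∈support⇒∈S d∈ in
        subst (_∣ e hi′) (sym d≡) (decode-mono-∣ pl (proj₂ (inbox v v∈))))
      -- The lower corner decodes to a common divisor of the support, so primitivity makes it 1;
      -- then the upper corner, a multiple of N, decodes to the diameter itself.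
      lo≡1 : e lo ≡ 1
      lo≡1 = gcd-support-trivial f prim d₀∈ (e lo) (λ d∈ → let v , v∈ , d≡ = ∈support⇒∈S d∈ in
        subst (e lo ∣_) (sym d≡) (decode-mono-∣ pl (proj₁ (inbox v v∈))))
      hi≡ : e hi′ ≡ dist (fromList pl) lo hi′
      hi≡ = let v , v∈ , _ = ∈support⇒∈S d₀∈ in
        trans (decode-dist pl (InBox⇒≤ (inbox v v∈))) (trans (cong (ℕ._* dist (fromList pl) lo hi′) lo≡1) (ℕ.+-identityʳ _))
    cases : ∀ L → support f ≡ L → N ≡ 1 ⊎ N ℕ.≤ clusterBound σ ℤ.∣ k ∣
    cases []       eq = inj₁ (cong (foldr lcm 1) eq)
    cases (d₀ ∷ L) eq = inj₂ (either (splits-or-boxed ratios recip 1≤ps X {S} σ ℤ.∣ k ∣ X≢0 V≥0 Π≤σ tot≤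
        (let v , v∈ , _ = ∈support⇒∈S d₀∈ in v , v∈)))
      where
      d₀∈ : d₀ ∈ support f
      d₀∈ = subst (d₀ ∈_) (sym eq) (here refl)
      either : Splits ratios recip 1≤ps X S ⊎ Boxed ratios recip 1≤ps X S (clusterBound σ ℤ.∣ k ∣) → N ℕ.≤ clusterBound σ ℤ.∣ k ∣
      either (inj₁ splits) = contradiction (splits⇒factorizable splits) irreducible
      either (inj₂ box)    = boxed d₀∈ box

-- Growth

Polynomial : (ℕ → ℕ) → Set
Polynomial f = ∃[ c ] ∃[ a ] (∀ L → f L ℕ.≤ c ℕ.* suc L ℕ.^ a)

polynomial-const : ∀ c → Polynomial (λ _ → c)
polynomial-const c = c , 0 , λ L → ℕ.≤-reflexive (sym (ℕ.*-identityʳ c))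

polynomial-+ : ∀ {f g} → Polynomial f → Polynomial g → Polynomial (λ L → f L ℕ.+ g L)
polynomial-+ (c , a , f≤) (d , b , g≤) = c ℕ.+ d , a ℕ.+ b , λ L → ℕ.≤-trans
  (ℕ.+-mono-≤ (ℕ.≤-trans (f≤ L) (ℕ.*-monoʳ-≤ c (ℕ.^-monoʳ-≤ (suc L) (ℕ.m≤m+n a b))))
              (ℕ.≤-trans (g≤ L) (ℕ.*-monoʳ-≤ d (ℕ.^-monoʳ-≤ (suc L) (ℕ.m≤n+m b a)))))
  (ℕ.≤-reflexive (sym (ℕ.*-distribʳ-+ (suc L ℕ.^ (a ℕ.+ b)) c d)))

polynomial-* : ∀ {f g} → Polynomial f → Polynomial g → Polynomial (λ L → f L ℕ.* g L)
polynomial-* (c , a , f≤) (d , b , g≤) = c ℕ.* d , a ℕ.+ b , λ L → ℕ.≤-trans (ℕ.*-mono-≤ (f≤ L) (g≤ L))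
  (ℕ.≤-reflexive (trans (PrimeProducts.*-interchange c (suc L ℕ.^ a) d (suc L ℕ.^ b))
    (cong (c ℕ.* d ℕ.*_) (sym (ℕ.^-distribˡ-+-* (suc L) a b)))))

polynomial-^ : ∀ {f} → Polynomial f → ∀ n → Polynomial (λ L → f L ℕ.^ n)
polynomial-^ pf zero    = polynomial-const 1
polynomial-^ pf (suc n) = polynomial-* pf (polynomial-^ pf n)

n<2^n : ∀ n → suc n ℕ.≤ 2 ℕ.^ n
n<2^n zero    = ℕ.≤-refl
n<2^n (suc n) = ℕ.+-mono-≤ (ℕ.m^n>0 2 n) (subst (suc n ℕ.≤_) (sym (ℕ.+-identityʳ _)) (n<2^n n))

-- With q = L / (a + 1), 2^L ≥ (2^q)^(a+1) ≥ (q + 1)^(a+1), while L + 1 ≤ (a + 1) (q + 1).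
power<exponential : ∀ c a → ∃[ L₀ ] (∀ L → L₀ ℕ.≤ L → c ℕ.* suc L ℕ.^ a ℕ.≤ 2 ℕ.^ L)
power<exponential c a = suc a ℕ.* K , large-L
  where
  K : ℕ
  K = c ℕ.* suc a ℕ.^ a
  large-L : ∀ L → suc a ℕ.* K ℕ.≤ L → c ℕ.* suc L ℕ.^ a ℕ.≤ 2 ℕ.^ L
  large-L L L≥ = begin
    c ℕ.* suc L ℕ.^ a                        ≤⟨ ℕ.*-monoʳ-≤ c (ℕ.^-monoˡ-≤ a L+1≤) ⟩
    c ℕ.* (suc a ℕ.* suc q) ℕ.^ a            ≡⟨ cong (c ℕ.*_) (PrimeProducts.^-distribʳ-* (suc a) (suc q) a) ⟩
    c ℕ.* (suc a ℕ.^ a ℕ.* suc q ℕ.^ a)      ≡⟨ sym (ℕ.*-assoc c (suc a ℕ.^ a) (suc q ℕ.^ a)) ⟩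
    K ℕ.* suc q ℕ.^ a                        ≤⟨ ℕ.*-monoˡ-≤ (suc q ℕ.^ a) (ℕ.m≤n⇒m≤1+n K≤q) ⟩
    suc q ℕ.^ suc a                          ≤⟨ ℕ.^-monoˡ-≤ (suc a) (n<2^n q) ⟩
    (2 ℕ.^ q) ℕ.^ suc a                      ≡⟨ ℕ.^-*-assoc 2 q (suc a) ⟩
    2 ℕ.^ (q ℕ.* suc a)                      ≤⟨ ℕ.^-monoʳ-≤ 2 (ℕ.m/n*n≤m L (suc a)) ⟩
    2 ℕ.^ L                                  ∎
    where
    open ℕ.≤-Reasoning
    q : ℕ
    q = L ℕ./ suc a
    L+1≤ : suc L ℕ.≤ suc a ℕ.* suc q
    L+1≤ = begin
      suc L                                    ≡⟨ cong suc (ℕ.m≡m%n+[m/n]*n L (suc a)) ⟩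
      suc (L ℕ.% suc a) ℕ.+ q ℕ.* suc a        ≤⟨ ℕ.+-monoˡ-≤ (q ℕ.* suc a) (ℕ.m%n<n L (suc a)) ⟩
      suc a ℕ.+ q ℕ.* suc a                    ≡⟨ ℕ.*-comm (suc q) (suc a) ⟩
      suc a ℕ.* suc q                          ∎
    K≤q : K ℕ.≤ q
    K≤q = subst (ℕ._≤ q) (trans (cong (ℕ._/ suc a) (ℕ.*-comm (suc a) K)) (ℕ.m*n/n≡m K (suc a))) (ℕ./-monoˡ-≤ (suc a) L≥)

-- The shift from `suc L` to L is what lets one round of `descent` lower L by one.
polynomial<exponential : ∀ {f} → Polynomial f → ∃[ L₀ ] (∀ L → L₀ ℕ.≤ L → f (suc L) ℕ.≤ 2 ℕ.^ L)
polynomial<exponential {f} (c , a , f≤) with power<exponential (c ℕ.* 2 ℕ.^ a) a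
... | L₀ , large-L = L₀ , λ L L≥ → begin
    f (suc L)                                ≤⟨ f≤ (suc L) ⟩
    c ℕ.* suc (suc L) ℕ.^ a                  ≤⟨ ℕ.*-monoʳ-≤ c (ℕ.^-monoˡ-≤ a (2+≤ L)) ⟩
    c ℕ.* (2 ℕ.* suc L) ℕ.^ a                ≡⟨ cong (c ℕ.*_) (PrimeProducts.^-distribʳ-* 2 (suc L) a) ⟩
    c ℕ.* (2 ℕ.^ a ℕ.* suc L ℕ.^ a)          ≡⟨ sym (ℕ.*-assoc c (2 ℕ.^ a) (suc L ℕ.^ a)) ⟩
    c ℕ.* 2 ℕ.^ a ℕ.* suc L ℕ.^ a            ≤⟨ large-L L L≥ ⟩
    2 ℕ.^ L                                  ∎
  where
  open ℕ.≤-Reasoning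
  2+≤ : ∀ L → suc (suc L) ℕ.≤ 2 ℕ.* suc L
  2+≤ L = ℕ.s≤s (subst (ℕ._≤ L ℕ.+ (suc L ℕ.+ 0)) (ℕ.+-comm L 1) (ℕ.+-monoʳ-≤ L (ℕ.s≤s ℕ.z≤n)))

growth-const : ∀ ρ m x → growth (λ _ → ρ) m (2 ℕ.^ x) ℕ.≤ 2 ℕ.^ (m ℕ.* ρ ℕ.+ x)
growth-const ρ zero    x = ℕ.≤-refl
growth-const ρ (suc m) x = ℕ.≤-trans
  (growth-monoʳ {λ _ → ρ} (λ _ → ℕ.≤-refl) m (ℕ.≤-trans (ℕ.*-monoˡ-≤ (2 ℕ.^ x) (ℕ.<⇒≤ (n<2^n ρ))) (ℕ.≤-reflexive (sym (ℕ.^-distribˡ-+-* 2 ρ x)))))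
  (ℕ.≤-trans (growth-const ρ m (ρ ℕ.+ x)) (ℕ.≤-reflexive (cong (2 ℕ.^_)
    (ℕ-solve 3 (λ a r x → a ⊕ (r ⊕ x) ⊜ (r ⊕ a) ⊕ x) refl (m ℕ.* ρ) ρ x))))

-- For D = 2^x a step yields at most 2^(2x + s), so the exponent plus s doubles each time.
growth-square : ∀ s m x → growth (λ D → suc (s ℕ.* D)) m (2 ℕ.^ x) ℕ.≤ 2 ℕ.^ (2 ℕ.^ m ℕ.* (x ℕ.+ s))
growth-square s zero    x = ℕ.^-monoʳ-≤ 2 (ℕ.≤-trans (ℕ.m≤m+n x s) (ℕ.m≤m+n _ 0))
growth-square s (suc m) x = ℕ.≤-trans
  (growth-monoʳ {λ D → suc (s ℕ.* D)} (λ a≤b → ℕ.s≤s (ℕ.*-monoʳ-≤ s a≤b)) m step)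
  (ℕ.≤-trans (growth-square s m (s ℕ.+ x ℕ.+ x)) (ℕ.≤-reflexive (cong (2 ℕ.^_) (rearrange (2 ℕ.^ m) s x))))
  where
  open ℕ.≤-Reasoning
  rearrange : ∀ p s x → p ℕ.* (s ℕ.+ x ℕ.+ x ℕ.+ s) ≡ (p ℕ.+ (p ℕ.+ 0)) ℕ.* (x ℕ.+ s)
  rearrange p s x rewrite ℕ.+-identityʳ p =
    ℕ-solve 3 (λ p s x → p ⊗ (s ⊕ x ⊕ x ⊕ s) ⊜ (p ⊕ p) ⊗ (x ⊕ s)) refl p s x
  D : ℕ
  D = 2 ℕ.^ x
  step : suc (s ℕ.* D) ℕ.* D ℕ.≤ 2 ℕ.^ (s ℕ.+ x ℕ.+ x)
  step = begin
    suc (s ℕ.* D) ℕ.* D             ≤⟨ ℕ.*-monoˡ-≤ D (ℕ.+-monoˡ-≤ (s ℕ.* D) (ℕ.m^n>0 2 x)) ⟩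
    suc s ℕ.* D ℕ.* D               ≤⟨ ℕ.*-monoˡ-≤ D (ℕ.*-monoˡ-≤ D (n<2^n s)) ⟩
    2 ℕ.^ s ℕ.* D ℕ.* D             ≡⟨ sym (trans (ℕ.^-distribˡ-+-* 2 (s ℕ.+ x) x) (cong (ℕ._* D) (ℕ.^-distribˡ-+-* 2 s x))) ⟩
    2 ℕ.^ (s ℕ.+ x ℕ.+ x)           ∎

-- A bound for the binary logarithm of `clusterBound`; for fixed k the factor 2^k is constant and
-- the rest is cubic in σ.
clusterExponent : ℕ → ℕ → ℕ
clusterExponent k σ = 2 ℕ.^ k ℕ.* ((σ ℕ.* k) ℕ.* (1 ℕ.+ (1 ℕ.+ σ) ℕ.* (σ ℕ.* k)) ℕ.+ σ ℕ.* k)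

clusterBound≤ : ∀ k σ → clusterBound σ k ℕ.≤ 2 ℕ.^ clusterExponent k σ
clusterBound≤ k σ = ℕ.≤-trans
  (growth-monoʳ {λ D → suc (s ℕ.* D)} (λ a≤b → ℕ.s≤s (ℕ.*-monoʳ-≤ s a≤b)) k
    (ℕ.≤-trans (growth-const ρ s 0) (ℕ.≤-reflexive (cong (2 ℕ.^_) (ℕ.+-identityʳ (s ℕ.* ρ))))))
  (growth-square s k (s ℕ.* ρ))
  where
  s ρ : ℕ
  s = σ ℕ.* k
  ρ = suc ((1 ℕ.+ σ) ℕ.* s)

polynomial-clusterExponent : ∀ k {σ} → Polynomial σ → Polynomial (λ L → clusterExponent k (σ L))
polynomial-clusterExponent k pσ = polynomial-* (polynomial-const (2 ℕ.^ k))
  (polynomial-+ (polynomial-* ps (polynomial-+ (polynomial-const 1) (polynomial-* (polynomial-+ (polynomial-const 1) pσ) ps))) ps)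
  where
  ps = polynomial-* pσ (polynomial-const k)

-- From N ≤ 2^(2^(L+1)) follows N ≤ B(L+1) ≤ 2^(2^L) unless N = 1, so L can be lowered until it
-- reaches L₀. The start L = N is wasteful but always available, and the final bound does not depend
-- on it.
descent : ∀ {N} (B : ℕ → ℕ) {L₀} → (∀ L → L₀ ℕ.≤ L → B (suc L) ℕ.≤ 2 ℕ.^ (2 ℕ.^ L)) →
  (∀ L → N ℕ.≤ 2 ℕ.^ (2 ℕ.^ L) → N ≡ 1 ⊎ N ℕ.≤ B L) → N ℕ.≤ 2 ℕ.^ (2 ℕ.^ L₀)
descent {N} B {L₀} B≤ N≤B = go N (ℕ.≤-trans (ℕ.<⇒≤ (n<2^n N)) (ℕ.^-monoʳ-≤ 2 (ℕ.<⇒≤ (n<2^n N))))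
  where
  go : ∀ L → N ℕ.≤ 2 ℕ.^ (2 ℕ.^ L) → N ℕ.≤ 2 ℕ.^ (2 ℕ.^ L₀)
  go zero    N≤ = ℕ.≤-trans N≤ (ℕ.^-monoʳ-≤ 2 (ℕ.^-monoʳ-≤ 2 {0} {L₀} ℕ.z≤n))
  go (suc L) N≤ with suc L ℕ.≤? L₀
  ... | yes L<L₀ = ℕ.≤-trans N≤ (ℕ.^-monoʳ-≤ 2 (ℕ.^-monoʳ-≤ 2 L<L₀))
  ... | no  L≮L₀ with N≤B (suc L) N≤
  ... | inj₁ refl = ℕ.m^n>0 2 (2 ℕ.^ L₀)
  ... | inj₂ N≤′  = go L (ℕ.≤-trans N≤′ (B≤ L (ℕ.≮⇒≥ L≮L₀)))

-- Enumeration

setExponent : ℕ → ℤ → (ℕ → ℤ) → ℕ → ℤ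
setExponent b x X d with d ℕ.≟ b
... | yes _ = x
... | no  _ = X d

set : ℕ → EtaQuotient → ℤ → EtaQuotient
set b g x = record
  { exponent   = setExponent (suc b) x (exponent g)
  ; exponent-0 = exponent-0 g
  ; bound      = bound g ⊔ suc b
  ; vanishes   = beyond
  }
  where
  beyond : ∀ d → bound g ⊔ suc b ℕ.< d → setExponent (suc b) x (exponent g) d ≡ 0ℤ
  beyond d b<d with d ℕ.≟ suc b
  ... | yes refl = contradiction (ℕ.m≤n⊔m (bound g) (suc b)) (ℕ.<⇒≱ b<d)
  ... | no  _    = vanishes g d (ℕ.≤-<-trans (ℕ.m≤m⊔n (bound g) (suc b)) b<d)

-- Lists 0 twice, which does no harm to a list that only has to be exhaustive.
integers : ℕ → List ℤ
integers s = map +_ (upTo (suc s)) ++ map (λ m → ℤ.- (+ m)) (upTo (suc s))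

∈-integers : ∀ {s x} → ℤ.∣ x ∣ ℕ.≤ s → x ∈ integers s
∈-integers {s} {+ m}      m≤s = ∈-++⁺ˡ (∈-map⁺ +_ (∈-upTo⁺ (ℕ.s≤s m≤s)))
∈-integers {s} { -[1+ m ]} m<s = ∈-++⁺ʳ (map +_ (upTo (suc s))) (∈-map⁺ (λ m → ℤ.- (+ m)) (∈-upTo⁺ (ℕ.s≤s m<s)))

enumerate : ℕ → ℕ → List EtaQuotient
enumerate s zero    = 𝟏 ∷ []
enumerate s (suc b) = cartesianProductWith (set b) (enumerate s b) (integers s)

-- With the exponent at b + 1 erased the quotient is listed by induction, and putting it back is one
-- of finitely many choices.
enumerate-complete : ∀ s b f → (∀ d → b ℕ.< d → exponent f d ≡ 0ℤ) → (∀ d → ℤ.∣ exponent f d ∣ ℕ.≤ s) →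
  Any (f ≈_) (enumerate s b)
enumerate-complete s zero    f X≡0 X≤s = here λ { zero → exponent-0 f ; (suc d) → X≡0 (suc d) (ℕ.s≤s ℕ.z≤n) }
enumerate-complete s (suc b) f X≡0 X≤s with find (enumerate-complete s b (set b f 0ℤ) X′≡0 X′≤s)
  where
  X′≡0 : ∀ d → b ℕ.< d → exponent (set b f 0ℤ) d ≡ 0ℤ
  X′≡0 d b<d with d ℕ.≟ suc b
  ... | yes _ = refl
  ... | no d≢ = X≡0 d (ℕ.≤∧≢⇒< b<d (λ e → d≢ (sym e)))
  X′≤s : ∀ d → ℤ.∣ exponent (set b f 0ℤ) d ∣ ℕ.≤ s
  X′≤s d with d ℕ.≟ suc b
  ... | yes _ = ℕ.z≤n
  ... | no  _ = X≤s d
... | g , g∈ , f′≈g = lose (∈-cartesianProductWith⁺ (set b) g∈ (∈-integers (X≤s (suc b)))) f≈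
  where
  f≈ : f ≈ set b g (exponent f (suc b))
  f≈ d with d ℕ.≟ suc b | f′≈g d
  ... | yes refl | _  = refl
  ... | no  _    | eq = eq

-- Closing the circle between the level and its primes

opaque
  -- The exponent is the 16 of 1 + 16/p, by way of `amplification-bound`.
  primeBound : ℕ → ℕ
  primeBound L = sucBound L ℕ.^ 16

  polynomial-primeBound : Polynomial primeBound
  polynomial-primeBound = polynomial-^ {sucBound} (8 , 4 , λ L → ℕ.≤-reflexive (sucBound-≡ L)) 16

  amplification≤primeBound : ∀ f L → level f ℕ.≤ 2 ℕ.^ (2 ℕ.^ L) →
    amplification (reciprocals (primesOf (level f))) ℚ.≤ ιℕ (primeBound L)
  amplification≤primeBound f L N≤ = amplification≤sucBound L
    (primesOf-unique (level f) {{level≢0 f}}) (primesOf-prime (level f) {{level≢0 f}})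
    (PrimeProducts.2^-cancel (ℕ.≤-trans (2^length-primesOf (level f) {{level≢0 f}}) N≤))

-- Of the primes only this enters: an amplification bound σ(L) for levels up to 2^(2^L) that grows
-- slowly enough for `clusterExponent` to fall below 2^L in the end.
finite : ∀ k (σ : ℕ → ℕ) L₀ →
  (∀ f L → level f ℕ.≤ 2 ℕ.^ (2 ℕ.^ L) → amplification (reciprocals (primesOf (level f))) ℚ.≤ ιℕ (σ L)) →
  (∀ L → L₀ ℕ.≤ L → clusterExponent ℤ.∣ k ∣ (σ (suc L)) ℕ.≤ 2 ℕ.^ L) →
  Finite (λ f → Simple f × weight f ≡ k / 2)
finite k σ L₀ Π≤σ eventually = enumerate s N₀ , complete
  where
  N₀ s : ℕ
  N₀ = 2 ℕ.^ (2 ℕ.^ L₀)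
  -- Once N ≤ N₀ is known, `σ L₀` bounds the amplification uniformly in f, and with it all
  -- exponents.
  s  = σ L₀ ℕ.* ℤ.∣ k ∣
  complete : ∀ f → Simple f × weight f ≡ k / 2 → Any (f ≈_) (enumerate s N₀)
  complete f ((prim , hol , irreducible) , wt≡) = enumerate-complete s N₀ f X≡0
    (exponent-bound f hol k wt≡ (σ L₀) (Π≤σ f L₀ N≤N₀))
    where
    N≤N₀ : level f ℕ.≤ N₀
    N≤N₀ = descent (λ L → clusterBound (σ L) ℤ.∣ k ∣)
      (λ L L≥ → ℕ.≤-trans (clusterBound≤ ℤ.∣ k ∣ (σ (suc L))) (ℕ.^-monoʳ-≤ 2 (eventually L L≥)))
      (λ L N≤ → level-bound f hol k wt≡ (σ L) (Π≤σ f L N≤) prim irreducible)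
    X≡0 : ∀ d → N₀ ℕ.< d → exponent f d ≡ 0ℤ
    X≡0 d N₀<d with exponent f d ℤ.≟ 0ℤ
    ... | yes eq = eq
    ... | no  X≢0 = contradiction (ℕ.≤-trans (∣.∣⇒≤ {{level≢0 f}} (support-∣-level f (∈-support⁺ f X≢0))) N≤N₀) (ℕ.<⇒≱ N₀<d)

mainTheorem1 : (k : ℤ) → Finite (λ f → Simple f × weight f ≡ k / 2)
mainTheorem1 k = finite k primeBound (proj₁ eventually) amplification≤primeBound (proj₂ eventually)
  where
  eventually : ∃[ L₀ ] (∀ L → L₀ ℕ.≤ L → clusterExponent ℤ.∣ k ∣ (primeBound (suc L)) ℕ.≤ 2 ℕ.^ L)
  eventually = polynomial<exponential (polynomial-clusterExponent ℤ.∣ k ∣ polynomial-primeBound)
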